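{- Let $\mathcal{L}: x+y-z=0$ be Schur's equation. Then $d(\mathcal{L},\varepsilon)=\Theta(\varepsilon)$; that is, there exist absolute constants $c,C>0$ such that $c\varepsilon\le d(\mathcal{L},\varepsilon)\le C\varepsilon$ for all $\varepsilon\in(0,1]$.
   Context: For a prime $p$, a set $A\subseteq\mathbb{F}_p$ is solution-free for a homogeneous linear equation $\sum_{i\in[k]} c_i x_i=0$ if there is no $k$-tuple of pairwise distinct elements of $A$ satisfying it in $\mathbb{F}_p$. The Cayley graph $\mathrm{Cay}_{\mathbb{F}_p}(A)$ is the digraph on $\mathbb{F}_p$ with an arc $\vec{uv}$ iff $v-u\in A$; $\alpha$ of a digraph is the independence number of its underlying undirected graph. $D(\mathcal{L},\varepsilon,p)$ is the maximum size of a solution-free set $A$ of $\mathcal{L}$ in $\mathbb{F}_p$ with $\alpha(\mathrm{Cay}_{\mathbb{F}_p}(A))\le\varepsilon p$, and $d(\mathcal{L},\varepsilon):=\limsup_{p\to\infty,\ p\text{ prime}} D(\mathcal{L},\varepsilon,p)/p$.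
   Formalization: The bounds are stated for rational ε in (0,1] (with rational constants c, C) rather than all real ε; the real case follows since d(L,ε) is monotone in ε. -}

module Defs where

open import Data.Nat as ℕ using (ℕ)
open import Data.Nat.Primality using (Prime)
open import Data.Integer as ℤ using (ℤ; +_)
open import Data.Integer.Divisibility using () renaming (_∣_ to _∣ℤ_)
open import Data.Fin using (Fin; toℕ)
open import Data.Fin.Subset using (Subset; _∈_; ∣_∣)
open import Data.Rational as ℚ using (ℚ)
open import Data.Product using (Σ; ∃; _×_; _,_)
open import Relation.Nullary using (¬_)
open import Relation.Binary.PropositionalEquality using (_≢_)

-- The element x ∈ F_p is represented by x : Fin p; arithmetic is mod p,
-- expressed through divisibility by p in ℤ.
toℤ : {p : ℕ} → Fin p → ℤ
toℤ x = + toℕ x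

ℕ→ℚ : ℕ → ℚ
ℕ→ℚ n = + n ℚ./ 1

SchurSolutionFree : (p : ℕ) → Subset p → Set
SchurSolutionFree p A =
  ¬ (Σ (Fin p) λ x → Σ (Fin p) λ y → Σ (Fin p) λ z →
       (x ∈ A) × (y ∈ A) × (z ∈ A) ×
       (x ≢ y) × (x ≢ z) × (y ≢ z) ×
       ((+ p) ∣ℤ ((toℤ x ℤ.+ toℤ y) ℤ.- toℤ z)))

Arc : (p : ℕ) → Subset p → Fin p → Fin p → Set
Arc p A u v = Σ (Fin p) λ a → (a ∈ A) × ((+ p) ∣ℤ ((toℤ v ℤ.- toℤ u) ℤ.- toℤ a))

-- I is independent in the underlying undirected (loopless) graph of Cay(A):
-- no two distinct vertices of I are joined by an arc in either direction.
Independent : (p : ℕ) → Subset p → Subset p → Set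
Independent p A I = ∀ u v → u ∈ I → v ∈ I → u ≢ v → ¬ Arc p A u v

AlphaAtMost : (p : ℕ) → Subset p → ℚ → Set
AlphaAtMost p A ε = ∀ (I : Subset p) → Independent p A I → ℕ→ℚ ∣ I ∣ ℚ.≤ ε ℚ.* ℕ→ℚ p

Admissible : ℚ → (p : ℕ) → Subset p → Set
Admissible ε p A = SchurSolutionFree p A × AlphaAtMost p A ε

-- "D(L,ε,p) ≤ m·p" (D is the maximum of |A| over admissible A)
DAtMost : ℚ → ℕ → ℚ → Set
DAtMost ε p m = ∀ (A : Subset p) → Admissible ε p A → ℕ→ℚ ∣ A ∣ ℚ.≤ m ℚ.* ℕ→ℚ p

DAtLeast : ℚ → ℕ → ℚ → Set
DAtLeast ε p m = Σ (Subset p) λ A → Admissible ε p A × (m ℚ.* ℕ→ℚ p ℚ.≤ ℕ→ℚ ∣ A ∣)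

-- d(L,ε) = limsup_{p prime} D(L,ε,p)/p ≤ L
dAtMost : ℚ → ℚ → Set
dAtMost ε L = ∀ (δ : ℚ) → ℚ.0ℚ ℚ.< δ → ∃ λ N → ∀ p → Prime p → N ℕ.≤ p → DAtMost ε p (L ℚ.+ δ)

-- d(L,ε) = limsup_{p prime} D(L,ε,p)/p ≥ L
dAtLeast : ℚ → ℚ → Set
dAtLeast ε L = ∀ (δ : ℚ) → ℚ.0ℚ ℚ.< δ → ∀ (N : ℕ) → Σ ℕ λ p → Prime p × (N ℕ.≤ p) × DAtLeast ε p (L ℚ.- δ)

module Submission where

-- Upper bound.  If A is sum-free, two distinct nonzero elements of A are joined by an arc of the Cayley graph only if
-- one is twice the other.  The doubling graph on 𝔽_p ∖ {0} has a proper 4-colouring, so A splits into five independent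
-- sets and |A| ≤ 5 α.
--
-- Lower bound.  For a prime q and k = ⌊q/4⌋ the set S = {(ρ y, y, ρ y²) : 1 ≤ ρ < 2k, y ≠ 0} ⊆ 𝔽_q³ is sum-free, since
-- two elements with parameters (ρ, y), (ρ′, y′) have their sum in S only if (ρ + ρ′) y y′ = 0.  Every set I ⊆ 𝔽_q³
-- without differences in S has at most 15 q² elements.  Indeed, write ρ as a difference t′ - t with t ∈ [0, k) and
-- t′ ∈ [k, 2k), and let L_y f be the sum of f over translates by the multiples of (y, y², 1) in 𝔽_q³.  With h_b the
-- indicator function of {(a, c) : (a, b, c) ∈ I} × [0, k) and h′_b that of the same set times [k, 2k), the function
-- L_y h_b is orthogonal to h′_{b+y} for y ≠ 0.  On the other hand, any three of the vectors (y, y², 1) are linearly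
-- independent, so Σ_y ⟨f, L_y f⟩ ≤ 2q ⟨f, f⟩ for all f of mean 0, and h_b, h′_{b+y} are nearly uncorrelated on average.
--
-- Such a set S of density about 1/q is transplanted to 𝔽_p for p large by replacing each point with an interval; an
-- average over translates carries the bound for independent sets over.  Chebyshev's estimates provide a prime q within a
-- constant factor of 1/ε.

open import Defs
open import Data.Nat as ℕ using (ℕ; NonZero)
import Data.Nat.Properties as ℕ
import Data.Nat.DivMod as ℕ
open import Data.Nat.Primality using (Prime; prime⇒nonZero)
import Data.Nat.Tactic.RingSolver as ℕ-Solver
open import Data.Integer as ℤ using (ℤ)
import Data.Integer.Properties as ℤ
open import Data.Fin.Subset as Subset using (Subset)
open import Data.Empty using (⊥)
open import Data.Product using (Σ; ∃; _×_; _,_; proj₁; proj₂)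
open import Data.Sum using (inj₁; inj₂)
open import Function using (_∘_; Injective)
open import Relation.Binary.PropositionalEquality
open import Relation.Nullary using (¬_; Dec; yes; no; contradiction; does; ¬?; _×-dec_)
open import Relation.Nullary.Decidable using (dec-true; map′)

-- Since |A| ≤ 5 α, the lower bound calls for a sum-free set whose Cayley graph has independence
-- number of the order of its degree. The constant 2 in 2q is visible on the Fourier side: on the
-- character of 𝔽_q³ with frequencies (ξ, η, τ) the operator L_y acts as q if ξ y + η y² + τ = 0 and
-- as 0 otherwise, and a nonzero quadratic has at most two roots y. The formal argument stays in ℤ:
-- characters are replaced by identities between products of the L_y, and denominators are cleared.
-- The coordinates (a, c, t) are not those of I. The coordinate b only records y and is treated by
-- summing over pairs of sections; t is new and records ρ. It is needed because ρ cannot run over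
-- all of 𝔽_q: sum-freeness requires ρ + ρ′ ≠ 0, which ρ < 2k with 4k ≤ q guarantees. Windows of
-- length k in t have positive density, so this costs a constant factor only. The 15 is 1 + 2 · 7:
-- the spectral argument gives k |I| ≤ k q² + 2 q³, and q ≤ 4k + 3 ≤ 7k.

module Primes where

  open import Data.Nat
  open import Data.Nat.Properties
  open import Data.Nat.Divisibility
  open import Data.Nat.DivMod using (m/n*n≡m)
  open import Data.Nat.Combinatorics using (_C_; nCk+nC[k+1]≡[n+1]C[k+1]; nCn≡1; nC1≡n; nCk≡nC[n∸k]; k>n⇒nCk≡0;
      nCk≡n!/k![n-k]!; k![n∸k]!∣n!)
  open import Data.Nat.Primality
  open import Data.Nat.Primality.Factorisation using (factorise)
  open import Data.Nat.Induction using (<-rec)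
  open import Data.Nat.ListAction using (product)
  open import Data.Nat.Tactic.RingSolver using (solve-∀)
  open import Data.List using (List; []; _∷_; _++_; length; filter; applyUpTo)
  open import Data.List.Properties using (length-++)
  open import Data.List.Membership.Propositional using (_∈_)
  open import Data.List.Membership.Propositional.Properties using (∈-filter⁺; ∈-filter⁻; ∈-applyUpTo⁺; ∈-applyUpTo⁻;
      ∈-++⁺ˡ; ∈-++⁺ʳ)
  open import Data.List.Relation.Unary.All as All using (All; []; _∷_)
  open import Data.List.Relation.Unary.All.Properties using (++⁺)
  open import Data.List.Relation.Unary.Any using (here; there)
  open import Data.List.Relation.Unary.AllPairs using ([]; _∷_)
  open import Data.List.Relation.Unary.Unique.Propositional using (Unique)
  import Data.List.Relation.Unary.Unique.Propositional.Properties as Unique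

  -- Divisibility and size of binomial coefficients.

  nC0≡1 : ∀ n → n C 0 ≡ 1
  nC0≡1 n = trans (nCk≡nC[n∸k] {k = 0} {n = n} z≤n) (nCn≡1 n)

  [k+1]*[n+1]C[k+1]≡[n+1]*nCk : ∀ n k → suc k * (suc n C suc k) ≡ suc n * (n C k)
  [k+1]*[n+1]C[k+1]≡[n+1]*nCk zero    zero    = refl
  [k+1]*[n+1]C[k+1]≡[n+1]*nCk zero    (suc k) = trans (cong (suc (suc k) *_) (k>n⇒nCk≡0 (s<s (s≤s (z≤n {k})))))
    (trans (*-zeroʳ (suc (suc k))) (sym (cong (1 *_) (k>n⇒nCk≡0 (s≤s (z≤n {k}))))))
  [k+1]*[n+1]C[k+1]≡[n+1]*nCk (suc n) zero    = trans (cong (1 *_) (nC1≡n (suc (suc n))))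
      (trans (*-comm 1 (suc (suc n))) (cong (suc (suc n) *_) (sym (nC0≡1 (suc n)))))
  [k+1]*[n+1]C[k+1]≡[n+1]*nCk (suc n) (suc k) = begin
    suc (suc k) * (suc (suc n) C suc (suc k))
      ≡⟨ cong (suc (suc k) *_) (sym (nCk+nC[k+1]≡[n+1]C[k+1] (suc n) (suc k))) ⟩
    suc (suc k) * (x + suc n C suc (suc k))
      ≡⟨ *-distribˡ-+ (suc (suc k)) x _ ⟩
    suc (suc k) * x + suc (suc k) * (suc n C suc (suc k))
      ≡⟨ cong₂ (λ u v → x + u + v) ([k+1]*[n+1]C[k+1]≡[n+1]*nCk n k) ([k+1]*[n+1]C[k+1]≡[n+1]*nCk n (suc k)) ⟩
    x + suc n * (n C k) + suc n * (n C suc k)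
      ≡⟨ trans (+-assoc x _ _) (cong (x +_) (sym (*-distribˡ-+ (suc n) (n C k) (n C suc k)))) ⟩
    x + suc n * (n C k + n C suc k)
      ≡⟨ cong (λ u → x + suc n * u) (nCk+nC[k+1]≡[n+1]C[k+1] n k) ⟩
    suc (suc n) * x ∎
    where
    open ≡-Reasoning
    x = suc n C suc k

  -- In the Leibniz harmonic triangle 1/((k+1)C(n,k+1)) = 1/(k C(n-1,k)) - 1/(k C(n,k)), and the boundary entries are 1/n.
  k*nCk∣ : ∀ N X → (∀ d → 1 ≤ d → d ≤ N → d ∣ X) → ∀ n k → k ≤ n → suc n ≤ N → suc k * (suc n C suc k) ∣ X
  k*nCk∣ N X all n       zero    k≤n n<N = subst (_∣ X) (sym (trans (*-identityˡ (suc n C 1)) (nC1≡n (suc n))))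
      (all (suc n) (s≤s z≤n) n<N)
  k*nCk∣ N X all (suc n) (suc k) (s≤s k≤n) n<N with k*nCk∣ N X all n k k≤n (≤-trans (n≤1+n (suc n)) n<N) | k*nCk∣ N X
      all (suc n) k (≤-trans k≤n (n≤1+n n)) n<N
  ... | divides e₁ eq₁ | divides e₂ eq₂ = divides (e₁ ∸ e₂)
      (*-cancelˡ-≡ X ((e₁ ∸ e₂) * (K * (suc (suc n) C suc (suc k)))) k′ (begin
    k′ * X                                    ≡⟨ m+n∸n≡m (k′ * X) (l * X) ⟨
    (k′ * X + l * X) ∸ l * X                  ≡⟨ cong₂ _∸_ (trans (sym (*-distribʳ-+ X k′ l)) (cong (_* X) n≡)) eq₄ ⟩
    suc (suc n) * X ∸ e₂ * (k′ * (suc (suc n) * c))  ≡⟨ cong (_∸ e₂ * (k′ * (suc (suc n) * c)))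
        (trans (cong (suc (suc n) *_) eq₁) (ring₁ (suc (suc n)) e₁ k′ c)) ⟩
    e₁ * (k′ * (suc (suc n) * c)) ∸ e₂ * (k′ * (suc (suc n) * c))  ≡⟨ *-distribʳ-∸ (k′ * (suc (suc n) * c)) e₁ e₂ ⟨
    (e₁ ∸ e₂) * (k′ * (suc (suc n) * c))      ≡⟨ ring₂ (e₁ ∸ e₂) k′ (suc (suc n) * c) ⟩
    k′ * ((e₁ ∸ e₂) * (suc (suc n) * c))      ≡⟨ cong (λ u → k′ * ((e₁ ∸ e₂) * u))
        (sym ([k+1]*[n+1]C[k+1]≡[n+1]*nCk (suc n) (suc k))) ⟩
    k′ * ((e₁ ∸ e₂) * (K * (suc (suc n) C suc (suc k)))) ∎))
    where
    open ≡-Reasoning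
    k′ = suc k
    K = suc (suc k)
    c = suc n C suc k
    b = suc (suc n) C suc k
    l = suc (suc n) ∸ k′
    n≡ : k′ + l ≡ suc (suc n)
    n≡ = m+[n∸m]≡n (s≤s (≤-trans k≤n (n≤1+n n)))
    ring₁ : ∀ n e k c → n * (e * (k * c)) ≡ e * (k * (n * c))
    ring₁ = solve-∀
    ring₂ : ∀ e k x → e * (k * x) ≡ k * (e * x)
    ring₂ = solve-∀
    ring₃ : ∀ l e k b → l * (e * (k * b)) ≡ e * (k * (l * b))
    ring₃ = solve-∀
    lb≡ : l * b ≡ suc (suc n) * c
    lb≡ = +-cancelˡ-≡ (k′ * b) _ _ (begin
      k′ * b + l * b                 ≡⟨ sym (*-distribʳ-+ b k′ l) ⟩
      (k′ + l) * b                   ≡⟨ cong (_* b) n≡ ⟩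
      suc (suc n) * b                ≡⟨ cong (suc (suc n) *_) (sym (nCk+nC[k+1]≡[n+1]C[k+1] (suc n) k)) ⟩
      suc (suc n) * (suc n C k + c)  ≡⟨ *-distribˡ-+ (suc (suc n)) (suc n C k) c ⟩
      suc (suc n) * (suc n C k) + suc (suc n) * c  ≡⟨ cong (_+ suc (suc n) * c)
          (sym ([k+1]*[n+1]C[k+1]≡[n+1]*nCk (suc n) k)) ⟩
      k′ * b + suc (suc n) * c       ∎)
    eq₄ : l * X ≡ e₂ * (k′ * (suc (suc n) * c))
    eq₄ = trans (cong (l *_) eq₂) (trans (ring₃ l e₂ k′ b) (cong (λ u → e₂ * (k′ * u)) lb≡))

  nCk≤2^n : ∀ n k → n C k ≤ 2 ^ n
  nCk≤2^n n       zero    = ≤-trans (≤-reflexive (nC0≡1 n)) (m^n>0 2 n)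
  nCk≤2^n zero    (suc k) = ≤-trans (≤-reflexive (k>n⇒nCk≡0 (s≤s (z≤n {k})))) z≤n
  nCk≤2^n (suc n) (suc k) = begin
    suc n C suc k        ≡⟨ nCk+nC[k+1]≡[n+1]C[k+1] n k ⟨
    n C k + n C suc k    ≤⟨ +-mono-≤ (nCk≤2^n n k) (nCk≤2^n n (suc k)) ⟩
    2 ^ n + 2 ^ n        ≡⟨ cong (2 ^ n +_) (+-identityʳ (2 ^ n)) ⟨
    2 ^ suc n            ∎
    where open ≤-Reasoning

  nCk≤[n+1]Ck : ∀ n k → n C k ≤ suc n C k
  nCk≤[n+1]Ck n zero    = ≤-reflexive (trans (nC0≡1 n) (sym (nC0≡1 (suc n))))
  nCk≤[n+1]Ck n (suc k) = subst (n C suc k ≤_) (nCk+nC[k+1]≡[n+1]C[k+1] n k) (m≤n+m (n C suc k) (n C k))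

  nCk≤[n+1]C[k+1] : ∀ n k → n C k ≤ suc n C suc k
  nCk≤[n+1]C[k+1] n k = subst (n C k ≤_) (nCk+nC[k+1]≡[n+1]C[k+1] n k) (m≤m+n (n C k) (n C suc k))

  -- By Pascal's rule each central coefficient is the sum of two terms that dominate the previous
  -- one. The true growth rate 4 is not sought, since only constants are at stake.
  2^n≤[n+n]Cn : ∀ n → 2 ^ n ≤ (n + n) C n
  2^n≤[n+n]Cn zero    = ≤-refl
  2^n≤[n+n]Cn (suc n) = begin
    2 ^ n + (2 ^ n + 0)              ≡⟨ cong (2 ^ n +_) (+-identityʳ (2 ^ n)) ⟩
    2 ^ n + 2 ^ n                    ≤⟨ +-mono-≤ (2^n≤[n+n]Cn n) (2^n≤[n+n]Cn n) ⟩
    (n + n) C n + (n + n) C n        ≤⟨ +-mono-≤ (nCk≤[n+1]Ck (n + n) n) (nCk≤[n+1]C[k+1] (n + n) n) ⟩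
    suc (n + n) C n + suc (n + n) C suc n  ≡⟨ nCk+nC[k+1]≡[n+1]C[k+1] (suc (n + n)) n ⟩
    suc (suc (n + n)) C suc n        ≡⟨ cong (λ m → suc m C suc n) (+-suc n n) ⟨
    (suc n + suc n) C suc n          ∎
    where open ≤-Reasoning

  [n+n]Cn*n!*n!≡[n+n]! : ∀ n → ((n + n) C n) * (n ! * n !) ≡ (n + n) !
  [n+n]Cn*n!*n!≡[n+n]! n = begin
    ((n + n) C n) * (n ! * n !)             ≡⟨ cong (λ m → ((n + n) C n) * (n ! * m !)) (m+n∸n≡m n n) ⟨
    ((n + n) C n) * (n ! * (n + n ∸ n) !)   ≡⟨ cong (_* (n ! * (n + n ∸ n) !)) (nCk≡n!/k![n-k]! (m≤m+n n n)) ⟩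
    _                                       ≡⟨ m/n*n≡m (k![n∸k]!∣n! (m≤m+n n n)) ⟩
    (n + n) !                               ∎
    where
    open ≡-Reasoning
    instance _ = n !* (n + n ∸ n) !≢0

  -- Chebyshev's upper bound for the number of primes.

  prime∣n!⇒≤ : ∀ {p} n → Prime p → p ∣ n ! → p ≤ n
  prime∣n!⇒≤ zero    p-prime p∣1  = contradiction (subst Prime (∣1⇒≡1 p∣1) p-prime) ¬prime[1]
  prime∣n!⇒≤ (suc n) p-prime p∣n! with euclidsLemma (suc n) (n !) p-prime p∣n!
  ... | inj₁ p∣n  = ∣⇒≤ p∣n
  ... | inj₂ p∣n! = m≤n⇒m≤1+n (prime∣n!⇒≤ n p-prime p∣n!)

  -- Such a prime occurs in (2n)! but in neither factor n!, so it survives in the quotient.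
  prime∣[n+n]Cn : ∀ {p} n → Prime p → n < p → p ≤ n + n → p ∣ (n + n) C n
  prime∣[n+n]Cn {p} n p-prime n<p p≤2n with euclidsLemma ((n + n) C n) (n ! * n !) p-prime
    (subst (p ∣_) (sym ([n+n]Cn*n!*n!≡[n+n]! n)) (∣-trans (n∣n! p {{prime⇒nonZero p-prime}}) (m≤n⇒m!∣n! p≤2n)))
    where
    n∣n! : ∀ n .{{_ : NonZero n}} → n ∣ n !
    n∣n! (suc n) = m∣m*n (n !)
  ... | inj₁ p∣C = p∣C
  ... | inj₂ p∣n!*n! with euclidsLemma (n !) (n !) p-prime p∣n!*n!
  ...   | inj₁ p∣n! = contradiction (prime∣n!⇒≤ n p-prime p∣n!) (<⇒≱ n<p)
  ...   | inj₂ p∣n! = contradiction (prime∣n!⇒≤ n p-prime p∣n!) (<⇒≱ n<p)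

  prime∣prime⇒≡ : ∀ {p r} → Prime p → Prime r → r ∣ p → r ≡ p
  prime∣prime⇒≡ p-prime r-prime r∣p with prime⇒irreducible p-prime r∣p
  ... | inj₁ refl = contradiction r-prime ¬prime[1]
  ... | inj₂ r≡p  = r≡p

  product-∣ : ∀ {ps} y → All Prime ps → Unique ps → All (_∣ y) ps → product ps ∣ y
  product-∣ y []              []             []             = 1∣ y
  product-∣ {p ∷ ps} y (p-prime ∷ pps) (p∉ps ∷ uniq) (divides-refl z ∷ ps∣) =
    subst (p * product ps ∣_) (*-comm p z) (*-monoʳ-∣ p (product-∣ z pps uniq (divide pps p∉ps ps∣)))
    where
    divide : ∀ {ps} → All Prime ps → All (p ≢_) ps → All (_∣ z * p) ps → All (_∣ z) ps
    divide []              []            []           = []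
    divide (r-prime ∷ rps) (p≢r ∷ p∉) (r∣ ∷ rs∣) with euclidsLemma z p r-prime r∣
    ... | inj₁ r∣z = r∣z ∷ divide rps p∉ rs∣
    ... | inj₂ r∣p = contradiction (sym (prime∣prime⇒≡ p-prime r-prime r∣p)) p≢r

  ^length≤product : ∀ {n} ps → All (n ≤_) ps → n ^ length ps ≤ product ps
  ^length≤product []       []         = ≤-refl
  ^length≤product (p ∷ ps) (n≤p ∷ n≤ps) = *-mono-≤ n≤p (^length≤product ps n≤ps)

  dyadicPrimes : ℕ → List ℕ
  dyadicPrimes n = filter prime? (applyUpTo (λ i → suc (n + i)) n)

  ∈-dyadicPrimes⁺ : ∀ {p} n → Prime p → n < p → p ≤ n + n → p ∈ dyadicPrimes n
  ∈-dyadicPrimes⁺ {p} n p-prime n<p p≤2n = ∈-filter⁺ prime? (subst (_∈ applyUpTo (λ i → suc (n + i)) n) (m+[n∸m]≡n n<p)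
    (∈-applyUpTo⁺ (λ i → suc (n + i))
        (+-cancelˡ-≤ n _ _ (subst (_≤ n + n) (sym (trans (+-suc n (p ∸ suc n)) (m+[n∸m]≡n n<p))) p≤2n)))) p-prime

  ∈-dyadicPrimes⁻ : ∀ {p} n → p ∈ dyadicPrimes n → n < p × p ≤ n + n × Prime p
  ∈-dyadicPrimes⁻ n p∈ with ∈-filter⁻ prime? {xs = applyUpTo (λ i → suc (n + i)) n} p∈
  ... | p∈′ , p-prime with ∈-applyUpTo⁻ (λ i → suc (n + i)) p∈′
  ...   | i , i<n , refl = s≤s (m≤m+n n i) , +-monoʳ-< n i<n , p-prime

  -- The primes in (n, 2n] are distinct divisors of the central binomial coefficient, so their
  -- product divides it, and each of them exceeds n.
  n^length-dyadicPrimes≤ : ∀ n → n ^ length (dyadicPrimes n) ≤ 2 ^ (n + n)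
  n^length-dyadicPrimes≤ n = begin
    n ^ length (dyadicPrimes n)   ≤⟨ ^length≤product (dyadicPrimes n)
        (All.tabulate λ p∈ → <⇒≤ (proj₁ (∈-dyadicPrimes⁻ n p∈))) ⟩
    product (dyadicPrimes n)      ≤⟨ ∣⇒≤ {{>-nonZero (≤-trans (m^n>0 2 n) (2^n≤[n+n]Cn n))}} (product-∣ ((n + n) C n)
                                (All.tabulate λ p∈ → proj₂ (proj₂ (∈-dyadicPrimes⁻ n p∈)))
                                (Unique.filter⁺ prime? (Unique.applyUpTo⁺₁ (λ i → suc (n + i)) n λ i<j _ eq →
                                    <⇒≢ i<j (+-cancelˡ-≡ n _ _ (suc-injective eq))))
                                (All.tabulate λ p∈ → let n<p , p≤2n , p-prime = ∈-dyadicPrimes⁻ n p∈ in prime∣[n+n]Cn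
                                    n p-prime n<p p≤2n)) ⟩
    (n + n) C n            ≤⟨ nCk≤2^n (n + n) n ⟩
    2 ^ (n + n)            ∎
    where open ≤-Reasoning

  2^-cancel-≤ : ∀ {m n} → 2 ^ m ≤ 2 ^ n → m ≤ n
  2^-cancel-≤ {m} {n} 2^m≤2^n = ≮⇒≥ λ n<m → <⇒≱ (^-monoʳ-< 2 (s≤s (s≤s z≤n)) n<m) 2^m≤2^n

  -- Taking n = 2^m turns the previous bound into a comparison of exponents of 2, so that no
  -- logarithm is required.
  m*length-dyadicPrimes≤ : ∀ m → m * length (dyadicPrimes (2 ^ m)) ≤ 2 ^ m + 2 ^ m
  m*length-dyadicPrimes≤ m = 2^-cancel-≤
      (subst (_≤ 2 ^ (2 ^ m + 2 ^ m)) (^-*-assoc 2 m (length (dyadicPrimes (2 ^ m)))) (n^length-dyadicPrimes≤ (2 ^ m)))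

  primesUpTo2^ : ℕ → List ℕ
  primesUpTo2^ zero    = []
  primesUpTo2^ (suc m) = dyadicPrimes (2 ^ m) ++ primesUpTo2^ m

  ∈-primesUpTo2^⁺ : ∀ {p} m → Prime p → p ≤ 2 ^ m → p ∈ primesUpTo2^ m
  ∈-primesUpTo2^⁺ {p} zero p-prime p≤1 = contradiction (<-≤-trans (nonTrivial⇒n>1 p {{prime⇒nonTrivial p-prime}}) p≤1)
      (<-irrefl refl)
  ∈-primesUpTo2^⁺ {p} (suc m) p-prime p≤ with p ≤? 2 ^ m
  ... | yes p≤2^m = ∈-++⁺ʳ (dyadicPrimes (2 ^ m)) (∈-primesUpTo2^⁺ m p-prime p≤2^m)
  ... | no  p≰2^m = ∈-++⁺ˡ (∈-dyadicPrimes⁺ (2 ^ m) p-prime (≰⇒> p≰2^m)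
      (subst (λ x → p ≤ 2 ^ m + x) (+-identityʳ (2 ^ m)) p≤))

  primesUpTo2^-prime : ∀ m → All Prime (primesUpTo2^ m)
  primesUpTo2^-prime zero    = []
  primesUpTo2^-prime (suc m) = ++⁺ (All.tabulate λ p∈ → proj₂ (proj₂ (∈-dyadicPrimes⁻ (2 ^ m) p∈)))
      (primesUpTo2^-prime m)

  -- With m = 2 + n this is π(2^m) ≤ 6 · 2^m / m. The induction step adds one dyadic block and comes
  -- down to 8 (m + 1) ≤ 12 m, which holds exactly from m = 2 on; hence the shift by 2.
  length-primesUpTo2^ : ∀ n → (2 + n) * length (primesUpTo2^ (2 + n)) ≤ 6 * 2 ^ (2 + n)
  length-primesUpTo2^ zero    = ≤ᵇ⇒≤ _ _ _
  length-primesUpTo2^ (suc n) = *-cancelˡ-≤ m (begin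
    m * (suc m * length (primesUpTo2^ (suc m)))
      ≡⟨ cong (λ l → m * (suc m * l)) (length-++ (dyadicPrimes (2 ^ m))) ⟩
    m * (suc m * (t + l))             ≡⟨ ring₁ m t l ⟩
    suc m * (m * t + m * l)           ≤⟨ *-monoʳ-≤ (suc m)
        (+-mono-≤ (m*length-dyadicPrimes≤ m) (length-primesUpTo2^ n)) ⟩
    suc m * (2 ^ m + 2 ^ m + 6 * 2 ^ m)  ≡⟨ ring₂ n (2 ^ m) ⟩
    (24 + 8 * n) * 2 ^ m              ≤⟨ *-monoˡ-≤ (2 ^ m) (+-monoʳ-≤ 24 (*-monoˡ-≤ n (m≤m+n 8 4))) ⟩
    (24 + 12 * n) * 2 ^ m             ≡⟨ ring₃ n (2 ^ m) ⟩
    m * (6 * 2 ^ suc m)               ∎)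
    where
    open ≤-Reasoning
    m = 2 + n
    t = length (dyadicPrimes (2 ^ m))
    l = length (primesUpTo2^ m)
    ring₁ : ∀ m t l → m * (suc m * (t + l)) ≡ suc m * (m * t + m * l)
    ring₁ = solve-∀
    ring₂ : ∀ n x → suc (2 + n) * (x + x + 6 * x) ≡ (24 + 8 * n) * x
    ring₂ = solve-∀
    ring₃ : ∀ n x → (24 + 12 * n) * x ≡ (2 + n) * (6 * (2 * x))
    ring₃ = solve-∀

  -- Common multiples of 1, ..., N and primes in a wide dyadic interval.

  powerBelow : ∀ p N → 1 < p → 1 ≤ N → ∃ λ e → p ^ e ≤ N × N < p ^ suc e
  powerBelow p (suc zero)    1<p _ = 0 , ≤-refl , subst (1 <_) (sym (*-identityʳ p)) 1<p
  powerBelow p (suc (suc N)) 1<p _ with powerBelow p (suc N) 1<p (s≤s z≤n)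
  ... | e , p^e≤N , N<p^ with p ^ suc e ≤? suc (suc N)
  ...   | no  p^≰N = e , ≤-trans p^e≤N (n≤1+n _) , ≰⇒> p^≰N
  ...   | yes p^≤N = suc e , p^≤N , ≤-<-trans N<p^ (^-monoʳ-< p 1<p (n<1+n (suc e)))

  splitPower : ∀ p d → Prime p → 1 ≤ d → ∃ λ j → ∃ λ d′ → d ≡ p ^ j * d′ × ¬ p ∣ d′
  splitPower p d p-prime = <-rec (λ d → 1 ≤ d → ∃ λ j → ∃ λ d′ → d ≡ p ^ j * d′ × ¬ p ∣ d′) step d
    where
    1<p : 1 < p
    1<p = nonTrivial⇒n>1 p {{prime⇒nonTrivial p-prime}}
    step : ∀ d → (∀ {d′} → d′ < d → 1 ≤ d′ → ∃ λ j → ∃ λ d″ → d′ ≡ p ^ j * d″ × ¬ p ∣ d″) → 1 ≤ d → ∃ λ j → ∃ λ d′ →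
        d ≡ p ^ j * d′ × ¬ p ∣ d′
    step d rec 1≤d with p ∣? d
    ... | no p∤d = 0 , d , sym (*-identityˡ d) , p∤d
    step _ rec 1≤d | yes (divides-refl zero)    = contradiction 1≤d λ ()
    step _ rec 1≤d | yes (divides-refl e@(suc _)) with rec (m<m*n e p 1<p) (s≤s z≤n)
    ... | j , d″ , eq , p∤d″ = suc j , d″ , trans (cong (_* p) eq)
        (trans (*-comm (p ^ j * d″) p) (sym (*-assoc p (p ^ j) d″))) , p∤d″

  module _ (N : ℕ) (1≤N : 1 ≤ N) where

    largestPower : ∀ p → Prime p → ∃ λ e → p ^ e ≤ N × N < p ^ suc e
    largestPower p p-prime = powerBelow p N (nonTrivial⇒n>1 p {{prime⇒nonTrivial p-prime}}) 1≤N

    -- For distinct primes `ps` this is the least common multiple of all d ≤ N composed of primes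
    -- from `ps`. Each prime contributes at most N, so a large common multiple forces many primes.
    commonMultiple : ∀ ps → All Prime ps → ℕ
    commonMultiple []       []              = 1
    commonMultiple (p ∷ ps) (p-prime ∷ pps) = p ^ proj₁ (largestPower p p-prime) * commonMultiple ps pps

    commonMultiple≤ : ∀ ps pps → commonMultiple ps pps ≤ N ^ length ps
    commonMultiple≤ []       []              = ≤-refl
    commonMultiple≤ (p ∷ ps) (p-prime ∷ pps) = *-mono-≤ (proj₁ (proj₂ (largestPower p p-prime)))
        (commonMultiple≤ ps pps)

    1≤commonMultiple : ∀ ps pps → 1 ≤ commonMultiple ps pps
    1≤commonMultiple []       []              = ≤-refl
    1≤commonMultiple (p ∷ ps) (p-prime ∷ pps) =
        *-mono-≤ (m^n>0 p {{prime⇒nonZero p-prime}} (proj₁ (largestPower p p-prime))) (1≤commonMultiple ps pps)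

    -- Splitting off the full power of the head prime leaves a cofactor that is still at most N and
    -- whose prime factors lie in the tail. The power split off is at most N, hence divides the
    -- largest one.
    ∣commonMultiple : ∀ ps pps d → 1 ≤ d → d ≤ N → (∀ r → Prime r → r ∣ d → r ∈ ps) → d ∣ commonMultiple ps pps
    ∣commonMultiple [] [] d 1≤d d≤N primes∈ with factorise d {{>-nonZero 1≤d}}
    ... | record { factors = [] ; isFactorisation = eq } = subst (_∣ 1) (sym eq) (1∣ 1)
    ... | record { factors = r ∷ rs ; isFactorisation = eq ; factorsPrime = r-prime ∷ _ } =
      contradiction (primes∈ r r-prime (divides (product rs) (trans eq (*-comm r (product rs))))) λ ()
    ∣commonMultiple (p ∷ ps) (p-prime ∷ pps) d 1≤d d≤N primes∈ with splitPower p d p-prime 1≤d | largestPower p p-prime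
    ... | j , d′ , eq , p∤d′ | e , _ , N<p^ = subst (_∣ _) (sym eq) (*-pres-∣ (^-monoʳ-∣ j≤e)
        (∣commonMultiple ps pps d′ 1≤d′ (≤-trans (∣⇒≤ {{>-nonZero 1≤d}} d′∣d) d≤N) primes∈′))
      where
      instance _ = prime⇒nonZero p-prime
      d′∣d : d′ ∣ d
      d′∣d = divides (p ^ j) eq
      1≤d′ : 1 ≤ d′
      1≤d′ = n≢0⇒n>0 λ d′≡0 → <⇒≢ 1≤d (sym (trans eq (trans (cong (p ^ j *_) d′≡0) (*-zeroʳ (p ^ j)))))
      p^j≤N : p ^ j ≤ N
      p^j≤N = ≤-trans (∣⇒≤ {{>-nonZero 1≤d}} (divides d′ (trans eq (*-comm (p ^ j) d′)))) d≤N
      j≤e : j ≤ e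
      j≤e = ≮⇒≥ λ e<j → <⇒≱ N<p^ (≤-trans (^-monoʳ-≤ p e<j) p^j≤N)
      ^-monoʳ-∣ : ∀ {i k} → i ≤ k → p ^ i ∣ p ^ k
      ^-monoʳ-∣ {i} {k} i≤k = divides (p ^ (k ∸ i))
          (trans (cong (p ^_) (sym (m∸n+n≡m i≤k))) (^-distribˡ-+-* p (k ∸ i) i))
      primes∈′ : ∀ r → Prime r → r ∣ d′ → r ∈ ps
      primes∈′ r r-prime r∣d′ with primes∈ r r-prime (∣-trans r∣d′ d′∣d)
      ... | here refl = contradiction r∣d′ p∤d′
      ... | there r∈  = r∈

  -- Put m = 2 + n, M = m + 7 and H = 2^(M-1) = 64 · 2^m. Without a prime in (2^m, 2^M] some common
  -- multiple of 1, ..., 2^M involves only primes up to 2^m and is at most 2^(M π(2^m)). It is also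
  -- a multiple of H C(2H, H), hence at least 2^H. Together with π(2^m) ≤ 6 · 2^m / m this gives 64
  -- m ≤ 6 (m + 7), false for m ≥ 2.
  prime-between : ∀ n → ∃ λ q → Prime q × 2 ^ (2 + n) < q × q ≤ 2 ^ (9 + n)
  prime-between n with anyUpTo? (λ q → (2 ^ (2 + n) <? q) ×-dec prime? q) (suc (2 ^ (9 + n)))
  ... | yes (q , s≤s q≤ , 2^m<q , q-prime) = q , q-prime , 2^m<q , q≤
  ... | no ¬q = contradiction 64m≤6m+42 (<⇒≱ 6m+42<64m)
    where
    m M N X l : ℕ
    m = 2 + n
    M = 9 + n
    N = 2 ^ M
    l = length (primesUpTo2^ m)
    X = commonMultiple N (m^n>0 2 M) (primesUpTo2^ m) (primesUpTo2^-prime m)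
    H = 2 ^ (8 + n)
    X-multiple : ∀ d → 1 ≤ d → d ≤ N → d ∣ X
    X-multiple d 1≤d d≤N = ∣commonMultiple N (m^n>0 2 M) (primesUpTo2^ m) (primesUpTo2^-prime m) d 1≤d d≤N
        λ r r-prime r∣d →
      ∈-primesUpTo2^⁺ m r-prime (≮⇒≥ λ 2^m<r → ¬q (r , s≤s (≤-trans (∣⇒≤ {{>-nonZero 1≤d}} r∣d) d≤N) , 2^m<r , r-prime))
    2^H≤X : 2 ^ H ≤ X
    2^H≤X = ≤-trans (2^n≤[n+n]Cn H) (≤-trans (m≤n*m ((H + H) C H) H {{m^n≢0 2 (8 + n)}})
      (∣⇒≤ {{>-nonZero (1≤commonMultiple N (m^n>0 2 M) (primesUpTo2^ m) (primesUpTo2^-prime m))}}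
        (k*nCk∣′ H (H + H) (m^n>0 2 (8 + n)) (m≤m+n H H) (≤-reflexive (cong (H +_) (sym (+-identityʳ H)))))))
      where
      k*nCk∣′ : ∀ k n → 1 ≤ k → k ≤ n → n ≤ N → k * (n C k) ∣ X
      k*nCk∣′ (suc k) (suc n) _ (s≤s k≤n) n≤N = k*nCk∣ N X X-multiple n k k≤n n≤N
    H≤Ml : H ≤ M * l
    H≤Ml = 2^-cancel-≤ (≤-trans 2^H≤X (≤-trans (commonMultiple≤ N (m^n>0 2 M) (primesUpTo2^ m) (primesUpTo2^-prime m))
        (≤-reflexive (^-*-assoc 2 M l))))
    64m≤6m+42 : 64 * m ≤ 6 * M
    64m≤6m+42 = *-cancelʳ-≤ (64 * m) (6 * M) (2 ^ m) {{m^n≢0 2 m}} (begin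
      64 * m * 2 ^ m     ≡⟨ ring₁ m (2 ^ m) ⟩
      m * (2 * (2 * (2 * (2 * (2 * (2 * 2 ^ m))))))  ≤⟨ *-monoʳ-≤ m H≤Ml ⟩
      m * (M * l)        ≡⟨ ring₂ m M l ⟩
      M * (m * l)        ≤⟨ *-monoʳ-≤ M (length-primesUpTo2^ n) ⟩
      M * (6 * 2 ^ m)    ≡⟨ ring₃ M (2 ^ m) ⟩
      6 * M * 2 ^ m      ∎)
      where
      open ≤-Reasoning
      ring₁ : ∀ m x → 64 * m * x ≡ m * (2 * (2 * (2 * (2 * (2 * (2 * x))))))
      ring₁ = solve-∀
      ring₂ : ∀ m M l → m * (M * l) ≡ M * (m * l)
      ring₂ = solve-∀
      ring₃ : ∀ M x → M * (6 * x) ≡ 6 * M * x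
      ring₃ = solve-∀
    6m+42<64m : 6 * M < 64 * m
    6m+42<64m = subst₂ _<_ (ring₁ n) (ring₂ n) (+-mono-<-≤ (m≤m+n 55 73) (*-monoˡ-≤ n (m≤m+n 6 58)))
      where
      ring₁ : ∀ n → 54 + 6 * n ≡ 6 * (9 + n)
      ring₁ = solve-∀
      ring₂ : ∀ n → 128 + 64 * n ≡ 64 * (2 + n)
      ring₂ = solve-∀

module SchurGraphs where

  open import Data.Bool using (Bool; true; false; not; _∧_; T)
  import Data.Bool.Properties as Bool
  open import Data.Integer using (ℤ; +_; -_; _+_; _*_; ∣_∣; 0ℤ; 1ℤ; +≤+) renaming (_≤_ to _≤ᶻ_)
  open import Data.Integer.DivMod using (_/ℕ_; n%ℕd<d; a≡a%ℕn+[a/ℕn]*n)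
  import Data.Integer.Divisibility as Unsigned
  import Data.Integer.Divisibility.Signed as Signed
  open import Data.Integer.Tactic.RingSolver using (solve-∀)
  import Data.Nat.Divisibility as ℕ
  open import Data.Nat.Coprimality using (prime⇒coprime; coprime-Bézout)
  open import Data.Nat.GCD using (module Bézout)
  open import Data.Nat.Logarithm using (⌊log₂_⌋; ⌊log₂[2*b]⌋≡1+⌊log₂b⌋)
  open import Data.Fin using (Fin; toℕ; fromℕ<; zero; suc; combine; remQuot; #_)
  import Data.Fin.Properties as Fin
  open import Data.Fin.Permutation using (Permutation; permutation; _⟨$⟩ʳ_)
  open import Data.Fin.Subset using (_∈_; inside; outside)
  open import Data.Vec using (_∷_; []; lookup; tabulate; here; there)
  import Data.Vec.Properties as Vec
  open import Algebra.Properties.AbelianGroup ℤ.+-0-abelianGroup using (∙-cancelʳ)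
  open import Algebra.Properties.Semiring.Sum ℤ.+-*-semiring using (sum; sum-cong-≗; ∑-distrib-+; ∑-comm; sum-permute;
      *-distribˡ-sum; *-distribʳ-sum; sum-replicate-zero)

  -- Finite sums of integers.

  abstract
    ∑ : ∀ {n} → (Fin n → ℤ) → ℤ
    ∑ = sum

    ∑-suc : ∀ {n} (f : Fin (ℕ.suc n) → ℤ) → ∑ f ≡ f zero + ∑ (f ∘ suc)
    ∑-suc f = refl

    ∑-empty : (f : Fin 0 → ℤ) → ∑ f ≡ 0ℤ
    ∑-empty f = refl

    ∑-cong : ∀ {n} {f g : Fin n → ℤ} → (∀ i → f i ≡ g i) → ∑ f ≡ ∑ g
    ∑-cong = sum-cong-≗

    ∑-+ : ∀ {n} (f g : Fin n → ℤ) → ∑ (λ i → f i + g i) ≡ ∑ f + ∑ g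
    ∑-+ = ∑-distrib-+

    ∑-swap : ∀ {m n} (f : Fin m → Fin n → ℤ) → ∑ (λ i → ∑ (f i)) ≡ ∑ (λ j → ∑ (λ i → f i j))
    ∑-swap {m} {n} = ∑-comm {m} {n}

    ∑-*ˡ : ∀ {n} x (f : Fin n → ℤ) → ∑ (λ i → x * f i) ≡ x * ∑ f
    ∑-*ˡ x f = sym (*-distribˡ-sum x f)

    ∑-*ʳ : ∀ {n} x (f : Fin n → ℤ) → ∑ (λ i → f i * x) ≡ ∑ f * x
    ∑-*ʳ x f = sym (*-distribʳ-sum x f)

    ∑-permute : ∀ {n} (f : Fin n → ℤ) (π : Permutation n n) → ∑ (λ i → f (π ⟨$⟩ʳ i)) ≡ ∑ f
    ∑-permute f π = sym (sum-permute f π)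

    ∑-zero : ∀ {n} {f : Fin n → ℤ} → (∀ i → f i ≡ 0ℤ) → ∑ f ≡ 0ℤ
    ∑-zero {n} f≡0 = trans (∑-cong f≡0) (sum-replicate-zero n)

    ∑-mono-≤ : ∀ {n} {f g : Fin n → ℤ} → (∀ i → f i ≤ᶻ g i) → ∑ f ≤ᶻ ∑ g
    ∑-mono-≤ {ℕ.zero}  f≤g = ℤ.≤-refl
    ∑-mono-≤ {ℕ.suc n} f≤g = ℤ.+-mono-≤ (f≤g zero) (∑-mono-≤ (f≤g ∘ suc))

    ∑-nonneg : ∀ {n} {f : Fin n → ℤ} → (∀ i → 0ℤ ≤ᶻ f i) → 0ℤ ≤ᶻ ∑ f
    ∑-nonneg {n} {f} 0≤f = subst (_≤ᶻ ∑ f) (sum-replicate-zero n) (∑-mono-≤ {g = f} 0≤f)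

    ∑-const : ∀ n x → ∑ {n} (λ _ → x) ≡ + n * x
    ∑-const ℕ.zero    x = sym (ℤ.*-zeroˡ x)
    ∑-const (ℕ.suc n) x = trans (cong (_+_ (x)) (∑-const n x)) (sym (ℤ.suc-* (+ n) x))

    ∑-neg : ∀ {n} (f : Fin n → ℤ) → ∑ (λ i → - f i) ≡ - ∑ f
    ∑-neg {ℕ.zero}  f = refl
    ∑-neg {ℕ.suc n} f = trans (cong (_+_ (- f zero)) (∑-neg (f ∘ suc))) (sym (ℤ.neg-distrib-+ (f zero) _))

    ∑-single : ∀ {n} (f : Fin n → ℤ) j → (∀ i → i ≢ j → f i ≡ 0ℤ) → ∑ f ≡ f j
    ∑-single f zero    f≡0 = trans (cong (_+_ (f zero)) (∑-zero λ i → f≡0 (suc i) λ ())) (ℤ.+-identityʳ _)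
    ∑-single f (suc j) f≡0 = trans (cong₂ _+_ (f≡0 zero λ ())
      (∑-single (f ∘ suc) j λ i i≢j → f≡0 (suc i) (i≢j ∘ Fin.suc-injective))) (ℤ.+-identityˡ _)

    ∑-double : ∀ {n} (f : Fin n → ℤ) j k → j ≢ k → (∀ i → i ≢ j → i ≢ k → f i ≡ 0ℤ) → ∑ f ≡ f j + f k
    ∑-double f zero    zero    j≢k f≡0 = contradiction refl j≢k
    ∑-double f zero    (suc k) j≢k f≡0 = cong (_+_ (f zero))
      (∑-single (f ∘ suc) k λ i i≢k → f≡0 (suc i) (λ ()) (i≢k ∘ Fin.suc-injective))
    ∑-double f (suc j) zero    j≢k f≡0 = trans (cong (_+_ (f zero))
      (∑-single (f ∘ suc) j λ i i≢j → f≡0 (suc i) (i≢j ∘ Fin.suc-injective) (λ ()))) (ℤ.+-comm (f zero) _)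
    ∑-double f (suc j) (suc k) j≢k f≡0 = trans (cong₂ _+_ (f≡0 zero (λ ()) (λ ()))
      (∑-double (f ∘ suc) j k (j≢k ∘ cong suc) λ i i≢j i≢k → f≡0 (suc i) (i≢j ∘ Fin.suc-injective)
          (i≢k ∘ Fin.suc-injective)))
      (ℤ.+-identityˡ _)

  -- Congruences modulo q.

  module Mod (q : ℕ) .{{q≢0 : NonZero q}} where

    infix 4 _≈_
    -- The quotient is carried along explicitly, so that each compatibility law below reduces to a
    -- ring identity in ℤ.
    record _≈_ (x y : ℤ) : Set where
      constructor mod
      field
        quot : ℤ
        eq   : x ≡ y + quot * + q

    ≈-reflexive : ∀ {x y} → x ≡ y → x ≈ y
    ≈-reflexive {x} refl = mod 0ℤ (sym (ℤ.+-identityʳ x))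

    ≈-refl : ∀ {x} → x ≈ x
    ≈-refl = ≈-reflexive refl

    ≈-sym : ∀ {x y} → x ≈ y → y ≈ x
    ≈-sym {_} {y} (mod k refl) = mod (- k) (lemma y k (+ q))
      where
      lemma : ∀ y k q → y ≡ (y + k * q) + - k * q
      lemma = solve-∀

    ≈-trans : ∀ {x y z} → x ≈ y → y ≈ z → x ≈ z
    ≈-trans {z = z} (mod k refl) (mod l refl) = mod (l + k) (lemma z k l (+ q))
      where
      lemma : ∀ z k l q → (z + l * q) + k * q ≡ z + (l + k) * q
      lemma = solve-∀

    ≈-+ : ∀ {x y x′ y′} → x ≈ x′ → y ≈ y′ → x + y ≈ x′ + y′
    ≈-+ {x′ = x} {y} (mod k refl) (mod l refl) = mod (k + l) (lemma x y k l (+ q))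
      where
      lemma : ∀ x y k l q → (x + k * q) + (y + l * q) ≡ (x + y) + (k + l) * q
      lemma = solve-∀

    ≈-* : ∀ {x y x′ y′} → x ≈ x′ → y ≈ y′ → x * y ≈ x′ * y′
    ≈-* {x′ = x} {y} (mod k refl) (mod l refl) = mod (x * l + k * y + k * l * + q) (lemma x y k l (+ q))
      where
      lemma : ∀ x y k l q → (x + k * q) * (y + l * q) ≡ x * y + (x * l + k * y + k * l * q) * q
      lemma = solve-∀

    ≈-neg : ∀ {x x′} → x ≈ x′ → - x ≈ - x′
    ≈-neg {x′ = x} (mod k refl) = mod (- k) (lemma x k (+ q))
      where
      lemma : ∀ x k q → - (x + k * q) ≡ - x + - k * q
      lemma = solve-∀

    small-≈0 : ∀ {x} → ∣ x ∣ ℕ.< q → x ≈ 0ℤ → x ≡ 0ℤ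
    small-≈0 {x} x<q (mod k eq) = ℤ.∣i∣≡0⇒i≡0 (lemma ∣ x ∣ x<q q∣x)
      where
      q∣x : q ℕ.∣ ∣ x ∣
      q∣x = ℕ.divides ∣ k ∣ (trans (cong ∣_∣ (trans eq (ℤ.+-identityˡ (k * + q)))) (ℤ.abs-* k (+ q)))
      lemma : ∀ n → n ℕ.< q → q ℕ.∣ n → n ≡ 0
      lemma ℕ.zero    _   _   = refl
      lemma (ℕ.suc n) n<q q∣n = contradiction (ℕ.<-≤-trans n<q (ℕ.∣⇒≤ q∣n)) (ℕ.<-irrefl refl)

    res : ℤ → Fin q
    res x = fromℕ< (n%ℕd<d x q)

    toℤ-res : ∀ x → toℤ (res x) ≈ x
    toℤ-res x = ≈-sym (mod (x /ℕ q) (trans (a≡a%ℕn+[a/ℕn]*n x q)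
      (cong (λ r → + r + (x /ℕ q) * + q) (sym (Fin.toℕ-fromℕ< _)))))

    toℤ-injective : ∀ {i j : Fin q} → toℤ i ≈ toℤ j → i ≡ j
    toℤ-injective {i} {j} i≈j = Fin.toℕ-injective (ℤ.+-injective (ℤ.i-j≡0⇒i≡j _ _ (small-≈0 small
      (≈-trans (≈-+ i≈j (≈-refl { - toℤ j})) (≈-reflexive (ℤ.+-inverseʳ (toℤ j)))))))
      where
      small : ∣ toℤ i ℤ.- toℤ j ∣ ℕ.< q
      small = ℕ.≤-<-trans (ℕ.≤-trans (ℕ.≤-reflexive (cong ∣_∣ (ℤ.m-n≡m⊖n (toℕ i) (toℕ j))))
          (ℤ.∣m⊝n∣≤m⊔n (toℕ i) (toℕ j)))
        (ℕ.⊔-lub (Fin.toℕ<n i) (Fin.toℕ<n j))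

    res-cong : ∀ {x y} → x ≈ y → res x ≡ res y
    res-cong {x} {y} x≈y = toℤ-injective (≈-trans (toℤ-res x) (≈-trans x≈y (≈-sym (toℤ-res y))))

    res-toℤ : ∀ i → res (toℤ i) ≡ i
    res-toℤ i = toℤ-injective (toℤ-res (toℤ i))

    -- For a unit u the map s ↦ u s + b permutes the residues; its inverse is s ↦ v (s - b).
    ∑-affine : ∀ (f : ℤ → ℤ) → (∀ {x y} → x ≈ y → f x ≡ f y) → ∀ u v b → u * v ≈ 1ℤ →
               ∑ {q} (λ s → f (u * toℤ s + b)) ≡ ∑ {q} (λ s → f (toℤ s))
    ∑-affine f f-cong u v b uv≈1 = trans (∑-cong λ s → f-cong (≈-sym (toℤ-res (u * toℤ s + b))))
      (∑-permute (λ s → f (toℤ s)) (permutation to from to∘from from∘to))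
      where
      to from : Fin q → Fin q
      to s   = res (u * toℤ s + b)
      from s = res (v * (toℤ s + - b))
      ring₁ : ∀ u v s b → u * (v * (s + - b)) + b ≡ (u * v) * (s + - b) + b
      ring₁ = solve-∀
      ring₂ : ∀ s b → 1ℤ * (s + - b) + b ≡ s
      ring₂ = solve-∀
      ring₃ : ∀ u v s b → v * ((u * s + b) + - b) ≡ (u * v) * s
      ring₃ = solve-∀
      to∘from : ∀ s → to (from s) ≡ s
      to∘from s = toℤ-injective (≈-trans (toℤ-res _)
          (≈-trans (≈-+ (≈-* (≈-refl {u}) (toℤ-res (v * (toℤ s + - b)))) (≈-refl {b}))
        (≈-trans (≈-reflexive (ring₁ u v (toℤ s) b)) (≈-trans (≈-+ (≈-* uv≈1 (≈-refl {toℤ s + - b})) (≈-refl {b}))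
        (≈-reflexive (ring₂ (toℤ s) b))))))
      from∘to : ∀ s → from (to s) ≡ s
      from∘to s = toℤ-injective (≈-trans (toℤ-res _)
          (≈-trans (≈-* (≈-refl {v}) (≈-+ (toℤ-res (u * toℤ s + b)) (≈-refl { - b})))
        (≈-trans (≈-reflexive (ring₃ u v (toℤ s) b)) (≈-trans (≈-* uv≈1 (≈-refl {toℤ s}))
        (≈-reflexive (ℤ.*-identityˡ (toℤ s)))))))

    ∑-translate : ∀ (f : ℤ → ℤ) → (∀ {x y} → x ≈ y → f x ≡ f y) → ∀ b →
                  ∑ {q} (λ s → f (toℤ s + b)) ≡ ∑ {q} (λ s → f (toℤ s))
    ∑-translate f f-cong b = trans (∑-cong λ s → cong (λ z → f (z + b)) (sym (ℤ.*-identityˡ (toℤ s))))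
      (∑-affine f f-cong 1ℤ 1ℤ b ≈-refl)

  cong₃ : ∀ {A B C D : Set} (f : A → B → C → D) {a a′ b b′ c c′} → a ≡ a′ → b ≡ b′ → c ≡ c′ → f a b c ≡ f a′ b′ c′
  cong₃ f refl refl refl = refl

  square : ∀ x → 0ℤ ≤ᶻ x * x
  square (+ n)      = subst (0ℤ ≤ᶻ_) (ℤ.pos-* n n) (+≤+ ℕ.z≤n)
  square ℤ.-[1+ n ] = +≤+ ℕ.z≤n

  -- Line sums on 𝔽_q³ and their spectral bound.

  module Lines (q : ℕ) .{{q≢0 : NonZero q}}
               (inverse : ∀ x → ¬ (Mod._≈_ q x 0ℤ) → Σ ℤ λ v → Mod._≈_ q (x * v) 1ℤ) where

    open Mod q

    ∑₃ : (ℤ → ℤ → ℤ → ℤ) → ℤ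
    ∑₃ f = ∑ {q} λ a → ∑ {q} λ c → ∑ {q} λ t → f (toℤ a) (toℤ c) (toℤ t)

    ∑₃-cong : ∀ {f g} → (∀ a c t → f a c t ≡ g a c t) → ∑₃ f ≡ ∑₃ g
    ∑₃-cong f≡g = ∑-cong λ a → ∑-cong λ c → ∑-cong λ t → f≡g (toℤ a) (toℤ c) (toℤ t)

    ∑₃-+ : ∀ f g → ∑₃ (λ a c t → f a c t + g a c t) ≡ ∑₃ f + ∑₃ g
    ∑₃-+ f g = trans (∑-cong λ a → trans (∑-cong λ c → ∑-+ {q} _ _) (∑-+ {q} _ _)) (∑-+ {q} _ _)

    ∑₃-* : ∀ x f → ∑₃ (λ a c t → x * f a c t) ≡ x * ∑₃ f
    ∑₃-* x f = trans (∑-cong λ a → trans (∑-cong λ c → ∑-*ˡ {q} x _) (∑-*ˡ {q} x _)) (∑-*ˡ {q} x _)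

    ∑₃-∑ : ∀ {n} (f : Fin n → ℤ → ℤ → ℤ → ℤ) → ∑₃ (λ a c t → ∑ (λ s → f s a c t)) ≡ ∑ (λ s → ∑₃ (f s))
    ∑₃-∑ f = trans (∑-cong λ a → trans (∑-cong λ c → ∑-swap {q} _) (∑-swap {q} _)) (∑-swap {q} _)

    ∑₃-nonneg : ∀ {f} → (∀ a c t → 0ℤ ≤ᶻ f a c t) → 0ℤ ≤ᶻ ∑₃ f
    ∑₃-nonneg 0≤f = ∑-nonneg λ a → ∑-nonneg λ c → ∑-nonneg λ t → 0≤f (toℤ a) (toℤ c) (toℤ t)

    -- Functions on 𝔽_q³ are taken as q-periodic functions on ℤ³: points can then be moved by plain
    -- integer identities, without reducing after every step.
    record Fn : Set where
      field
        at  : ℤ → ℤ → ℤ → ℤ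
        per : ∀ {a a′ c c′ t t′} → a ≈ a′ → c ≈ c′ → t ≈ t′ → at a c t ≡ at a′ c′ t′
    open Fn public

    line-per : ∀ f a c t y {z z′} → z ≈ z′ →
               at f (a + z * y) (c + z * (y * y)) (t + z) ≡ at f (a + z′ * y) (c + z′ * (y * y)) (t + z′)
    line-per f a c t y z≈ = per f (≈-+ (≈-refl {a}) (≈-* z≈ (≈-refl {y})))
      (≈-+ (≈-refl {c}) (≈-* z≈ (≈-refl {y * y}))) (≈-+ (≈-refl {t}) z≈)

    infix 4 _≗₃_
    _≗₃_ : Fn → Fn → Set
    f ≗₃ g = ∀ a c t → at f a c t ≡ at g a c t

    total : Fn → ℤ
    total f = ∑₃ (at f)

    ⟨_,_⟩ : Fn → Fn → ℤ
    ⟨ f , g ⟩ = ∑₃ λ a c t → at f a c t * at g a c t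

    -- This is q times the orthogonal projection onto the functions invariant under translation by
    -- (y, y², 1), as `L-selfAdjoint` and `L-L` confirm.
    L : ℤ → Fn → Fn
    at  (L y f) a c t = ∑ {q} λ s → at f (a + toℤ s * y) (c + toℤ s * (y * y)) (t + toℤ s)
    per (L y f) a≈ c≈ t≈ = ∑-cong {q} λ s → per f (≈-+ a≈ (≈-refl {toℤ s * y})) (≈-+ c≈ (≈-refl {toℤ s * (y * y)}))
        (≈-+ t≈ (≈-refl {toℤ s}))

    X : Fn → Fn
    at  (X f) a c t = ∑ {q} λ y → at (L (toℤ y) f) a c t
    per (X f) a≈ c≈ t≈ = ∑-cong {q} λ y → per (L (toℤ y) f) a≈ c≈ t≈

    infixl 6 _⊝_
    infixr 7 _∙_
    _∙_ : ℤ → Fn → Fn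
    at  (x ∙ f) a c t = x * at f a c t
    per (x ∙ f) a≈ c≈ t≈ = cong (_*_ x) (per f a≈ c≈ t≈)

    _⊝_ : Fn → Fn → Fn
    at  (f ⊝ g) a c t = at f a c t + - at g a c t
    per (f ⊝ g) a≈ c≈ t≈ = cong₂ (λ x y → x + - y) (per f a≈ c≈ t≈) (per g a≈ c≈ t≈)

    ⟨⟩-congʳ : ∀ f g h → g ≗₃ h → ⟨ f , g ⟩ ≡ ⟨ f , h ⟩
    ⟨⟩-congʳ f g h g≗h = ∑₃-cong λ a c t → cong (_*_ (at f a c t)) (g≗h a c t)

    ⟨⟩-comm : ∀ f g → ⟨ f , g ⟩ ≡ ⟨ g , f ⟩
    ⟨⟩-comm f g = ∑₃-cong λ a c t → ℤ.*-comm (at f a c t) (at g a c t)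

    ⟨⟩-∙ʳ : ∀ x f g → ⟨ f , x ∙ g ⟩ ≡ x * ⟨ f , g ⟩
    ⟨⟩-∙ʳ x f g = trans (∑₃-cong λ a c t → lemma (at f a c t) x (at g a c t))
        (∑₃-* x (λ a c t → at f a c t * at g a c t))
      where
      lemma : ∀ f x g → f * (x * g) ≡ x * (f * g)
      lemma = solve-∀

    ⟨⟩-⊝ʳ : ∀ f g h → ⟨ f , g ⊝ h ⟩ ≡ ⟨ f , g ⟩ + - ⟨ f , h ⟩
    ⟨⟩-⊝ʳ f g h = trans (∑₃-cong λ a c t → lemma (at f a c t) (at g a c t) (at h a c t))
      (trans (∑₃-+ (λ a c t → at f a c t * at g a c t) (λ a c t → ℤ.-1ℤ * (at f a c t * at h a c t)))
      (cong (_+_ ⟨ f , g ⟩) (trans (∑₃-* ℤ.-1ℤ (λ a c t → at f a c t * at h a c t)) (ℤ.-1*i≡-i ⟨ f , h ⟩))))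
      where
      lemma : ∀ f g h → f * (g + - h) ≡ f * g + ℤ.-1ℤ * (f * h)
      lemma = solve-∀

    ⟨⟩-square : ∀ f → 0ℤ ≤ᶻ ⟨ f , f ⟩
    ⟨⟩-square f = ∑₃-nonneg λ a c t → square (at f a c t)

    ∑₃-shift : ∀ f α γ τ → ∑₃ (λ a c t → at f (a + α) (c + γ) (t + τ)) ≡ ∑₃ (at f)
    ∑₃-shift f α γ τ = trans (∑-cong λ a → trans (∑-cong λ c →
        ∑-translate (λ t → at f (toℤ a + α) (toℤ c + γ) t) (λ t≈ → per f ≈-refl ≈-refl t≈) τ)
        (∑-translate (λ c → ∑ {q} λ t → at f (toℤ a + α) c (toℤ t)) (λ c≈ → ∑-cong {q} λ t → per f ≈-refl c≈ ≈-refl) γ))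
      (∑-translate (λ a → ∑ {q} λ c → ∑ {q} λ t → at f a (toℤ c) (toℤ t))
        (λ a≈ → ∑-cong {q} λ c → ∑-cong {q} λ t → per f a≈ ≈-refl ≈-refl) α)

    -- Translating the sum over 𝔽_q³ moves the shift by s from g to a shift by -s of f, and s ↦ -s
    -- permutes the residues.
    L-selfAdjoint : ∀ y f g → ⟨ f , L y g ⟩ ≡ ⟨ L y f , g ⟩
    L-selfAdjoint y f g = begin
      ∑₃ (λ a c t → at f a c t * at (L y g) a c t)
        ≡⟨ ∑₃-cong (λ a c t → sym (∑-*ˡ {q} (at f a c t) (λ s → g′ (toℤ s) a c t))) ⟩
      ∑₃ (λ a c t → ∑ {q} λ s → at f a c t * g′ (toℤ s) a c t)
        ≡⟨ ∑₃-∑ {q} (λ s a c t → at f a c t * g′ (toℤ s) a c t) ⟩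
      ∑ {q} (λ s → ∑₃ λ a c t → at f a c t * g′ (toℤ s) a c t)
        ≡⟨ ∑-cong {q} (λ s → trans (∑₃-cong λ a c t → cong (_* g′ (toℤ s) a c t)
             (cong₃ (at f) (cancel a (toℤ s) y) (cancel c (toℤ s) (y * y)) (cancel₁ t (toℤ s))))
             (∑₃-shift (F (toℤ s)) (toℤ s * y) (toℤ s * (y * y)) (toℤ s))) ⟩
      ∑ {q} (λ s → ∑₃ (at (F (toℤ s))))
        ≡⟨ sym (∑₃-∑ {q} (λ s → at (F (toℤ s)))) ⟩
      ∑₃ (λ a c t → ∑ {q} λ s → at (F (toℤ s)) a c t)
        ≡⟨ ∑₃-cong (λ a c t → trans (∑-*ʳ {q} (at g a c t) (λ s → f′ (toℤ s) a c t))
            (cong (_* at g a c t) (reflect a c t))) ⟩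
      ∑₃ (λ a c t → at (L y f) a c t * at g a c t) ∎
      where
      open ≡-Reasoning
      cancel : ∀ a s y → a ≡ (a + s * y) + - s * y
      cancel = solve-∀
      cancel₁ : ∀ t s → t ≡ (t + s) + - s
      cancel₁ = solve-∀
      f′ g′ : ℤ → ℤ → ℤ → ℤ → ℤ
      f′ s a c t = at f (a + - s * y) (c + - s * (y * y)) (t + - s)
      g′ s a c t = at g (a + s * y) (c + s * (y * y)) (t + s)
      F : ℤ → Fn
      at  (F s) a c t = f′ s a c t * at g a c t
      per (F s) a≈ c≈ t≈ = cong₂ _*_ (per f (≈-+ a≈ (≈-refl { - s * y})) (≈-+ c≈ (≈-refl { - s * (y * y)}))
          (≈-+ t≈ (≈-refl { - s}))) (per g a≈ c≈ t≈)
      negate : ∀ s → ℤ.-1ℤ * s + 0ℤ ≡ - s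
      negate = solve-∀
      reflect : ∀ a c t → ∑ {q} (λ s → at f (a + - toℤ s * y) (c + - toℤ s * (y * y)) (t + - toℤ s)) ≡ at (L y f) a c t
      reflect a c t = trans
        (∑-cong {q} λ s → cong (λ z → at f (a + z * y) (c + z * (y * y)) (t + z)) (sym (negate (toℤ s))))
        (∑-affine (λ z → at f (a + z * y) (c + z * (y * y)) (t + z))
          (line-per f a c t y)
          ℤ.-1ℤ ℤ.-1ℤ 0ℤ ≈-refl)

    L-cong : ∀ y f g → f ≗₃ g → L y f ≗₃ L y g
    L-cong y f g f≗g a c t = ∑-cong {q} λ s → f≗g _ _ _

    L-∙ : ∀ y x f → L y (x ∙ f) ≗₃ x ∙ L y f
    L-∙ y x f a c t = ∑-*ˡ {q} x _

    L-⊝ : ∀ y f g → L y (f ⊝ g) ≗₃ L y f ⊝ L y g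
    L-⊝ y f g a c t = trans (∑-+ {q} _ _) (cong (_+_ (at (L y f) a c t)) (∑-neg {q} _))

    L-X : ∀ y f a c t → at (L y (X f)) a c t ≡ ∑ {q} λ y′ → at (L y (L (toℤ y′) f)) a c t
    L-X y f a c t = ∑-swap {q} _

    L-comm : ∀ y y′ f → L y (L y′ f) ≗₃ L y′ (L y f)
    L-comm y y′ f a c t = trans (∑-swap {q} _) (∑-cong {q} λ s → ∑-cong {q} λ s′ →
      cong₃ (at f) (lemma a _ _) (lemma c _ _) (lemma t _ _))
      where
      lemma : ∀ a x y → (a + x) + y ≡ (a + y) + x
      lemma = solve-∀

    -- A line sum does not change when its base point moves along the line, so the outer summation
    -- only counts q equal terms.
    L-L : ∀ y f → L y (L y f) ≗₃ + q ∙ L y f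
    L-L y f a c t = trans (∑-cong {q} λ s → trans
        (∑-cong {q} λ s′ → cong₃ (at f) (lemma a y (toℤ s) (toℤ s′)) (lemma c (y * y) (toℤ s) (toℤ s′))
            (lemma₁ t (toℤ s) (toℤ s′)))
        (∑-translate (λ z → at f (a + z * y) (c + z * (y * y)) (t + z))
          (line-per f a c t y) (toℤ s)))
      (∑-const q _)
      where
      lemma : ∀ a y s s′ → (a + s * y) + s′ * y ≡ a + (s′ + s) * y
      lemma = solve-∀
      lemma₁ : ∀ a s s′ → (a + s) + s′ ≡ a + (s′ + s)
      lemma₁ = solve-∀

    -- Three distinct directions (y, y², 1) form a basis of 𝔽_q³ by the Vandermonde determinant, so
    -- the triple sum meets every point exactly once. The change of basis is carried out by
    -- successive elimination, and the three hypotheses are the factors of that determinant.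
    L-L-L : ∀ y₁ y₂ y₃ → ¬ (y₁ + - y₃ ≈ 0ℤ) → ¬ (y₂ + - y₃ ≈ 0ℤ) → ¬ (y₂ + - y₁ ≈ 0ℤ) →
            ∀ f a c t → at (L y₁ (L y₂ (L y₃ f))) a c t ≡ total f
    L-L-L y₁ y₂ y₃ y₁≉y₃ y₂≉y₃ y₂≉y₁ f a c t = begin
      at (L y₁ (L y₂ (L y₃ f))) a c t
        ≡⟨ ∑-cong {q} (λ s₁ → ∑-cong {q} λ s₂ → eliminate-t (toℤ s₁) (toℤ s₂)) ⟩
      ∑ {q} (λ s₁ → ∑ {q} λ s₂ → ∑ {q} λ s₃ → H ((y₁ + - y₃) * toℤ s₁ + 0ℤ) ((y₂ + - y₃) * toℤ s₂ + 0ℤ) (toℤ s₃))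
        ≡⟨ ∑-cong {q} (λ s₁ → rescale y₂≉y₃ 0ℤ
             (λ x → ∑ {q} λ s₃ → H ((y₁ + - y₃) * toℤ s₁ + 0ℤ) x (toℤ s₃))
             (λ x≈ → ∑-cong {q} λ s₃ → H-cong {(y₁ + - y₃) * toℤ s₁ + 0ℤ} (toℤ s₃) ≈-refl x≈)) ⟩
      ∑ {q} (λ s₁ → ∑ {q} λ s₂ → ∑ {q} λ s₃ → H ((y₁ + - y₃) * toℤ s₁ + 0ℤ) (toℤ s₂) (toℤ s₃))
        ≡⟨ rescale y₁≉y₃ 0ℤ
             (λ x → ∑ {q} λ s₂ → ∑ {q} λ s₃ → H x (toℤ s₂) (toℤ s₃))
             (λ x≈ → ∑-cong {q} λ s₂ → ∑-cong {q} λ s₃ → H-cong (toℤ s₃) x≈ ≈-refl) ⟩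
      ∑ {q} (λ s₁ → ∑ {q} λ s₂ → ∑ {q} λ s₃ → H (toℤ s₁) (toℤ s₂) (toℤ s₃))
        ≡⟨ ∑-swap {q} (λ s₁ s₂ → ∑ {q} λ s₃ → H (toℤ s₁) (toℤ s₂) (toℤ s₃)) ⟩
      ∑ {q} (λ s₂ → ∑ {q} λ s₁ → ∑ {q} λ s₃ → H (toℤ s₁) (toℤ s₂) (toℤ s₃))
        ≡⟨ ∑-cong {q} (λ s₂ → ∑-swap {q} (λ s₁ s₃ → H (toℤ s₁) (toℤ s₂) (toℤ s₃))) ⟩
      ∑ {q} (λ s₂ → ∑ {q} λ s₃ → ∑ {q} λ s₁ → H (toℤ s₁) (toℤ s₂) (toℤ s₃))
        ≡⟨ ∑-cong {q} (λ s₂ → ∑-cong {q} λ s₃ → eliminate-a (toℤ s₂) (toℤ s₃)) ⟩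
      ∑ {q} (λ s₂ → ∑ {q} λ s₃ → ∑ {q} λ s₁ → G (toℤ s₁) ((y₂ + - y₁) * toℤ s₂ + β (toℤ s₁) (toℤ s₃)) (toℤ s₃))
        ≡⟨ ∑-cong {q} (λ s₂ → ∑-swap {q} (λ s₃ s₁ → G (toℤ s₁) ((y₂ + - y₁) * toℤ s₂ + β (toℤ s₁) (toℤ s₃)) (toℤ s₃))) ⟩
      ∑ {q} (λ s₂ → ∑ {q} λ s₁ → ∑ {q} λ s₃ → G (toℤ s₁) ((y₂ + - y₁) * toℤ s₂ + β (toℤ s₁) (toℤ s₃)) (toℤ s₃))
        ≡⟨ ∑-swap {q} (λ s₂ s₁ → ∑ {q} λ s₃ → G (toℤ s₁) ((y₂ + - y₁) * toℤ s₂ + β (toℤ s₁) (toℤ s₃)) (toℤ s₃)) ⟩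
      ∑ {q} (λ s₁ → ∑ {q} λ s₂ → ∑ {q} λ s₃ → G (toℤ s₁) ((y₂ + - y₁) * toℤ s₂ + β (toℤ s₁) (toℤ s₃)) (toℤ s₃))
        ≡⟨ ∑-cong {q} (λ s₁ → ∑-swap {q} (λ s₂ s₃ → G (toℤ s₁) ((y₂ + - y₁) * toℤ s₂ + β (toℤ s₁) (toℤ s₃)) (toℤ s₃))) ⟩
      ∑ {q} (λ s₁ → ∑ {q} λ s₃ → ∑ {q} λ s₂ → G (toℤ s₁) ((y₂ + - y₁) * toℤ s₂ + β (toℤ s₁) (toℤ s₃)) (toℤ s₃))
        ≡⟨ ∑-cong {q} (λ s₁ → ∑-cong {q} λ s₃ → rescale y₂≉y₁ (β (toℤ s₁) (toℤ s₃))
             (λ x → G (toℤ s₁) x (toℤ s₃)) (λ x≈ → per f ≈-refl x≈ ≈-refl)) ⟩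
      ∑ {q} (λ s₁ → ∑ {q} λ s₃ → ∑ {q} λ s₂ → G (toℤ s₁) (toℤ s₂) (toℤ s₃))
        ≡⟨ ∑-cong {q} (λ s₁ → ∑-swap {q} (λ s₃ s₂ → G (toℤ s₁) (toℤ s₂) (toℤ s₃))) ⟩
      total f ∎
      where
      open ≡-Reasoning
      G : ℤ → ℤ → ℤ → ℤ
      G = at f
      -- The first two coordinates after s₃ has been shifted to make the third one equal to it. Here
      -- x₁ and x₂ stand for (y₁ - y₃) s₁ and (y₂ - y₃) s₂; the second coordinate factors through
      -- them because y² - y₃² = (y + y₃) (y - y₃).
      H₁ H₂ : ℤ → ℤ → ℤ → ℤ
      H₁ x₁ x₂ s = (a + - t * y₃ + s * y₃ + x₂) + x₁
      H₂ x₁ x₂ s = (c + - t * (y₃ * y₃) + s * (y₃ * y₃)) + (y₁ + y₃) * x₁ + (y₂ + y₃) * x₂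
      H : ℤ → ℤ → ℤ → ℤ
      H x₁ x₂ s = G (H₁ x₁ x₂ s) (H₂ x₁ x₂ s) s
      -- Once the first coordinate has become s₁, the second is (y₂ - y₁) s₂ plus this term, which
      -- is free of s₂.
      β : ℤ → ℤ → ℤ
      β x₁ s = (c + - t * (y₃ * y₃) + s * (y₃ * y₃)) + (y₁ + y₃) * (x₁ + - (a + - t * y₃ + s * y₃))
      H-cong : ∀ {x₁ x₁′ x₂ x₂′} s → x₁ ≈ x₁′ → x₂ ≈ x₂′ → H x₁ x₂ s ≡ H x₁′ x₂′ s
      H-cong s x₁≈ x₂≈ = per f (≈-+ (≈-+ (≈-refl {a + - t * y₃ + s * y₃}) x₂≈) x₁≈)
        (≈-+ (≈-+ (≈-refl {c + - t * (y₃ * y₃) + s * (y₃ * y₃)}) (≈-* (≈-refl {y₁ + y₃}) x₁≈))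
            (≈-* (≈-refl {y₂ + y₃}) x₂≈)) (≈-refl {s})
      rescale : ∀ {u} → ¬ (u ≈ 0ℤ) → ∀ b (f : ℤ → ℤ) → (∀ {x y} → x ≈ y → f x ≡ f y) →
                ∑ {q} (λ s → f (u * toℤ s + b)) ≡ ∑ {q} (λ s → f (toℤ s))
      rescale {u} u≉0 b f f-cong = ∑-affine f f-cong u (proj₁ (inverse u u≉0)) b (proj₂ (inverse u u≉0))
      eliminate-t : ∀ s₁ s₂ →
        ∑ {q} (λ s₃ → G (a + s₁ * y₁ + s₂ * y₂ + toℤ s₃ * y₃) (c + s₁ * (y₁ * y₁) + s₂ * (y₂ * y₂) + toℤ s₃ *
            (y₃ * y₃)) (t + s₁ + s₂ + toℤ s₃))
        ≡ ∑ {q} (λ s₃ → H ((y₁ + - y₃) * s₁ + 0ℤ) ((y₂ + - y₃) * s₂ + 0ℤ) (toℤ s₃))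
      eliminate-t s₁ s₂ = trans
        (sym (∑-translate (λ z → G (a + s₁ * y₁ + s₂ * y₂ + z * y₃)
            (c + s₁ * (y₁ * y₁) + s₂ * (y₂ * y₂) + z * (y₃ * y₃)) (t + s₁ + s₂ + z))
          (line-per f (a + s₁ * y₁ + s₂ * y₂) (c + s₁ * (y₁ * y₁) + s₂ * (y₂ * y₂)) (t + s₁ + s₂) y₃)
              (- (t + s₁ + s₂))))
        (∑-cong {q} λ s₃ → cong₃ G (ring₁ a t s₁ s₂ (toℤ s₃) y₁ y₂ y₃) (ring₂ c t s₁ s₂ (toℤ s₃) y₁ y₂ y₃)
            (ring₃ t s₁ s₂ (toℤ s₃)))
        where
        ring₁ : ∀ a t s₁ s₂ s₃ y₁ y₂ y₃ → a + s₁ * y₁ + s₂ * y₂ + (s₃ + - (t + s₁ + s₂)) * y₃ ≡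
          (a + - t * y₃ + s₃ * y₃ + ((y₂ + - y₃) * s₂ + 0ℤ)) + ((y₁ + - y₃) * s₁ + 0ℤ)
        ring₁ = solve-∀
        ring₂ : ∀ c t s₁ s₂ s₃ y₁ y₂ y₃ → c + s₁ * (y₁ * y₁) + s₂ * (y₂ * y₂) + (s₃ + - (t + s₁ + s₂)) * (y₃ * y₃) ≡
          (c + - t * (y₃ * y₃) + s₃ * (y₃ * y₃)) + (y₁ + y₃) * ((y₁ + - y₃) * s₁ + 0ℤ) + (y₂ + y₃) *
              ((y₂ + - y₃) * s₂ + 0ℤ)
        ring₂ = solve-∀
        ring₃ : ∀ t s₁ s₂ s₃ → t + s₁ + s₂ + (s₃ + - (t + s₁ + s₂)) ≡ s₃
        ring₃ = solve-∀
      eliminate-a : ∀ s₂ s₃ →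
        ∑ {q} (λ s₁ → H (toℤ s₁) s₂ s₃) ≡ ∑ {q} (λ s₁ → G (toℤ s₁) ((y₂ + - y₁) * s₂ + β (toℤ s₁) s₃) s₃)
      eliminate-a s₂ s₃ = trans
        (sym (∑-translate (λ x → H x s₂ s₃) (λ x≈ → H-cong s₃ x≈ (≈-refl {s₂})) (- (a + - t * y₃ + s₃ * y₃ + s₂))))
        (∑-cong {q} λ s₁ → cong₂ (λ x y → G x y s₃) (ring₁ (a + - t * y₃ + s₃ * y₃ + s₂) (toℤ s₁))
          (ring₂ (c + - t * (y₃ * y₃) + s₃ * (y₃ * y₃)) (a + - t * y₃ + s₃ * y₃) (toℤ s₁) s₂ y₁ y₂ y₃))
        where
        ring₁ : ∀ x s → x + (s + - x) ≡ s
        ring₁ = solve-∀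
        ring₂ : ∀ γ α s₁ s₂ y₁ y₂ y₃ → γ + (y₁ + y₃) * (s₁ + - (α + s₂)) + (y₂ + y₃) * s₂ ≡
          (y₂ + - y₁) * s₂ + (γ + (y₁ + y₃) * (s₁ + - α))
        ring₂ = solve-∀

    toℤ-distinct : ∀ {i j : Fin q} → i ≢ j → ¬ (toℤ i + - toℤ j ≈ 0ℤ)
    toℤ-distinct {i} {j} i≢j i-j≈0 = i≢j (toℤ-injective (≈-trans (≈-reflexive (ring₁ (toℤ i) (toℤ j)))
      (≈-trans (≈-+ i-j≈0 (≈-refl {toℤ j})) (≈-reflexive (ℤ.+-identityˡ (toℤ j))))))
      where
      ring₁ : ∀ x y → x ≡ (x + - y) + y
      ring₁ = solve-∀

    X-selfAdjoint : ∀ f g → ⟨ f , X g ⟩ ≡ ⟨ X f , g ⟩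
    X-selfAdjoint f g = begin
      ⟨ f , X g ⟩
        ≡⟨ ∑₃-cong (λ a c t → sym (∑-*ˡ {q} (at f a c t) (λ y → at (L (toℤ y) g) a c t))) ⟩
      ∑₃ (λ a c t → ∑ {q} λ y → at f a c t * at (L (toℤ y) g) a c t)
        ≡⟨ ∑₃-∑ {q} (λ y a c t → at f a c t * at (L (toℤ y) g) a c t) ⟩
      ∑ {q} (λ y → ⟨ f , L (toℤ y) g ⟩)
        ≡⟨ ∑-cong {q} (λ y → L-selfAdjoint (toℤ y) f g) ⟩
      ∑ {q} (λ y → ⟨ L (toℤ y) f , g ⟩)
        ≡⟨ sym (∑₃-∑ {q} (λ y a c t → at (L (toℤ y) f) a c t * at g a c t)) ⟩
      ∑₃ (λ a c t → ∑ {q} λ y → at (L (toℤ y) f) a c t * at g a c t)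
        ≡⟨ ∑₃-cong (λ a c t → ∑-*ʳ {q} (at g a c t) (λ y → at (L (toℤ y) f) a c t)) ⟩
      ⟨ X f , g ⟩ ∎
      where open ≡-Reasoning

    ⟨⟩-X : ∀ f → ⟨ f , X f ⟩ ≡ ∑ {q} λ y → ⟨ f , L (toℤ y) f ⟩
    ⟨⟩-X f = trans (∑₃-cong (λ a c t → sym (∑-*ˡ {q} (at f a c t) (λ y → at (L (toℤ y) f) a c t))))
      (∑₃-∑ {q} (λ y a c t → at f a c t * at (L (toℤ y) f) a c t))

    -- On functions of mean zero X / q is a sum of commuting projections in which products of three vanish, so its
    -- spectrum is contained in {0, 1, 2}.  Its complement g to 2 is annihilated by the products of two.
    module _ (f : Fn) (total≡0 : total f ≡ 0ℤ) where
      private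
        2q = + 2 * + q
        g : Fn
        g = 2q ∙ f ⊝ X f

      -- Expand `X` over its directions. A direction different from both i and j yields the total of
      -- f, which is 0; the two remaining ones each repeat a line sum and yield a factor q.
      L-L-X : ∀ {i j} → i ≢ j → L (toℤ i) (L (toℤ j) (X f)) ≗₃ 2q ∙ L (toℤ i) (L (toℤ j) f)
      L-L-X {i} {j} i≢j a c t = begin
        at (L y (L z (X f))) a c t
          ≡⟨ L-cong y (L z (X f)) Y (L-X z f) a c t ⟩
        at (L y Y) a c t
          ≡⟨ ∑-swap {q} (λ s k → at (L z (L (toℤ k) f)) (a + toℤ s * y) (c + toℤ s * (y * y)) (t + toℤ s)) ⟩
        ∑ {q} (λ k → at (L y (L z (L (toℤ k) f))) a c t)
          ≡⟨ ∑-double (λ k → at (L y (L z (L (toℤ k) f))) a c t) i j i≢j (λ k k≢i k≢j →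
               trans (L-L-L y z (toℤ k) (toℤ-distinct (k≢i ∘ sym)) (toℤ-distinct (k≢j ∘ sym))
                   (toℤ-distinct (i≢j ∘ sym)) f a c t) total≡0) ⟩
        at (L y (L z (L y f))) a c t + at (L y (L z (L z f))) a c t
          ≡⟨ cong₂ _+_
               (trans (L-cong y (L z (L y f)) (L y (L z f)) (L-comm z y f) a c t) (L-L y (L z f) a c t))
               (trans (L-cong y (L z (L z f)) (+ q ∙ L z f) (L-L z f) a c t) (L-∙ y (+ q) (L z f) a c t)) ⟩
        + q * at (L y (L z f)) a c t + + q * at (L y (L z f)) a c t
          ≡⟨ ring₁ (+ q) (at (L y (L z f)) a c t) ⟩
        2q * at (L y (L z f)) a c t ∎
        where
        open ≡-Reasoning
        y = toℤ i
        z = toℤ j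
        Y : Fn
        at  Y a c t = ∑ {q} λ k → at (L z (L (toℤ k) f)) a c t
        per Y a≈ c≈ t≈ = ∑-cong {q} λ k → per (L z (L (toℤ k) f)) a≈ c≈ t≈
        ring₁ : ∀ q x → q * x + q * x ≡ (+ 2 * q) * x
        ring₁ = solve-∀

      L-L-g : ∀ {i j} → i ≢ j → ∀ a c t → at (L (toℤ i) (L (toℤ j) g)) a c t ≡ 0ℤ
      L-L-g {i} {j} i≢j a c t = begin
        at (L y (L z g)) a c t
          ≡⟨ L-cong y (L z g) (L z (2q ∙ f) ⊝ L z (X f)) (L-⊝ z (2q ∙ f) (X f)) a c t ⟩
        at (L y (L z (2q ∙ f) ⊝ L z (X f))) a c t
          ≡⟨ L-⊝ y (L z (2q ∙ f)) (L z (X f)) a c t ⟩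
        at (L y (L z (2q ∙ f))) a c t + - at (L y (L z (X f))) a c t
          ≡⟨ cong₂ (λ u v → u + - v)
               (trans (L-cong y (L z (2q ∙ f)) (2q ∙ L z f) (L-∙ z 2q f) a c t) (L-∙ y 2q (L z f) a c t))
               (L-L-X i≢j a c t) ⟩
        2q * at (L y (L z f)) a c t + - (2q * at (L y (L z f)) a c t)
          ≡⟨ ℤ.+-inverseʳ (2q * at (L y (L z f)) a c t) ⟩
        0ℤ ∎
        where
        open ≡-Reasoning
        y = toℤ i
        z = toℤ j

      -- Only the diagonal of the double sum over directions survives, and there `L-L` applies. So
      -- `X` acts on its image of g as multiplication by q.
      X-X-g : X (X g) ≗₃ + q ∙ X g
      X-X-g a c t = trans (∑-cong {q} λ i → trans (L-X (toℤ i) g a c t)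
          (trans (∑-single (λ j → at (L (toℤ i) (L (toℤ j) g)) a c t) i λ j j≢i → L-L-g (j≢i ∘ sym) a c t)
            (L-L (toℤ i) g a c t)))
        (∑-*ˡ {q} (+ q) (λ i → at (L (toℤ i) g) a c t))

      private
        0<q : 0ℤ ℤ.< + q
        0<q = ℤ.+<+ (ℕ.>-nonZero⁻¹ q)

        cancel : ∀ {n} .{{_ : ℤ.Positive n}} {x} → 0ℤ ≤ᶻ n * x → 0ℤ ≤ᶻ x
        cancel {n} {x} 0≤nx = ℤ.*-cancelˡ-≤-pos 0ℤ x n (subst (_≤ᶻ n * x) (sym (ℤ.*-zeroʳ n)) 0≤nx)

        instance
          q-pos : ℤ.Positive (+ q)
          q-pos = ℤ.positive 0<q
          2q-pos : ℤ.Positive 2q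
          2q-pos = ℤ.positive (subst (ℤ._< 2q) (ℤ.*-zeroʳ (+ 2)) (ℤ.*-monoˡ-<-pos (+ 2) 0<q))

        0≤gXg : 0ℤ ≤ᶻ ⟨ g , X g ⟩
        0≤gXg = cancel {+ q} (subst (0ℤ ≤ᶻ_) (sym (trans (sym (⟨⟩-∙ʳ (+ q) g (X g)))
          (trans (sym (⟨⟩-congʳ g (X (X g)) (+ q ∙ X g) X-X-g)) (X-selfAdjoint g (X g))))) (⟨⟩-square (X g)))

        -- From 2q f = g + X f and the self-adjointness of `X`; this trades pairings with f for
        -- pairings with g, where `X-X-g` is available.
        2qf : ∀ h → 2q * ⟨ f , h ⟩ ≡ ⟨ g , h ⟩ + ⟨ f , X h ⟩
        2qf h = begin
          2q * ⟨ f , h ⟩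
            ≡⟨ trans (cong (_*_ 2q) (⟨⟩-comm f h)) (sym (⟨⟩-∙ʳ 2q h f)) ⟩
          ⟨ h , 2q ∙ f ⟩
            ≡⟨ ring₁ ⟨ h , 2q ∙ f ⟩ ⟨ h , X f ⟩ ⟩
          (⟨ h , 2q ∙ f ⟩ + - ⟨ h , X f ⟩) + ⟨ h , X f ⟩
            ≡⟨ cong₂ _+_ (trans (sym (⟨⟩-⊝ʳ h (2q ∙ f) (X f))) (⟨⟩-comm h g))
                (trans (⟨⟩-comm h (X f)) (sym (X-selfAdjoint f h))) ⟩
          ⟨ g , h ⟩ + ⟨ f , X h ⟩ ∎
          where
          open ≡-Reasoning
          ring₁ : ∀ x y → x ≡ (x + - y) + y
          ring₁ = solve-∀

        qfXg : + q * ⟨ f , X g ⟩ ≡ ⟨ g , X g ⟩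
        qfXg = ∙-cancelʳ (+ q * ⟨ f , X g ⟩) _ _ (begin
          + q * ⟨ f , X g ⟩ + + q * ⟨ f , X g ⟩
            ≡⟨ ring₁ (+ q) ⟨ f , X g ⟩ ⟩
          2q * ⟨ f , X g ⟩
            ≡⟨ 2qf (X g) ⟩
          ⟨ g , X g ⟩ + ⟨ f , X (X g) ⟩
            ≡⟨ cong (_+_ ⟨ g , X g ⟩) (trans (⟨⟩-congʳ f (X (X g)) (+ q ∙ X g) X-X-g) (⟨⟩-∙ʳ (+ q) f (X g))) ⟩
          ⟨ g , X g ⟩ + + q * ⟨ f , X g ⟩ ∎)
          where
          open ≡-Reasoning
          ring₁ : ∀ q x → q * x + q * x ≡ (+ 2 * q) * x
          ring₁ = solve-∀

        -- The spectral inequality without diagonalisation: 2q ⟨f, g⟩ = ⟨g, g⟩ + ⟨f, X g⟩, then q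
        -- ⟨f, X g⟩ = ⟨g, X g⟩, and finally q ⟨g, X g⟩ = ⟨X g, X g⟩ is a sum of squares.
        0≤fg : 0ℤ ≤ᶻ ⟨ f , g ⟩
        0≤fg = cancel {2q} (subst (0ℤ ≤ᶻ_) (sym (2qf g)) (ℤ.+-mono-≤ (⟨⟩-square g)
          (cancel {+ q} (subst (0ℤ ≤ᶻ_) (sym qfXg) 0≤gXg))))

      ⟨f,Xf⟩≤2q⟨f,f⟩ : ⟨ f , X f ⟩ ≤ᶻ 2q * ⟨ f , f ⟩
      ⟨f,Xf⟩≤2q⟨f,f⟩ = ℤ.0≤i-j⇒j≤i (subst (0ℤ ≤ᶻ_)
        (trans (⟨⟩-⊝ʳ f (2q ∙ f) (X f)) (cong (_+ - ⟨ f , X f ⟩) (⟨⟩-∙ʳ 2q f f))) 0≤fg)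

    -- A multiple of a projection is positive: q ⟨f, L f⟩ = ⟨L f, L f⟩.
    0≤⟨f,Lf⟩ : ∀ y f → 0ℤ ≤ᶻ ⟨ f , L y f ⟩
    0≤⟨f,Lf⟩ y f = ℤ.*-cancelˡ-≤-pos 0ℤ _ (+ q) {{ℤ.positive (ℤ.+<+ (ℕ.>-nonZero⁻¹ q))}}
      (subst₂ _≤ᶻ_ (sym (ℤ.*-zeroʳ (+ q)))
        (trans (sym (L-selfAdjoint y f (L y f))) (trans (⟨⟩-congʳ f (L y (L y f)) (+ q ∙ L y f) (L-L y f))
            (⟨⟩-∙ʳ (+ q) f (L y f))))
        (⟨⟩-square (L y f)))

  -- Indicator functions and sets without differences in S.

  𝟙 : Bool → ℤ
  𝟙 true  = 1ℤ
  𝟙 false = 0ℤ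

  𝟙-nonneg : ∀ b → 0ℤ ≤ᶻ 𝟙 b
  𝟙-nonneg true  = +≤+ ℕ.z≤n
  𝟙-nonneg false = +≤+ ℕ.z≤n

  𝟙≤1 : ∀ b → 𝟙 b ≤ᶻ 1ℤ
  𝟙≤1 true  = ℤ.≤-refl
  𝟙≤1 false = +≤+ ℕ.z≤n

  𝟙*𝟙-idem : ∀ b c → (𝟙 b * 𝟙 c) * (𝟙 b * 𝟙 c) ≡ 𝟙 b * 𝟙 c
  𝟙*𝟙-idem true  true  = refl
  𝟙*𝟙-idem true  false = refl
  𝟙*𝟙-idem false _     = refl

  ∑-below : ∀ n k → k ℕ.≤ n → ∑ {n} (λ i → 𝟙 (toℕ i ℕ.<ᵇ k)) ≡ + k
  ∑-below n         ℕ.zero    k≤n         = ∑-zero {n} λ i → refl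
  ∑-below (ℕ.suc n) (ℕ.suc k) (ℕ.s≤s k≤n) = trans (∑-suc {n} (λ i → 𝟙 (toℕ i ℕ.<ᵇ ℕ.suc k)))
      (cong (_+_ 1ℤ) (∑-below n k k≤n))

  module Independence (q : ℕ) .{{q≢0 : NonZero q}}
               (inverse : ∀ x → ¬ (Mod._≈_ q x 0ℤ) → Σ ℤ λ v → Mod._≈_ q (x * v) 1ℤ) where
    open Mod q
    open Lines q inverse

    one : Fn
    at  one a c t = 1ℤ
    per one a≈ c≈ t≈ = refl

    q³ : ℤ
    q³ = + q * (+ q * + q)

    L-one : ∀ y a c t → at (L y one) a c t ≡ + q
    L-one y a c t = trans (∑-const q 1ℤ) (ℤ.*-identityʳ (+ q))

    total-one : total one ≡ q³
    total-one = trans (∑-cong {q} λ a → trans (∑-cong {q} λ c → trans (∑-const q 1ℤ) (ℤ.*-identityʳ (+ q)))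
        (∑-const q (+ q))) (∑-const q (+ q * + q))

    ⟨⟩-one : ∀ f → ⟨ f , one ⟩ ≡ total f
    ⟨⟩-one f = ∑₃-cong λ a c t → ℤ.*-identityʳ (at f a c t)

    ⟨⟩-L-one : ∀ f y → ⟨ f , L y one ⟩ ≡ + q * total f
    ⟨⟩-L-one f y = trans (⟨⟩-congʳ f (L y one) (+ q ∙ one)
        (λ a c t → trans (L-one y a c t) (sym (ℤ.*-identityʳ (+ q)))))
      (trans (⟨⟩-∙ʳ (+ q) f one) (cong (_*_ (+ q)) (⟨⟩-one f)))

    -- The factor q³ keeps the mean an integer.
    centre : Fn → Fn
    centre h = q³ ∙ h ⊝ total h ∙ one

    total-centre : ∀ h → total (centre h) ≡ 0ℤ
    total-centre h = begin
      total (centre h)                              ≡⟨ sym (⟨⟩-one (centre h)) ⟩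
      ⟨ centre h , one ⟩                            ≡⟨ ⟨⟩-comm (centre h) one ⟩
      ⟨ one , centre h ⟩                            ≡⟨ ⟨⟩-⊝ʳ one (q³ ∙ h) (total h ∙ one) ⟩
      ⟨ one , q³ ∙ h ⟩ + - ⟨ one , total h ∙ one ⟩  ≡⟨ cong₂ (λ x y → x + - y)
        (trans (⟨⟩-∙ʳ q³ one h) (cong (_*_ q³) (trans (⟨⟩-comm one h) (⟨⟩-one h))))
        (trans (⟨⟩-∙ʳ (total h) one one) (cong (_*_ (total h)) (trans (⟨⟩-one one) total-one))) ⟩
      q³ * total h + - (total h * q³)               ≡⟨ ring₁ q³ (total h) ⟩
      0ℤ ∎
      where
      open ≡-Reasoning
      ring₁ : ∀ x y → x * y + - (y * x) ≡ 0ℤ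
      ring₁ = solve-∀

    ⟨centre,L⟩ : ∀ h y f → ⟨ centre h , L y f ⟩ ≡ q³ * ⟨ h , L y f ⟩ + - (total h * (+ q * total f))
    ⟨centre,L⟩ h y f = begin
      ⟨ centre h , L y f ⟩                             ≡⟨ ⟨⟩-comm (centre h) (L y f) ⟩
      ⟨ L y f , centre h ⟩                             ≡⟨ ⟨⟩-⊝ʳ (L y f) (q³ ∙ h) (total h ∙ one) ⟩
      ⟨ L y f , q³ ∙ h ⟩ + - ⟨ L y f , total h ∙ one ⟩ ≡⟨ cong₂ (λ u v → u + - v)
        (trans (⟨⟩-∙ʳ q³ (L y f) h) (cong (_*_ q³) (⟨⟩-comm (L y f) h)))
        (trans (⟨⟩-∙ʳ (total h) (L y f) one)
            (cong (_*_ (total h)) (trans (sym (L-selfAdjoint y f one)) (⟨⟩-L-one f y)))) ⟩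
      q³ * ⟨ h , L y f ⟩ + - (total h * (+ q * total f)) ∎
      where open ≡-Reasoning

    ⟨centre,Lcentre⟩ : ∀ h y h′ → ⟨ centre h , L y (centre h′) ⟩ ≡ q³ *
        (q³ * ⟨ h , L y h′ ⟩ + - (+ q * (total h * total h′)))
    ⟨centre,Lcentre⟩ h y h′ = begin
      ⟨ centre h , L y (centre h′) ⟩
        ≡⟨ ⟨centre,L⟩ h y (centre h′) ⟩
      q³ * ⟨ h , L y (centre h′) ⟩ + - (total h * (+ q * total (centre h′)))
        ≡⟨ cong₂ (λ u v → q³ * u + - (total h * (+ q * v)))
             (trans (L-selfAdjoint y h (centre h′)) (trans (⟨⟩-comm (L y h) (centre h′)) (⟨centre,L⟩ h′ y h)))
                 (total-centre h′) ⟩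
      q³ * (q³ * ⟨ h′ , L y h ⟩ + - (total h′ * (+ q * total h))) + - (total h * (+ q * 0ℤ))
        ≡⟨ cong (λ u → q³ * (q³ * u + - (total h′ * (+ q * total h))) + - (total h * (+ q * 0ℤ)))
             (trans (L-selfAdjoint y h′ h) (⟨⟩-comm (L y h′) h)) ⟩
      q³ * (q³ * ⟨ h , L y h′ ⟩ + - (total h′ * (+ q * total h))) + - (total h * (+ q * 0ℤ))
        ≡⟨ ring₁ q³ (+ q) ⟨ h , L y h′ ⟩ (total h) (total h′) ⟩
      q³ * (q³ * ⟨ h , L y h′ ⟩ + - (+ q * (total h * total h′))) ∎
      where
      open ≡-Reasoning
      ring₁ : ∀ Q q x H H′ → Q * (Q * x + - (H′ * (q * H))) + - (H * (q * 0ℤ)) ≡ Q * (Q * x + - (q * (H * H′)))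
      ring₁ = solve-∀

    ⟨centre,centre⟩ : ∀ h → ⟨ centre h , centre h ⟩ ≡ q³ * (q³ * ⟨ h , h ⟩ + - (total h * total h))
    ⟨centre,centre⟩ h = begin
      ⟨ c , c ⟩
        ≡⟨ ⟨⟩-⊝ʳ c (q³ ∙ h) (total h ∙ one) ⟩
      ⟨ c , q³ ∙ h ⟩ + - ⟨ c , total h ∙ one ⟩
        ≡⟨ cong₂ (λ u v → u + - v) (⟨⟩-∙ʳ q³ c h) (trans (⟨⟩-∙ʳ (total h) c one)
             (cong (_*_ (total h)) (trans (⟨⟩-one c) (total-centre h)))) ⟩
      q³ * ⟨ c , h ⟩ + - (total h * 0ℤ)
        ≡⟨ cong (λ u → q³ * u + - (total h * 0ℤ)) (trans (⟨⟩-comm c h) (trans (⟨⟩-⊝ʳ h (q³ ∙ h) (total h ∙ one))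
             (cong₂ (λ u v → u + - v) (⟨⟩-∙ʳ q³ h h)
                 (trans (⟨⟩-∙ʳ (total h) h one) (cong (_*_ (total h)) (⟨⟩-one h)))))) ⟩
      q³ * (q³ * ⟨ h , h ⟩ + - (total h * total h)) + - (total h * 0ℤ)
        ≡⟨ ring₁ q³ ⟨ h , h ⟩ (total h) ⟩
      q³ * (q³ * ⟨ h , h ⟩ + - (total h * total h)) ∎
      where
      open ≡-Reasoning
      c = centre h
      ring₁ : ∀ Q x H → Q * (Q * x + - (H * H)) + - (H * 0ℤ) ≡ Q * (Q * x + - (H * H))
      ring₁ = solve-∀

    -- Expand 0 ≤ ⟨f + g, L (f + g)⟩; the sum f + g is the function `s` below.
    -2⟨f,Lg⟩≤ : ∀ y f g → - (+ 2 * ⟨ f , L y g ⟩) ≤ᶻ ⟨ f , L y f ⟩ + ⟨ g , L y g ⟩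
    -2⟨f,Lg⟩≤ y f g = ℤ.0≤i-j⇒j≤i (subst (0ℤ ≤ᶻ_) expand (0≤⟨f,Lf⟩ y s))
      where
      open ≡-Reasoning
      s = f ⊝ ℤ.-1ℤ ∙ g
      half : ∀ h → ⟨ h , L y s ⟩ ≡ ⟨ h , L y f ⟩ + - (ℤ.-1ℤ * ⟨ h , L y g ⟩)
      half h = trans (⟨⟩-congʳ h (L y s) (L y f ⊝ L y (ℤ.-1ℤ ∙ g)) (L-⊝ y f (ℤ.-1ℤ ∙ g)))
        (trans (⟨⟩-⊝ʳ h (L y f) (L y (ℤ.-1ℤ ∙ g))) (cong (λ u → ⟨ h , L y f ⟩ + - u)
        (trans (⟨⟩-congʳ h (L y (ℤ.-1ℤ ∙ g)) (ℤ.-1ℤ ∙ L y g) (L-∙ y ℤ.-1ℤ g)) (⟨⟩-∙ʳ ℤ.-1ℤ h (L y g)))))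
      swap : ∀ h k → ⟨ h , L y k ⟩ ≡ ⟨ k , L y h ⟩
      swap h k = trans (L-selfAdjoint y h k) (⟨⟩-comm (L y h) k)
      ring₁ : ∀ ff fg gg → (ff + - (ℤ.-1ℤ * fg)) + - (ℤ.-1ℤ * (fg + - (ℤ.-1ℤ * gg))) ≡ (ff + gg) + - (- (+ 2 * fg))
      ring₁ = solve-∀
      expand : ⟨ s , L y s ⟩ ≡ (⟨ f , L y f ⟩ + ⟨ g , L y g ⟩) + - (- (+ 2 * ⟨ f , L y g ⟩))
      expand = begin
        ⟨ s , L y s ⟩
          ≡⟨ half s ⟩
        ⟨ s , L y f ⟩ + - (ℤ.-1ℤ * ⟨ s , L y g ⟩)
          ≡⟨ cong₂ (λ u v → u + - (ℤ.-1ℤ * v)) (trans (swap s f) (half f)) (trans (swap s g) (half g)) ⟩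
        (⟨ f , L y f ⟩ + - (ℤ.-1ℤ * ⟨ f , L y g ⟩)) + - (ℤ.-1ℤ * (⟨ g , L y f ⟩ + - (ℤ.-1ℤ * ⟨ g , L y g ⟩)))
          ≡⟨ cong (λ u → (⟨ f , L y f ⟩ + - (ℤ.-1ℤ * ⟨ f , L y g ⟩)) + - (ℤ.-1ℤ * (u + - (ℤ.-1ℤ * ⟨ g , L y g ⟩))))
              (swap g f) ⟩
        (⟨ f , L y f ⟩ + - (ℤ.-1ℤ * ⟨ f , L y g ⟩)) + - (ℤ.-1ℤ * (⟨ f , L y g ⟩ + - (ℤ.-1ℤ * ⟨ g , L y g ⟩)))
          ≡⟨ ring₁ ⟨ f , L y f ⟩ ⟨ f , L y g ⟩ ⟨ g , L y g ⟩ ⟩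
        (⟨ f , L y f ⟩ + ⟨ g , L y g ⟩) + - (- (+ 2 * ⟨ f , L y g ⟩)) ∎

    -- Orthogonality before centring becomes strong negative correlation after it: the centred
    -- pairing equals -q⁴ times the product of the two totals. By positivity of `L` the two energies
    -- must pay for this.
    2q⁴HH′≤ : ∀ y h h′ → ⟨ h , L y h′ ⟩ ≡ 0ℤ → + 2 * (q³ * (+ q * (total h * total h′))) ≤ᶻ
              ⟨ centre h , L y (centre h) ⟩ + ⟨ centre h′ , L y (centre h′) ⟩
    2q⁴HH′≤ y h h′ h⊥h′ = subst (_≤ᶻ ⟨ centre h , L y (centre h) ⟩ + ⟨ centre h′ , L y (centre h′) ⟩)
        (trans (cong (λ u → - (+ 2 * u)) (trans (⟨centre,Lcentre⟩ h y h′)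
        (cong (λ u → q³ * (q³ * u + - (+ q * (total h * total h′)))) h⊥h′))) (ring₁ q³ (+ q) (total h * total h′)))
      (-2⟨f,Lg⟩≤ y (centre h) (centre h′))
      where
      ring₁ : ∀ Q q H → - (+ 2 * (Q * (Q * 0ℤ + - (q * H)))) ≡ + 2 * (Q * (q * H))
      ring₁ = solve-∀

    -- The spectral bound for the centred function. The hypothesis, satisfied by indicator
    -- functions, makes its norm q³ (q³ H - H²) with H the total; the term -H² is dropped.
    ∑⟨centre,Lcentre⟩≤ : ∀ h → ⟨ h , h ⟩ ≡ total h →
      ∑ {q} (λ y → ⟨ centre h , L (toℤ y) (centre h) ⟩) ≤ᶻ (+ 2 * + q) * (q³ * (q³ * total h))
    ∑⟨centre,Lcentre⟩≤ h idem = ℤ.≤-trans (ℤ.≤-reflexive (sym (⟨⟩-X (centre h))))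
      (ℤ.≤-trans (⟨f,Xf⟩≤2q⟨f,f⟩ (centre h) (total-centre h)) (subst₂ _≤ᶻ_ (eq₁) refl
        (ℤ.*-monoˡ-≤-nonNeg (+ 2 * + q) {{nn₁}}
            (ℤ.*-monoˡ-≤-nonNeg q³ {{nn₂}} (ℤ.i≤j⇒i-k≤j (total h * total h) {{nn₃}} (ℤ.≤-refl {q³ * total h}))))))
      where
      nn₁ : ℤ.NonNegative (+ 2 * + q)
      nn₁ = ℤ.nonNegative (subst (0ℤ ≤ᶻ_) (ℤ.pos-* 2 q) (+≤+ ℕ.z≤n))
      nn₂ : ℤ.NonNegative q³
      nn₂ = ℤ.nonNegative (subst (0ℤ ≤ᶻ_) (trans (ℤ.pos-* q (q ℕ.* q)) (cong (_*_ (+ q)) (ℤ.pos-* q q))) (+≤+ ℕ.z≤n))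
      nn₃ : ℤ.NonNegative (total h * total h)
      nn₃ = ℤ.nonNegative (square (total h))
      eq₁ : (+ 2 * + q) * (q³ * (q³ * total h ℤ.- total h * total h)) ≡ (+ 2 * + q) * ⟨ centre h , centre h ⟩
      eq₁ = cong (_*_ (+ 2 * + q)) (sym
          (trans (⟨centre,centre⟩ h) (cong (λ u → q³ * (q³ * u + - (total h * total h))) idem)))

    -- Allows the energies attached to the section b + y to be summed as if they were attached to b.
    ∑∑-translate : ∀ (f : Fin q → ℤ → ℤ) → (∀ i {x y} → x ≈ y → f i x ≡ f i y) →
                   ∑ {q} (λ b → ∑ {q} λ y → f y (toℤ b + toℤ y)) ≡ ∑ {q} λ b → ∑ {q} λ y → f y (toℤ b)
    ∑∑-translate f f-cong = trans (∑-swap {q} λ b y → f y (toℤ b + toℤ y))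
      (trans (∑-cong {q} λ y → ∑-translate (f y) (f-cong y) (toℤ y)) (∑-swap {q} λ y b → f y (toℤ b)))

    module Bound (I : Fin q → Fin q → Fin q → Bool) (k : ℕ) (k≤q : k ℕ.≤ q)
      (independent : ∀ a b c a′ b′ c′ → I a b c ≡ true → I a′ b′ c′ ≡ true → ∀ (y : Fin q) ρ → toℕ y ≢ 0 → 1 ℕ.≤ ρ →
          ρ ℕ.< 2 ℕ.* k →
        toℤ a′ ≈ toℤ a + + ρ * toℤ y → toℤ b′ ≈ toℤ b + toℤ y → toℤ c′ ≈ toℤ c + + ρ * (toℤ y * toℤ y) → ⊥) where

      χ : ℤ → ℤ → ℤ → ℤ
      χ a b c = 𝟙 (I (res a) (res b) (res c))

      seg : ℤ → ℤ
      seg t = 𝟙 (toℕ (res t) ℕ.<ᵇ k)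

      h h′ : ℤ → Fn
      at  (h b) a c t = χ a b c * seg t
      per (h b) a≈ c≈ t≈ = cong₂ _*_ (cong₂ (λ a c → 𝟙 (I a (res b) c)) (res-cong a≈) (res-cong c≈))
          (cong (λ i → 𝟙 (toℕ i ℕ.<ᵇ k)) (res-cong t≈))
      at  (h′ b) a c t = χ a b c * seg (t + - + k)
      per (h′ b) a≈ c≈ t≈ = per (h b) a≈ c≈ (≈-+ t≈ (≈-refl { - + k}))

      size : ℤ → ℤ
      size b = ∑ {q} λ a → ∑ {q} λ c → χ (toℤ a) b (toℤ c)

      total-h : ∀ b → total (h b) ≡ + k * size b
      total-h b = begin
        ∑ {q} (λ a → ∑ {q} λ c → ∑ {q} λ t → χ (toℤ a) b (toℤ c) * seg (toℤ t))
          ≡⟨ ∑-cong {q} (λ a → ∑-cong {q} λ c → trans (∑-*ˡ {q} (χ (toℤ a) b (toℤ c)) (seg ∘ toℤ))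
               (trans (cong (_*_ (χ (toℤ a) b (toℤ c))) ∑seg) (ℤ.*-comm (χ (toℤ a) b (toℤ c)) (+ k)))) ⟩
        ∑ {q} (λ a → ∑ {q} λ c → + k * χ (toℤ a) b (toℤ c))
          ≡⟨ ∑-cong {q} (λ a → ∑-*ˡ {q} (+ k) (λ c → χ (toℤ a) b (toℤ c))) ⟩
        ∑ {q} (λ a → + k * ∑ {q} λ c → χ (toℤ a) b (toℤ c))
          ≡⟨ ∑-*ˡ {q} (+ k) (λ a → ∑ {q} λ c → χ (toℤ a) b (toℤ c)) ⟩
        + k * size b ∎
        where
        open ≡-Reasoning
        ∑seg : ∑ {q} (λ t → seg (toℤ t)) ≡ + k
        ∑seg = trans (∑-cong {q} λ t → cong (λ i → 𝟙 (toℕ i ℕ.<ᵇ k)) (res-toℤ t)) (∑-below q k k≤q)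

      total-h′ : ∀ b → total (h′ b) ≡ + k * size b
      total-h′ b = trans (∑-cong {q} λ a → ∑-cong {q} λ c → ∑-translate (λ t → at (h b) (toℤ a) (toℤ c) t)
        (per (h b) (≈-refl {toℤ a}) (≈-refl {toℤ c})) (- + k)) (total-h b)

      idem-h : ∀ b → ⟨ h b , h b ⟩ ≡ total (h b)
      idem-h b = ∑₃-cong λ a c t → 𝟙*𝟙-idem (I (res a) (res b) (res c)) (toℕ (res t) ℕ.<ᵇ k)

      idem-h′ : ∀ b → ⟨ h′ b , h′ b ⟩ ≡ total (h′ b)
      idem-h′ b = ∑₃-cong λ a c t → 𝟙*𝟙-idem (I (res a) (res b) (res c)) (toℕ (res (t + - + k)) ℕ.<ᵇ k)

      -- A nonzero term exhibits two points of `I` whose difference is (ρ y, y, ρ y²), where ρ is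
      -- the distance travelled in the coordinate t.
      orthogonal : ∀ b (y : Fin q) → toℕ y ≢ 0 → ⟨ h b , L (toℤ y) (h′ (b + toℤ y)) ⟩ ≡ 0ℤ
      orthogonal b y y≢0 = ∑-zero {q} λ a → ∑-zero {q} λ c → ∑-zero {q} λ t →
        trans (sym (∑-*ˡ {q} (at (h b) (toℤ a) (toℤ c) (toℤ t)) (λ s → f (toℤ a) (toℤ c) (toℤ t) (toℤ s))))
          (∑-zero {q} λ s → vanish (toℤ a) (toℤ c) (toℤ t) (toℤ s))
        where
        f : ℤ → ℤ → ℤ → ℤ → ℤ
        f a c t s = χ (a + s * toℤ y) (b + toℤ y) (c + s * (toℤ y * toℤ y)) * seg (t + s + - + k)
        vanish : ∀ a c t s → (χ a b c * seg t) * f a c t s ≡ 0ℤ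
        vanish a c t s with I (res a) (res b) (res c) in eqI | toℕ (res t) ℕ.<ᵇ k in eqJ
                          | I (res (a + s * toℤ y)) (res (b + toℤ y)) (res (c + s * (toℤ y * toℤ y))) in eqI′
                          | toℕ (res (t + s + - + k)) ℕ.<ᵇ k in eqJ′
        ... | false | _     | _     | _     = refl
        ... | true  | false | _     | _     = refl
        ... | true  | true  | false | _     = refl
        ... | true  | true  | true  | false = refl
        ... | true  | true  | true  | true  = contradiction′ (independent _ _ _ _ _ _ eqI eqI′ y ρ y≢0 1≤ρ ρ<2k
            (≈-trans (toℤ-res _) (≈-+ (≈-sym (toℤ-res a)) (≈-* s≈ρ ≈-refl)))
            (≈-trans (toℤ-res _) (≈-+ (≈-sym (toℤ-res b)) ≈-refl))
            (≈-trans (toℤ-res _) (≈-+ (≈-sym (toℤ-res c)) (≈-* s≈ρ (≈-refl {toℤ y * toℤ y})))))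
          where
          contradiction′ : ∀ {x} → ⊥ → x ≡ 0ℤ
          contradiction′ ()
          t₀ = toℕ (res t)
          t₁ = toℕ (res (t + s + - + k))
          t₀<k : t₀ ℕ.< k
          t₀<k = ℕ.<ᵇ⇒< t₀ k (subst T (sym eqJ) _)
          t₁<k : t₁ ℕ.< k
          t₁<k = ℕ.<ᵇ⇒< t₁ k (subst T (sym eqJ′) _)
          -- The starting point lies in [0, k) and the end point t₁ + k in [k, 2k), so no truncation
          -- occurs and 1 ≤ ρ < 2k.
          ρ = t₁ ℕ.+ k ℕ.∸ t₀
          1≤ρ : 1 ℕ.≤ ρ
          1≤ρ = ℕ.m<n⇒0<n∸m (ℕ.<-≤-trans t₀<k (ℕ.m≤n+m k t₁))
          ρ<2k : ρ ℕ.< 2 ℕ.* k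
          ρ<2k = ℕ.≤-<-trans (ℕ.m∸n≤m (t₁ ℕ.+ k) t₀) (subst (t₁ ℕ.+ k ℕ.<_) (cong (k ℕ.+_) (sym (ℕ.+-identityʳ k)))
              (ℕ.+-monoˡ-< k t₁<k))
          ρ-eq : + ρ ≡ + t₁ + + k + - + t₀
          ρ-eq = trans (sym (ℤ.⊖-≥ (ℕ.≤-trans (ℕ.<⇒≤ t₀<k) (ℕ.m≤n+m k t₁)))) (sym (ℤ.m-n≡m⊖n (t₁ ℕ.+ k) t₀))
          ring₁ : ∀ t s k → s ≡ (t + s + - k) + k + - t
          ring₁ = solve-∀
          s≈ρ : s ≈ + ρ
          s≈ρ = ≈-trans (≈-reflexive (ring₁ t s (+ k))) (≈-trans
            (≈-+ (≈-+ (≈-sym (toℤ-res (t + s + - + k))) (≈-refl {+ k})) (≈-neg (≈-sym (toℤ-res t))))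
                (≈-reflexive (sym ρ-eq)))

      private
        δ : Fin q → ℤ
        δ y = 𝟙 (toℕ y ℕ.<ᵇ 1)

        ∑δ : ∑ {q} δ ≡ 1ℤ
        ∑δ = ∑-below q 1 (ℕ.>-nonZero⁻¹ q)

        q² : ℤ
        q² = + q * + q

        0≤q³ : 0ℤ ≤ᶻ q³
        0≤q³ = subst (0ℤ ≤ᶻ_) (trans (ℤ.pos-* q (q ℕ.* q)) (cong (_*_ (+ q)) (ℤ.pos-* q q))) (+≤+ ℕ.z≤n)

        *-nonneg : ∀ {x y} → 0ℤ ≤ᶻ x → 0ℤ ≤ᶻ y → 0ℤ ≤ᶻ x * y
        *-nonneg {+ x} {+ y} _ _ = subst (0ℤ ≤ᶻ_) (ℤ.pos-* x y) (+≤+ ℕ.z≤n)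

        *-monoˡ : ∀ {z x y} → 0ℤ ≤ᶻ z → x ≤ᶻ y → z * x ≤ᶻ z * y
        *-monoˡ {z} 0≤z = ℤ.*-monoˡ-≤-nonNeg z {{ℤ.nonNegative 0≤z}}

        0≤size : ∀ b → 0ℤ ≤ᶻ size b
        0≤size b = ∑-nonneg {q} λ a → ∑-nonneg {q} λ c → 𝟙-nonneg _

        size≤q² : ∀ b → size b ≤ᶻ q²
        size≤q² b = ℤ.≤-trans (∑-mono-≤ {q} {g = λ _ → + q} λ a →
            ℤ.≤-trans (∑-mono-≤ {q} {g = λ _ → 1ℤ} λ c → 𝟙≤1 _)
                (ℤ.≤-reflexive (trans (∑-const q 1ℤ) (ℤ.*-identityʳ (+ q)))))
          (ℤ.≤-reflexive (∑-const q (+ q)))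

        size-cong : ∀ {x y} → x ≈ y → size x ≡ size y
        size-cong x≈y = ∑-cong {q} λ a → ∑-cong {q} λ c → cong (λ b → 𝟙 (I (res (toℤ a)) b (res (toℤ c))))
            (res-cong x≈y)

        h-cong : ∀ {x y} → x ≈ y → h x ≗₃ h y
        h-cong x≈y a c t = cong (λ b → 𝟙 (I (res a) b (res c)) * seg t) (res-cong x≈y)

        T₀ : ℤ
        T₀ = ∑ {q} λ b → size (toℤ b)

        E E′ : ℤ → Fin q → ℤ
        E  b y = ⟨ centre (h b) , L (toℤ y) (centre (h b)) ⟩
        E′ b y = ⟨ centre (h′ b) , L (toℤ y) (centre (h′ b)) ⟩

        E′-cong : ∀ y {b b′} → b ≈ b′ → E′ b y ≡ E′ b′ y
        E′-cong y {b} {b′} b≈b′ = ∑₃-cong λ a c t → cong₂ _*_ (centre-cong a c t)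
          (L-cong (toℤ y) (centre (h′ b)) (centre (h′ b′)) centre-cong a c t)
          where
          centre-cong : centre (h′ b) ≗₃ centre (h′ b′)
          centre-cong a c t = cong₂ (λ u v → q³ * u + - (v * 1ℤ)) (h-cong b≈b′ a c (t + - + k))
            (trans (total-h′ b) (trans (cong (_*_ (+ k)) (size-cong b≈b′)) (sym (total-h′ b′))))

        -- The factor 2 q⁴ k shared by both sides of the summed inequality; it is positive and is
        -- cancelled at the end.
        C : ℤ
        C = (+ 2 * (q³ * + q)) * + k

        -- For y ≠ 0 this is `2q⁴HH′≤` with totals k times the section sizes. For y = 0
        -- orthogonality fails; subtracting q² times the size of the section, at least its square,
        -- makes the left side nonpositive, while the right side is nonnegative.
        pointwise : ∀ (b y : Fin q) → (C * + k) *
            (size (toℤ b) * size (toℤ b + toℤ y) + - (δ y * (q² * size (toℤ b)))) ≤ᶻ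
                    E (toℤ b) y + E′ (toℤ b + toℤ y) y
        pointwise b y with toℕ y in eq
        ... | ℕ.zero  = ℤ.≤-trans
          (subst₂ _≤ᶻ_ (ring₁ (C * + k) q² n n′) (ℤ.*-zeroʳ (C * + k))
            (*-monoˡ {C * + k} 0≤Ck (*-mono-≤0 (0≤size (toℤ b)) (size≤q² (toℤ b + + 0)))))
          (ℤ.+-mono-≤ (0≤⟨f,Lf⟩ (+ 0) (centre (h (toℤ b)))) (0≤⟨f,Lf⟩ (+ 0) (centre (h′ (toℤ b + + 0)))))
          where
          n = size (toℤ b)
          n′ = size (toℤ b + + 0)
          0≤Ck : 0ℤ ≤ᶻ C * + k
          0≤Ck = *-nonneg (*-nonneg (*-nonneg {+ 2} (+≤+ ℕ.z≤n) (*-nonneg 0≤q³ (+≤+ ℕ.z≤n))) (+≤+ ℕ.z≤n)) (+≤+ ℕ.z≤n)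
          ring₁ : ∀ C Q n n′ → C * (n * (n′ + - Q)) ≡ C * (n * n′ + - (1ℤ * (Q * n)))
          ring₁ = solve-∀
          *-mono-≤0 : ∀ {x y z} → 0ℤ ≤ᶻ x → y ≤ᶻ z → x * (y + - z) ≤ᶻ 0ℤ
          *-mono-≤0 {x} {y} {z} 0≤x y≤z = subst (x * (y + - z) ≤ᶻ_) (ℤ.*-zeroʳ x) (*-monoˡ 0≤x (ℤ.i≤j⇒i-j≤0 y≤z))
        ... | ℕ.suc m = subst (_≤ᶻ E₁)
            (trans (cong (λ u → + 2 * (q³ * (+ q * u))) (cong₂ _*_ (total-h (toℤ b)) (total-h′ (toℤ b + + ℕ.suc m))))
            (ring₁ q³ (+ q) (+ k) q² n n′))
          (2q⁴HH′≤ (+ ℕ.suc m) (h (toℤ b)) (h′ (toℤ b + + ℕ.suc m))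
            (subst (λ j → ⟨ h (toℤ b) , L (+ j) (h′ (toℤ b + + j)) ⟩ ≡ 0ℤ) eq
                (orthogonal (toℤ b) y λ y≡0 → ℕ.0≢1+n (trans (sym y≡0) eq))))
          where
          n = size (toℤ b)
          n′ = size (toℤ b + + ℕ.suc m)
          E₁ = ⟨ centre (h (toℤ b)) , L (+ ℕ.suc m) (centre (h (toℤ b))) ⟩
             + ⟨ centre (h′ (toℤ b + + ℕ.suc m)) , L (+ ℕ.suc m) (centre (h′ (toℤ b + + ℕ.suc m))) ⟩
          ring₁ : ∀ Q q k R n n′ → + 2 * (Q * (q * ((k * n) * (k * n′)))) ≡ (((+ 2 * (Q * q)) * k) * k) *
              (n * n′ + - (0ℤ * (R * n)))
          ring₁ = solve-∀

        ∑-lhs : ∑ {q} (λ b → ∑ {q} λ y →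
            (C * + k) * (size (toℤ b) * size (toℤ b + toℤ y) + - (δ y * (q² * size (toℤ b)))))
                ≡ C * (+ k * (T₀ * T₀ + - (q² * T₀)))
        ∑-lhs = begin
          ∑ {q} (λ b → ∑ {q} λ y → (C * + k) * (size (toℤ b) * size (toℤ b + toℤ y) + - (δ y * (q² * size (toℤ b)))))
            ≡⟨ ∑-cong {q} (λ b → inner (toℤ b)) ⟩
          ∑ {q} (λ b → (C * + k) * (size (toℤ b) * (T₀ + - q²)))
            ≡⟨ ∑-*ˡ {q} (C * + k) (λ b → size (toℤ b) * (T₀ + - q²)) ⟩
          (C * + k) * ∑ {q} (λ b → size (toℤ b) * (T₀ + - q²))
            ≡⟨ cong (_*_ (C * + k)) (∑-*ʳ {q} (T₀ + - q²) (λ b → size (toℤ b))) ⟩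
          (C * + k) * (T₀ * (T₀ + - q²))
            ≡⟨ ring₁ C (+ k) T₀ q² ⟩
          C * (+ k * (T₀ * T₀ + - (q² * T₀))) ∎
          where
          open ≡-Reasoning
          ring₁ : ∀ C k T Q → (C * k) * (T * (T + - Q)) ≡ C * (k * (T * T + - (Q * T)))
          ring₁ = solve-∀
          ring₂ : ∀ n Q T → n * T + - (1ℤ * (Q * n)) ≡ n * (T + - Q)
          ring₂ = solve-∀
          inner : ∀ b → ∑ {q} (λ y → (C * + k) * (size b * size (b + toℤ y) + - (δ y * (q² * size b)))) ≡ (C * + k) *
              (size b * (T₀ + - q²))
          inner b = trans (∑-*ˡ {q} (C * + k) (λ y → size b * size (b + toℤ y) + - (δ y * (q² * size b))))
              (cong (_*_ (C * + k)) (begin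
            ∑ {q} (λ y → size b * size (b + toℤ y) + - (δ y * (q² * size b)))
              ≡⟨ ∑-+ {q} (λ y → size b * size (b + toℤ y)) (λ y → - (δ y * (q² * size b))) ⟩
            ∑ {q} (λ y → size b * size (b + toℤ y)) + ∑ {q} (λ y → - (δ y * (q² * size b)))
              ≡⟨ cong₂ _+_ (trans (∑-*ˡ {q} (size b) (λ y → size (b + toℤ y))) (cong (_*_ (size b))
                   (trans (∑-cong {q} λ y → cong size (ℤ.+-comm b (toℤ y))) (∑-translate size size-cong b))))
                   (trans (∑-neg {q} (λ y → δ y * (q² * size b)))
                       (cong -_ (trans (∑-*ʳ {q} (q² * size b) δ) (cong (_* (q² * size b)) ∑δ)))) ⟩
            size b * T₀ + - (1ℤ * (q² * size b))
              ≡⟨ ring₂ (size b) q² T₀ ⟩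
            size b * (T₀ + - q²) ∎))

        ∑-rhs : ∑ {q} (λ b → ∑ {q} λ y → E (toℤ b) y + E′ (toℤ b + toℤ y) y) ≤ᶻ C * (+ 2 * (q³ * T₀))
        ∑-rhs = begin
          ∑ {q} (λ b → ∑ {q} λ y → E (toℤ b) y + E′ (toℤ b + toℤ y) y)
            ≡⟨ trans (∑-cong {q} λ b → ∑-+ {q} (E (toℤ b)) (λ y → E′ (toℤ b + toℤ y) y))
                (∑-+ {q} (λ b → ∑ {q} (E (toℤ b))) (λ b → ∑ {q} λ y → E′ (toℤ b + toℤ y) y)) ⟩
          ∑ {q} (λ b → ∑ {q} (E (toℤ b))) + ∑ {q} (λ b → ∑ {q} λ y → E′ (toℤ b + toℤ y) y)
            ≡⟨ cong (_+_ (∑ {q} (λ b → ∑ {q} (E (toℤ b))))) (∑∑-translate (λ y b → E′ b y) E′-cong) ⟩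
          ∑ {q} (λ b → ∑ {q} (E (toℤ b))) + ∑ {q} (λ b → ∑ {q} (E′ (toℤ b)))
            ≤⟨ ℤ.+-mono-≤ (∑-mono-≤ {q} λ b → ∑⟨centre,Lcentre⟩≤ (h (toℤ b)) (idem-h (toℤ b)))
                          (∑-mono-≤ {q} λ b → ∑⟨centre,Lcentre⟩≤ (h′ (toℤ b)) (idem-h′ (toℤ b))) ⟩
          ∑ {q} (λ b → (+ 2 * + q) * (q³ * (q³ * total (h (toℤ b))))) + ∑ {q}
              (λ b → (+ 2 * + q) * (q³ * (q³ * total (h′ (toℤ b)))))
            ≡⟨ cong₂ _+_ (sum-H (λ b → total (h b)) total-h) (sum-H (λ b → total (h′ b)) total-h′) ⟩
          ((+ 2 * + q) * (q³ * (q³ * + k))) * T₀ + ((+ 2 * + q) * (q³ * (q³ * + k))) * T₀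
            ≡⟨ ring₂ q³ (+ q) (+ k) T₀ ⟩
          C * (+ 2 * (q³ * T₀)) ∎
          where
          open ℤ.≤-Reasoning
          ring₁ : ∀ Q q k n → (+ 2 * q) * (Q * (Q * (k * n))) ≡ ((+ 2 * q) * (Q * (Q * k))) * n
          ring₁ = solve-∀
          ring₂ : ∀ Q q k T → ((+ 2 * q) * (Q * (Q * k))) * T + ((+ 2 * q) * (Q * (Q * k))) * T ≡
              ((+ 2 * (Q * q)) * k) * (+ 2 * (Q * T))
          ring₂ = solve-∀
          sum-H : ∀ H → (∀ b → H b ≡ + k * size b) → ∑ {q} (λ b → (+ 2 * + q) * (q³ * (q³ * H (toℤ b)))) ≡
              ((+ 2 * + q) * (q³ * (q³ * + k))) * T₀
          sum-H H H≡ = trans (∑-cong {q} λ b → trans (cong (λ u → (+ 2 * + q) * (q³ * (q³ * u))) (H≡ (toℤ b)))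
              (ring₁ q³ (+ q) (+ k) (size (toℤ b))))
            (∑-*ˡ {q} ((+ 2 * + q) * (q³ * (q³ * + k))) (λ b → size (toℤ b)))

      ∣I∣ : ℤ
      ∣I∣ = ∑ {q} λ b → ∑ {q} λ a → ∑ {q} λ c → 𝟙 (I a b c)

      -- Summing `pointwise` over b and y and cancelling `C` leaves k (T² - q² T) ≤ 2 q³ T for T =
      -- |I|. Division by T settles the nonempty case.
      k∣I∣≤kq²+2q³ : 1 ℕ.≤ k → + k * ∣I∣ ≤ᶻ + k * (+ q * + q) + + 2 * q³
      k∣I∣≤kq²+2q³ 1≤k = subst (λ T → + k * T ≤ᶻ + k * (+ q * + q) + + 2 * q³) T₀≡∣I∣
          (bound T₀ (∑-nonneg {q} λ b → 0≤size (toℤ b)) cancelled)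
        where
        T₀≡∣I∣ : T₀ ≡ ∣I∣
        T₀≡∣I∣ = ∑-cong {q} λ b → ∑-cong {q} λ a → ∑-cong {q} λ c → cong 𝟙 (cong₃ I (res-toℤ a) (res-toℤ b) (res-toℤ c))
        pos-* : ∀ {x y} → ℤ.Positive x → ℤ.Positive y → ℤ.Positive (x * y)
        pos-* {x} {y} 0<x 0<y = ℤ.positive
            (subst (ℤ._< x * y) (ℤ.*-zeroʳ x) (ℤ.*-monoˡ-<-pos x {{0<x}} (ℤ.positive⁻¹ y {{0<y}})))
        pos : ∀ n → 1 ℕ.≤ n → ℤ.Positive (+ n)
        pos n 1≤n = ℤ.positive (ℤ.+<+ 1≤n)
        qpos : ℤ.Positive (+ q)
        qpos = pos q (ℕ.>-nonZero⁻¹ q)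
        cancelled : + k * (T₀ * T₀ + - (q² * T₀)) ≤ᶻ + 2 * (q³ * T₀)
        cancelled = ℤ.*-cancelˡ-≤-pos _ _ C
            {{pos-* {+ 2 * (q³ * + q)} (pos-* {+ 2} _ (pos-* {q³} (pos-* {+ q} qpos (pos-* {+ q} qpos qpos)) qpos))
            (pos k 1≤k)}}
          (ℤ.≤-trans (ℤ.≤-reflexive (sym ∑-lhs)) (ℤ.≤-trans (∑-mono-≤ {q} λ b → ∑-mono-≤ {q} (pointwise b)) ∑-rhs))
        ring₁ : ∀ k T Q → T * (k * (T + - Q)) ≡ k * (T * T + - (Q * T))
        ring₁ = solve-∀
        ring₂ : ∀ Q T → + 2 * (Q * T) ≡ T * (+ 2 * Q)
        ring₂ = solve-∀
        ring₃ : ∀ k T Q → k * Q + k * (T + - Q) ≡ k * T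
        ring₃ = solve-∀
        bound : ∀ T → 0ℤ ≤ᶻ T → + k * (T * T + - (q² * T)) ≤ᶻ + 2 * (q³ * T) → + k * T ≤ᶻ + k * q² + + 2 * q³
        bound T@(+ ℕ.zero)  _ _  = subst (_≤ᶻ + k * q² + + 2 * q³) (sym (ℤ.*-zeroʳ (+ k)))
          (ℤ.+-mono-≤ (*-nonneg {+ k} (+≤+ ℕ.z≤n) (*-nonneg {+ q} (+≤+ ℕ.z≤n) (+≤+ ℕ.z≤n)))
              (*-nonneg {+ 2} (+≤+ ℕ.z≤n) 0≤q³))
        bound T@(+ ℕ.suc n) _ le = subst (_≤ᶻ + k * q² + + 2 * q³) (ring₃ (+ k) T q²) (ℤ.+-monoʳ-≤ (+ k * q²)
          (ℤ.*-cancelˡ-≤-pos _ _ T (subst₂ _≤ᶻ_ (sym (ring₁ (+ k) T q²)) (ring₂ q³ T) le)))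

  -- Inverses modulo a prime and the algebra of sum-freeness.

  module PrimeMod (q : ℕ) .{{q≢0 : NonZero q}} (q-prime : Prime q) where
    open Mod q

    inverseℕ : ∀ n .{{_ : NonZero n}} → n ℕ.< q → Σ ℤ λ v → + n * v ≈ 1ℤ
    inverseℕ n n<q with coprime-Bézout (prime⇒coprime q-prime n<q)
    ... | Bézout.+- x y eq = - + y ,
        mod (- + x) (trans (ring₁ (+ n) (+ y)) (cong (_+_ 1ℤ) (trans (cong -_ eqℤ) (ℤ.neg-distribˡ-* (+ x) (+ q)))))
      where
      eqℤ : 1ℤ + + y * + n ≡ + x * + q
      eqℤ = trans (trans (cong (_+_ 1ℤ) (sym (ℤ.pos-* y n))) (sym (ℤ.pos-+ 1 (y ℕ.* n))))
          (trans (cong +_ eq) (ℤ.pos-* x q))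
      ring₁ : ∀ n y → n * - y ≡ 1ℤ + - (1ℤ + y * n)
      ring₁ = solve-∀
    ... | Bézout.-+ x y eq = + y , mod (+ x) (trans (ℤ.*-comm (+ n) (+ y)) (sym eqℤ))
      where
      eqℤ : 1ℤ + + x * + q ≡ + y * + n
      eqℤ = trans (trans (cong (_+_ 1ℤ) (sym (ℤ.pos-* x q))) (sym (ℤ.pos-+ 1 (x ℕ.* q))))
          (trans (cong +_ eq) (ℤ.pos-* y n))

    inverse : ∀ x → ¬ (x ≈ 0ℤ) → Σ ℤ λ v → x * v ≈ 1ℤ
    inverse x x≉0 with toℕ (res x) in eq
    ... | ℕ.zero  = contradiction (≈-trans (≈-sym (toℤ-res x)) (≈-reflexive (cong +_ eq))) x≉0
    ... | ℕ.suc m with inverseℕ (ℕ.suc m) (subst (ℕ._< q) eq (Fin.toℕ<n (res x)))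
    ...   | v , mv≈1 = v , ≈-trans (≈-* (≈-trans (≈-sym (toℤ-res x)) (≈-reflexive (cong +_ eq))) (≈-refl {v})) mv≈1

    cancel-unit : ∀ x y → ¬ (x ≈ 0ℤ) → x * y ≈ 0ℤ → y ≈ 0ℤ
    cancel-unit x y x≉0 xy≈0 with inverse x x≉0
    ... | v , xv≈1 = ≈-trans (≈-reflexive (sym (ℤ.*-identityˡ y))) (≈-trans (≈-* (≈-sym xv≈1) (≈-refl {y}))
      (≈-trans (≈-reflexive (ring₁ x v y)) (≈-trans (≈-* (≈-refl {v}) xy≈0) (≈-reflexive (ℤ.*-zeroʳ v)))))
      where
      ring₁ : ∀ x v y → (x * v) * y ≡ v * (x * y)
      ring₁ = solve-∀

    ≉0 : ∀ {n} → n ≢ 0 → n ℕ.< q → ¬ (+ n ≈ 0ℤ)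
    ≉0 n≢0 n<q n≈0 = n≢0 (ℤ.+-injective (small-≈0 n<q n≈0))

    -- The three relations force (r + r′) y y′ = 0.
    parabolic-sumFree : ∀ {r r′ y y′} r″ y″ → r ℕ.+ r′ ≢ 0 → r ℕ.+ r′ ℕ.< q → y ≢ 0 → y ℕ.< q → y′ ≢ 0 → y′ ℕ.< q →
      + r * + y + + r′ * + y′ ≈ r″ * y″ → + y + + y′ ≈ y″ →
      + r * (+ y * + y) + + r′ * (+ y′ * + y′) ≈ r″ * (y″ * y″) → ⊥
    parabolic-sumFree {r} {r′} {y} {y′} r″ y″ r+r′≢0 r+r′<q y≢0 y<q y′≢0 y′<q e₁ e₂ e₃ =
      ≉0 y′≢0 y′<q (cancel-unit (+ y) (+ y′) (≉0 y≢0 y<q) (cancel-unit (+ (r ℕ.+ r′)) (+ y * + y′) (≉0 r+r′≢0 r+r′<q)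
        (≈-trans (≈-reflexive (ring₁ (+ r) (+ r′) (+ y) (+ y′)))
        (≈-trans (≈-+ (≈-* e₁ e₂) (≈-neg e₃)) (≈-reflexive (ring₂ r″ y″))))))
      where
      ring₁ : ∀ r r′ y y′ → (r + r′) * (y * y′) ≡ (r * y + r′ * y′) * (y + y′) + - (r * (y * y) + r′ * (y′ * y′))
      ring₁ = solve-∀
      ring₂ : ∀ r y → (r * y) * y + - (r * (y * y)) ≡ 0ℤ
      ring₂ = solve-∀

  -- Subsets, their cardinalities, and digit expansions.

  comprehension : ∀ {n} {P : Fin n → Set} → (∀ x → Dec (P x)) → Subset n
  comprehension P? = tabulate (does ∘ P?)

  ∈-comprehension⁺ : ∀ {n} {P : Fin n → Set} (P? : ∀ x → Dec (P x)) {x} → P x → x ∈ comprehension P?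
  ∈-comprehension⁺ P? {x} px = Vec.lookup⇒[]= x _ (trans (Vec.lookup∘tabulate (does ∘ P?) x) (dec-true (P? x) px))

  ∈-comprehension⁻ : ∀ {n} {P : Fin n → Set} (P? : ∀ x → Dec (P x)) {x} → x ∈ comprehension P? → P x
  ∈-comprehension⁻ P? {x} x∈ with P? x | trans (sym (Vec.lookup∘tabulate (does ∘ P?) x)) (Vec.[]=⇒lookup x∈)
  ... | yes px | _  = px
  ... | no _   | ()

  ∣_∣≡∑ : ∀ {n} (A : Subset n) → + Subset.∣ A ∣ ≡ ∑ λ i → 𝟙 (lookup A i)
  ∣ [] ∣≡∑          = sym (∑-empty _)
  ∣ inside  ∷ A ∣≡∑ = trans (cong (_+_ 1ℤ) ∣ A ∣≡∑) (sym (∑-suc λ i → 𝟙 (lookup (inside ∷ A) i)))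
  ∣ outside ∷ A ∣≡∑ = trans (trans ∣ A ∣≡∑ (sym (ℤ.+-identityˡ _))) (sym (∑-suc λ i → 𝟙 (lookup (outside ∷ A) i)))

  rank : ∀ {n} {A : Subset n} {x} → x ∈ A → Fin Subset.∣ A ∣
  rank {A = inside  ∷ A} here       = zero
  rank {A = inside  ∷ A} (there x∈) = suc (rank x∈)
  rank {A = outside ∷ A} (there x∈) = rank x∈

  rank-injective : ∀ {n} {A : Subset n} {x y} (x∈ : x ∈ A) (y∈ : y ∈ A) → rank x∈ ≡ rank y∈ → x ≡ y
  rank-injective {A = inside  ∷ A} here       here       eq = refl
  rank-injective {A = inside  ∷ A} (there x∈) (there y∈) eq = cong suc (rank-injective x∈ y∈ (Fin.suc-injective eq))
  rank-injective {A = outside ∷ A} (there x∈) (there y∈) eq = cong suc (rank-injective x∈ y∈ eq)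

  injection⇒≤∣_∣ : ∀ {m n} (A : Subset n) (f : Fin m → Fin n) → (∀ i → f i ∈ A) → Injective _≡_ _≡_ f → m ℕ.≤ Subset.∣
      A ∣
  injection⇒≤∣ A ∣ f f∈A f-inj = Fin.injective⇒≤ {f = λ i → rank (f∈A i)} λ {i} {j} eq →
      f-inj (rank-injective (f∈A i) (f∈A j) eq)

  injection₃⇒≤∣_∣ : ∀ {m₁ m₂ m₃ n} (A : Subset n) (f : Fin m₁ → Fin m₂ → Fin m₃ → Fin n) → (∀ i j k → f i j k ∈ A) →
    (∀ i i′ j j′ k k′ → f i j k ≡ f i′ j′ k′ → i ≡ i′ × j ≡ j′ × k ≡ k′) → m₁ ℕ.* (m₂ ℕ.* m₃) ℕ.≤ Subset.∣ A ∣
  injection₃⇒≤∣_∣ {m₁} {m₂} {m₃} A f f∈A f-inj = injection⇒≤∣ A ∣ (f₃ ∘ split) (λ i → f∈A _ _ _)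
    λ {x} {y} eq → trans (sym (merge-split x)) (trans (cong merge (f₃-inj (split x) (split y) eq)) (merge-split y))
    where
    Triple = Fin m₁ × Fin m₂ × Fin m₃
    split : Fin (m₁ ℕ.* (m₂ ℕ.* m₃)) → Triple
    split x = proj₁ (remQuot (m₂ ℕ.* m₃) x) , remQuot m₃ (proj₂ (remQuot {m₁} (m₂ ℕ.* m₃) x))
    merge : Triple → Fin (m₁ ℕ.* (m₂ ℕ.* m₃))
    merge (i , j , k) = combine i (combine j k)
    merge-split : ∀ x → merge (split x) ≡ x
    merge-split x = trans (cong (combine (proj₁ (remQuot {m₁} (m₂ ℕ.* m₃) x)))
      (Fin.combine-remQuot {m₂} m₃ (proj₂ (remQuot {m₁} (m₂ ℕ.* m₃) x)))) (Fin.combine-remQuot {m₁} (m₂ ℕ.* m₃) x)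
    f₃ : Triple → Fin _
    f₃ (i , j , k) = f i j k
    f₃-inj : ∀ x y → f₃ x ≡ f₃ y → x ≡ y
    f₃-inj (i , j , k) (i′ , j′ , k′) eq with f-inj i i′ j j′ k k′ eq
    ... | refl , refl , refl = refl

  digits-unique : ∀ d {r r′ m m′} → r ℕ.< d → r′ ℕ.< d → r ℕ.+ m ℕ.* d ≡ r′ ℕ.+ m′ ℕ.* d → r ≡ r′ × m ≡ m′
  digits-unique d {r} {r′} {m} {m′} r<d r′<d eq = r≡r′ ,
    ℕ.*-cancelʳ-≡ m m′ d (ℕ.+-cancelˡ-≡ r _ _ (trans eq (cong (ℕ._+ m′ ℕ.* d) (sym r≡r′))))
    where
    instance
      d≢0 : NonZero d
      d≢0 = ℕ.>-nonZero (ℕ.≤-<-trans ℕ.z≤n r<d)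
    r≡r′ : r ≡ r′
    r≡r′ = begin
      r                        ≡⟨ ℕ.m<n⇒m%n≡m r<d ⟨
      r ℕ.% d                  ≡⟨ ℕ.[m+kn]%n≡m%n r m d ⟨
      (r ℕ.+ m ℕ.* d) ℕ.% d    ≡⟨ cong (ℕ._% d) eq ⟩
      (r′ ℕ.+ m′ ℕ.* d) ℕ.% d  ≡⟨ ℕ.[m+kn]%n≡m%n r′ m′ d ⟩
      r′ ℕ.% d                 ≡⟨ ℕ.m<n⇒m%n≡m r′<d ⟩
      r′                       ∎
      where open ≡-Reasoning

  digits-< : ∀ {d e r m} → r ℕ.< d → m ℕ.< e → r ℕ.+ m ℕ.* d ℕ.< e ℕ.* d
  digits-< {d} {e} {r} {m} r<d m<e = ℕ.<-≤-trans (ℕ.+-monoˡ-< (m ℕ.* d) r<d) (ℕ.*-monoˡ-≤ d m<e)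

  module ModExtra (q : ℕ) .{{q≢0 : NonZero q}} where
    open Mod q

    ≈-injective-< : ∀ {m n} → m ℕ.< q → n ℕ.< q → + m ≈ + n → m ≡ n
    ≈-injective-< {m} {n} m<q n<q m≈n = trans (sym (Fin.toℕ-fromℕ< m<q)) (trans (cong toℕ (toℤ-injective
      (subst₂ _≈_ (cong +_ (sym (Fin.toℕ-fromℕ< m<q))) (cong +_ (sym (Fin.toℕ-fromℕ< n<q))) m≈n))) (Fin.toℕ-fromℕ< n<q))

    ∣⇒≈0 : ∀ {x} → + q Unsigned.∣ x → x ≈ 0ℤ
    ∣⇒≈0 {x} q∣x with Signed.∣ᵤ⇒∣ {+ q} {x} q∣x
    ... | Signed.divides k eq = mod k (trans eq (sym (ℤ.+-identityˡ (k * + q))))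

    ≈0⇒∣ : ∀ {x} → x ≈ 0ℤ → + q Unsigned.∣ x
    ≈0⇒∣ {x} (mod k eq) = Signed.∣⇒∣ᵤ {+ q} {x} (Signed.divides k (trans eq (ℤ.+-identityˡ (k * + q))))

    infix 4 _≈?_
    _≈?_ : ∀ x y → Dec (x ≈ y)
    x ≈? y = map′ (λ eq → ≈-trans (≈-sym (toℤ-res x)) (≈-trans (≈-reflexive (cong toℤ eq)) (toℤ-res y))) res-cong
        (res x Fin.≟ res y)

  -- Transplanting S from 𝔽_q³ to 𝔽_p.

  module Embedding (q : ℕ) .{{q≢0 : NonZero q}} (q-prime : Prime q) (k : ℕ) (1≤k : 1 ℕ.≤ k) (4k≤q : 4 ℕ.* k ℕ.≤ q)
                   (w : ℕ) (1≤w : 1 ℕ.≤ w) (p : ℕ) .{{p≢0 : NonZero p}} where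

    -- Once the subtractions are moved across, each side of x + y = z adds three digits below q in
    -- every coordinate, hence a base above 3q. One side also adds two offsets below `w`, hence the
    -- spacing 2w.
    D E : ℕ
    D = 4 ℕ.* q
    E = 2 ℕ.* w

    open Mod q
    open ModExtra q
    open PrimeMod q q-prime
    open Mod p using () renaming (_≈_ to _≈ₚ_; ≈-refl to ≈ₚ-refl; ≈-trans to ≈ₚ-trans; ≈-sym to ≈ₚ-sym; ≈-+ to ≈ₚ-+;
      ≈-neg to ≈ₚ-neg; ≈-reflexive to ≈ₚ-reflexive; res to resₚ; toℤ-res to toℤ-resₚ; res-cong to resₚ-cong;
      ∑-translate to ∑ₚ-translate; res-toℤ to resₚ-toℤ)
    open ModExtra p using () renaming (≈-injective-< to ≈ₚ-injective-<; ∣⇒≈0 to ∣⇒≈ₚ0; ≈0⇒∣ to ≈ₚ0⇒∣; _≈?_ to _≈ₚ?_)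

    -- Each side of the rearranged equation is a natural number below 3 D³ E, so a congruence modulo
    -- p between them is an equality.
    module _ (3D³E≤p : (3 ℕ.* (D ℕ.* D ℕ.* D)) ℕ.* E ℕ.≤ p) where

      encode : ℕ → ℕ → ℕ → ℕ
      encode a b c = a ℕ.+ (b ℕ.+ c ℕ.* D) ℕ.* D

      G : Fin q → Fin q → Fin q → ℕ
      G a b c = encode (toℕ a) (toℕ b) (toℕ c)

      3q<D : ∀ {a b c} → a ℕ.< q → b ℕ.< q → c ℕ.< q → a ℕ.+ b ℕ.+ c ℕ.< D
      3q<D {a} {b} {c} a<q b<q c<q = ℕ.<-≤-trans (ℕ.+-mono-< (ℕ.+-mono-< a<q b<q) c<q)
          (subst (q ℕ.+ q ℕ.+ q ℕ.≤_) (ring₁ q) (ℕ.m≤m+n (q ℕ.+ q ℕ.+ q) q))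
        where
        ring₁ : ∀ q → q ℕ.+ q ℕ.+ q ℕ.+ q ≡ 4 ℕ.* q
        ring₁ = ℕ-Solver.solve-∀

      q≤D : q ℕ.≤ D
      q≤D = ℕ.m≤m+n q (3 ℕ.* q)

      <D : ∀ (a : Fin q) → toℕ a ℕ.< D
      <D a = ℕ.<-≤-trans (Fin.toℕ<n a) q≤D

      G<D³ : ∀ a b c → G a b c ℕ.< D ℕ.* D ℕ.* D
      G<D³ a b c = digits-< {m = toℕ b ℕ.+ toℕ c ℕ.* D} (<D a) (digits-< {m = toℕ c} (<D b) (<D c))

      value<p : ∀ {r N} → r ℕ.< E → N ℕ.< 3 ℕ.* (D ℕ.* D ℕ.* D) → r ℕ.+ N ℕ.* E ℕ.< p
      value<p r<E N<3D³ = ℕ.<-≤-trans (digits-< r<E N<3D³) 3D³E≤p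

      3G<3D³ : ∀ {x y z} → x ℕ.< D ℕ.* D ℕ.* D → y ℕ.< D ℕ.* D ℕ.* D → z ℕ.< D ℕ.* D ℕ.* D → x ℕ.+ y ℕ.+ z ℕ.< 3 ℕ.*
          (D ℕ.* D ℕ.* D)
      3G<3D³ {x} {y} {z} x< y< z< = subst (x ℕ.+ y ℕ.+ z ℕ.<_) (ring₁ (D ℕ.* D ℕ.* D))
          (ℕ.+-mono-< (ℕ.+-mono-< x< y<) z<)
        where
        ring₁ : ∀ q → q ℕ.+ q ℕ.+ q ≡ 3 ℕ.* q
        ring₁ = ℕ-Solver.solve-∀

      -- S = {(ρ y, y, ρ y²) : 1 ≤ ρ < 2k, y ≠ 0} ⊆ 𝔽_q³ enters only through pairs (a,b,c), (a′,b′,c′) whose difference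
      -- lies in S.
      Difference : (a b c a′ b′ c′ y : Fin q) → Fin (2 ℕ.* k) → Set
      Difference a b c a′ b′ c′ y ρ = toℕ y ≢ 0 × toℕ ρ ≢ 0 × toℤ a′ ≈ toℤ a + toℤ ρ * toℤ y × toℤ b′ ≈ toℤ b + toℤ y
        × toℤ c′ ≈ toℤ c + toℤ ρ * (toℤ y * toℤ y)

      -- The negative part of the difference of codes is kept on the left, so that sums of such
      -- relations can be compared as natural numbers.
      Near : Fin p → (a b c a′ b′ c′ : Fin q) → Fin w → Set
      Near x a b c a′ b′ c′ e = toℤ x + + (G a b c) * + E ≈ₚ toℤ e + + (G a′ b′ c′) * + E

      -- A is the union of the intervals E (G v′ - G v) + [0 , E/2) over v′ - v ∈ S.  Sums of three values of G have no
      -- carries in base D = 4q, and so x + y = z in A forces the same relation between the elements of S.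
      InA : Fin p → Set
      InA x = ∃ λ a → ∃ λ b → ∃ λ c → ∃ λ a′ → ∃ λ b′ → ∃ λ c′ → ∃ λ y → ∃ λ ρ → Difference a b c a′ b′ c′ y ρ
        × ∃ (Near x a b c a′ b′ c′)

      InA? : ∀ x → Dec (InA x)
      InA? x = Fin.any? λ a → Fin.any? λ b → Fin.any? λ c → Fin.any? λ a′ → Fin.any? λ b′ → Fin.any? λ c′ →
          Fin.any? λ y → Fin.any? λ ρ →
        ((¬? (toℕ y ℕ.≟ 0)) ×-dec (¬? (toℕ ρ ℕ.≟ 0)) ×-dec (_ ≈? _) ×-dec (_ ≈? _) ×-dec (_ ≈? _)) ×-dec Fin.any?
            λ e → _ ≈ₚ? _

      abstract
        A : Subset p
        A = comprehension InA?

        ∈A⁺ : ∀ {x} → InA x → x ∈ A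
        ∈A⁺ = ∈-comprehension⁺ InA?

        ∈A⁻ : ∀ {x} → x ∈ A → InA x
        ∈A⁻ = ∈-comprehension⁻ InA?

      private
        -- The digit equation is u₁′ - u₁ + u₂′ - u₂ = u₃′ - u₃ with all minus signs cleared;
        -- reducing it modulo q recovers the relation between the differences.
        differences-add : ∀ (u₁ u₂ u₃ u₁′ u₂′ u₃′ : Fin q) {d₁ d₂ d₃} → toℤ u₁′ ≈ toℤ u₁ + d₁ → toℤ u₂′ ≈ toℤ u₂ +
            d₂ → toℤ u₃′ ≈ toℤ u₃ + d₃ →
          toℕ u₁′ ℕ.+ toℕ u₂′ ℕ.+ toℕ u₃ ≡ toℕ u₁ ℕ.+ toℕ u₂ ℕ.+ toℕ u₃′ → d₁ + d₂ ≈ d₃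
        differences-add u₁ u₂ u₃ u₁′ u₂′ u₃′ {d₁} {d₂} {d₃} e₁ e₂ e₃ eq =
          ≈-trans (≈-reflexive (ring₁ (toℤ u₁) (toℤ u₂) (toℤ u₃) d₁ d₂))
          (≈-trans (≈-+ (≈-+ (≈-+ (≈-sym e₁) (≈-sym e₂)) (≈-refl {toℤ u₃})) (≈-refl { - (toℤ u₁ + toℤ u₂ + toℤ u₃)}))
          (≈-trans (≈-reflexive (cong (λ u → u + - (toℤ u₁ + toℤ u₂ + toℤ u₃)) (cong +_ eq)))
          (≈-trans (≈-+ (≈-+ (≈-refl {toℤ u₁ + toℤ u₂}) e₃) (≈-refl { - (toℤ u₁ + toℤ u₂ + toℤ u₃)}))
          (≈-reflexive (ring₂ (toℤ u₁ + toℤ u₂) (toℤ u₃) d₃)))))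
          where
          ring₁ : ∀ u₁ u₂ u₃ d₁ d₂ → d₁ + d₂ ≡ ((u₁ + d₁) + (u₂ + d₂) + u₃) + - (u₁ + u₂ + u₃)
          ring₁ = solve-∀
          ring₂ : ∀ u u₃ d → (u + (u₃ + d)) + - (u + u₃) ≡ d
          ring₂ = solve-∀

        near-add : ∀ x₁ x₂ x₃ g₁ g₂ g₃ g₁′ g₂′ g₃′ e₁ e₂ e₃ → x₁ + + g₁ * + E ≈ₚ + e₁ + + g₁′ * + E → x₂ + + g₂ * + E
            ≈ₚ + e₂ + + g₂′ * + E →
          x₃ + + g₃ * + E ≈ₚ + e₃ + + g₃′ * + E → (x₁ + x₂) + - x₃ ≈ₚ 0ℤ →
          + ((e₁ ℕ.+ e₂) ℕ.+ (g₁′ ℕ.+ g₂′ ℕ.+ g₃) ℕ.* E) ≈ₚ + (e₃ ℕ.+ (g₁ ℕ.+ g₂ ℕ.+ g₃′) ℕ.* E)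
        near-add x₁ x₂ x₃ g₁ g₂ g₃ g₁′ g₂′ g₃′ e₁ e₂ e₃ n₁ n₂ n₃ sum≈0 =
          ≈ₚ-trans (≈ₚ-reflexive (trans (cong (_+_ (+ (e₁ ℕ.+ e₂))) (ℤ.pos-* (g₁′ ℕ.+ g₂′ ℕ.+ g₃) E))
              (ring₁ (+ e₁) (+ e₂) (+ g₁′) (+ g₂′) (+ g₃) (+ E))))
          (≈ₚ-trans (≈ₚ-+ (≈ₚ-+ (≈ₚ-sym n₁) (≈ₚ-sym n₂)) (≈ₚ-refl {+ g₃ * + E}))
          (≈ₚ-trans (≈ₚ-reflexive (ring₂ x₁ x₂ x₃ (+ g₁) (+ g₂) (+ g₃) (+ E)))
          (≈ₚ-trans (≈ₚ-+ (≈ₚ-+ n₃ sum≈0) (≈ₚ-refl {(+ g₁ + + g₂) * + E}))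
          (≈ₚ-reflexive (trans (ring₃ (+ e₃) (+ g₃′) (+ g₁) (+ g₂) (+ E))
              (cong (_+_ (+ e₃)) (sym (ℤ.pos-* (g₁ ℕ.+ g₂ ℕ.+ g₃′) E))))))))
          where
          ring₁ : ∀ e₁ e₂ g₁ g₂ g₃ E → (e₁ + e₂) + (g₁ + g₂ + g₃) * E ≡ ((e₁ + g₁ * E) + (e₂ + g₂ * E)) + g₃ * E
          ring₁ = solve-∀
          ring₂ : ∀ x₁ x₂ x₃ g₁ g₂ g₃ E → ((x₁ + g₁ * E) + (x₂ + g₂ * E)) + g₃ * E ≡
              ((x₃ + g₃ * E) + ((x₁ + x₂) + - x₃)) + (g₁ + g₂) * E
          ring₂ = solve-∀
          ring₃ : ∀ e₃ g₃ g₁ g₂ E → ((e₃ + g₃ * E) + 0ℤ) + (g₁ + g₂) * E ≡ e₃ + (g₁ + g₂ + g₃) * E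
          ring₃ = solve-∀

      A-sumFree : SchurSolutionFree p A
      A-sumFree (x₁ , x₂ , x₃ , x₁∈A , x₂∈A , x₃∈A , _ , _ , _ , p∣) with ∈A⁻ x₁∈A | ∈A⁻ x₂∈A | ∈A⁻ x₃∈A
      ... | a₁ , b₁ , c₁ , a₁′ , b₁′ , c₁′ , y₁ , ρ₁ , (y₁≢0 , ρ₁≢0 , α₁ , β₁ , γ₁) , e₁ , n₁
          | a₂ , b₂ , c₂ , a₂′ , b₂′ , c₂′ , y₂ , ρ₂ , (y₂≢0 , ρ₂≢0 , α₂ , β₂ , γ₂) , e₂ , n₂
          | a₃ , b₃ , c₃ , a₃′ , b₃′ , c₃′ , y₃ , ρ₃ , (_ , _ , α₃ , β₃ , γ₃) , e₃ , n₃ =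
        parabolic-sumFree {toℕ ρ₁} {toℕ ρ₂} {toℕ y₁} {toℕ y₂} (toℤ ρ₃) (toℤ y₃) (ρ₁≢0 ∘ ℕ.m+n≡0⇒m≡0 (toℕ ρ₁) {toℕ ρ₂})
            ρ₁+ρ₂<q y₁≢0 (Fin.toℕ<n y₁) y₂≢0 (Fin.toℕ<n y₂)
          (differences-add a₁ a₂ a₃ a₁′ a₂′ a₃′ {toℤ ρ₁ * toℤ y₁} {toℤ ρ₂ * toℤ y₂} α₁ α₂ α₃ (proj₁ a-digit))
          (differences-add b₁ b₂ b₃ b₁′ b₂′ b₃′ {toℤ y₁} {toℤ y₂} β₁ β₂ β₃ (proj₁ b-digit))
          (differences-add c₁ c₂ c₃ c₁′ c₂′ c₃′ {toℤ ρ₁ * (toℤ y₁ * toℤ y₁)} {toℤ ρ₂ * (toℤ y₂ * toℤ y₂)} γ₁ γ₂ γ₃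
              (proj₂ b-digit))
        where
        ρ₁+ρ₂<q : toℕ ρ₁ ℕ.+ toℕ ρ₂ ℕ.< q
        ρ₁+ρ₂<q = ℕ.<-≤-trans (ℕ.+-mono-< (Fin.toℕ<n ρ₁) (Fin.toℕ<n ρ₂)) (subst (ℕ._≤ q) (ring₁ k) 4k≤q)
          where
          ring₁ : ∀ k → 4 ℕ.* k ≡ 2 ℕ.* k ℕ.+ 2 ℕ.* k
          ring₁ = ℕ-Solver.solve-∀
        N N′ : ℕ
        N  = G a₁′ b₁′ c₁′ ℕ.+ G a₂′ b₂′ c₂′ ℕ.+ G a₃ b₃ c₃
        N′ = G a₁ b₁ c₁ ℕ.+ G a₂ b₂ c₂ ℕ.+ G a₃′ b₃′ c₃′
        e₁+e₂<E : toℕ e₁ ℕ.+ toℕ e₂ ℕ.< E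
        e₁+e₂<E = subst (toℕ e₁ ℕ.+ toℕ e₂ ℕ.<_) (cong (w ℕ.+_) (sym (ℕ.+-identityʳ w)))
            (ℕ.+-mono-< (Fin.toℕ<n e₁) (Fin.toℕ<n e₂))
        e₃<E : toℕ e₃ ℕ.< E
        e₃<E = ℕ.<-≤-trans (Fin.toℕ<n e₃) (ℕ.m≤m+n w (w ℕ.+ 0))
        value-eq : (toℕ e₁ ℕ.+ toℕ e₂) ℕ.+ N ℕ.* E ≡ toℕ e₃ ℕ.+ N′ ℕ.* E
        value-eq = ≈ₚ-injective-< (value<p {N = N} e₁+e₂<E (3G<3D³ (G<D³ a₁′ b₁′ c₁′) (G<D³ a₂′ b₂′ c₂′)
            (G<D³ a₃ b₃ c₃)))
          (value<p {N = N′} e₃<E (3G<3D³ (G<D³ a₁ b₁ c₁) (G<D³ a₂ b₂ c₂) (G<D³ a₃′ b₃′ c₃′)))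
          (near-add (toℤ x₁) (toℤ x₂) (toℤ x₃) (G a₁ b₁ c₁) (G a₂ b₂ c₂) (G a₃ b₃ c₃) (G a₁′ b₁′ c₁′) (G a₂′ b₂′ c₂′)
              (G a₃′ b₃′ c₃′)
            (toℕ e₁) (toℕ e₂) (toℕ e₃) n₁ n₂ n₃ (∣⇒≈ₚ0 p∣))
        N≡N′ : N ≡ N′
        N≡N′ = proj₂ (digits-unique E e₁+e₂<E e₃<E value-eq)
        regroup : ∀ D a a′ a″ b b′ b″ c c′ c″ → (a ℕ.+ (b ℕ.+ c ℕ.* D) ℕ.* D) ℕ.+ (a′ ℕ.+ (b′ ℕ.+ c′ ℕ.* D) ℕ.* D) ℕ.+
            (a″ ℕ.+ (b″ ℕ.+ c″ ℕ.* D) ℕ.* D)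
          ≡ (a ℕ.+ a′ ℕ.+ a″) ℕ.+ ((b ℕ.+ b′ ℕ.+ b″) ℕ.+ (c ℕ.+ c′ ℕ.+ c″) ℕ.* D) ℕ.* D
        regroup = ℕ-Solver.solve-∀
        a-digit : toℕ a₁′ ℕ.+ toℕ a₂′ ℕ.+ toℕ a₃ ≡ toℕ a₁ ℕ.+ toℕ a₂ ℕ.+ toℕ a₃′ × _
        a-digit = digits-unique D (3q<D (Fin.toℕ<n a₁′) (Fin.toℕ<n a₂′) (Fin.toℕ<n a₃))
            (3q<D (Fin.toℕ<n a₁) (Fin.toℕ<n a₂) (Fin.toℕ<n a₃′))
          (trans (sym (regroup D (toℕ a₁′) (toℕ a₂′) (toℕ a₃) (toℕ b₁′) (toℕ b₂′) (toℕ b₃) (toℕ c₁′) (toℕ c₂′)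
              (toℕ c₃)))
          (trans N≡N′ (regroup D (toℕ a₁) (toℕ a₂) (toℕ a₃′) (toℕ b₁) (toℕ b₂) (toℕ b₃′) (toℕ c₁) (toℕ c₂) (toℕ c₃′))))
        b-digit : toℕ b₁′ ℕ.+ toℕ b₂′ ℕ.+ toℕ b₃ ≡ toℕ b₁ ℕ.+ toℕ b₂ ℕ.+ toℕ b₃′ × toℕ c₁′ ℕ.+ toℕ c₂′ ℕ.+ toℕ c₃ ≡
            toℕ c₁ ℕ.+ toℕ c₂ ℕ.+ toℕ c₃′
        b-digit = digits-unique D (3q<D (Fin.toℕ<n b₁′) (Fin.toℕ<n b₂′) (Fin.toℕ<n b₃))
            (3q<D (Fin.toℕ<n b₁) (Fin.toℕ<n b₂) (Fin.toℕ<n b₃′)) (proj₂ a-digit)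

      module _ (I : Subset p) (I-independent : Independent p A I) where
        private
          -- The pullback of `I` along v ↦ t + E G(v), that is, the trace of `I` on a copy of 𝔽_q³
          -- placed at the translate t.
          fibre : Fin p → Fin q → Fin q → Fin q → Bool
          fibre t a b c = lookup I (resₚ (toℤ t + + (G a b c) * + E))

          0<E : 0 ℕ.< E
          0<E = ℕ.≤-trans 1≤w (ℕ.m≤m+n w (w ℕ.+ 0))

          GE<p : ∀ a b c → 0 ℕ.+ G a b c ℕ.* E ℕ.< p
          GE<p a b c = value<p {0} {G a b c} 0<E (ℕ.<-≤-trans (G<D³ a b c) (ℕ.m≤m+n (D ℕ.* D ℕ.* D) _))

          -- Two points of the fibre whose difference lies in S map to vertices joined by an arc
          -- with offset 0. These vertices are distinct: the codes determine b, and b′ = b + y with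
          -- y ≠ 0.
          fibre-independent : ∀ t a b c a′ b′ c′ → fibre t a b c ≡ true → fibre t a′ b′ c′ ≡ true → ∀ (y : Fin q) ρ →
              toℕ y ≢ 0 → 1 ℕ.≤ ρ → ρ ℕ.< 2 ℕ.* k →
            toℤ a′ ≈ toℤ a + + ρ * toℤ y → toℤ b′ ≈ toℤ b + toℤ y → toℤ c′ ≈ toℤ c + + ρ * (toℤ y * toℤ y) → ⊥
          fibre-independent t a b c a′ b′ c′ u∈I v∈I y ρ y≢0 1≤ρ ρ<2k α β γ =
            I-independent u v (Vec.lookup⇒[]= u I u∈I) (Vec.lookup⇒[]= v I v∈I) u≢v
              (x , ∈A⁺ (a , b , c , a′ , b′ , c′ , y , ρ′ , (y≢0 , subst (_≢ 0) (sym ρ′≡ρ) (ℕ.m<n⇒n≢0 1≤ρ) ,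
                subst (λ r → toℤ a′ ≈ toℤ a + + r * toℤ y) (sym ρ′≡ρ) α , β ,
                subst (λ r → toℤ c′ ≈ toℤ c + + r * (toℤ y * toℤ y)) (sym ρ′≡ρ) γ) , fromℕ< 1≤w , near) , ≈ₚ0⇒∣ arc)
            where
            g g′ : ℤ
            g  = + (G a b c) * + E
            g′ = + (G a′ b′ c′) * + E
            u v x : Fin p
            u = resₚ (toℤ t + g)
            v = resₚ (toℤ t + g′)
            x = resₚ (g′ + - g)
            ρ′ : Fin (2 ℕ.* k)
            ρ′ = fromℕ< ρ<2k
            ρ′≡ρ : toℕ ρ′ ≡ ρ
            ρ′≡ρ = Fin.toℕ-fromℕ< ρ<2k
            ring₁ : ∀ g g′ → (g′ + - g) + g ≡ 0ℤ + g′
            ring₁ = solve-∀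
            near : toℤ x + g ≈ₚ toℤ (fromℕ< 1≤w) + g′
            near = ≈ₚ-trans (≈ₚ-+ (toℤ-resₚ (g′ + - g)) (≈ₚ-refl {g}))
                (≈ₚ-reflexive (trans (ring₁ g g′) (cong (λ e → + e + g′) (sym (Fin.toℕ-fromℕ< 1≤w)))))
            ring₂ : ∀ t g g′ → ((t + g′) + - (t + g)) + - (g′ + - g) ≡ 0ℤ
            ring₂ = solve-∀
            arc : (toℤ v ℤ.- toℤ u) ℤ.- toℤ x ≈ₚ 0ℤ
            arc = ≈ₚ-trans (≈ₚ-+ (≈ₚ-+ (toℤ-resₚ (toℤ t + g′)) (≈ₚ-neg (toℤ-resₚ (toℤ t + g))))
                (≈ₚ-neg (toℤ-resₚ (g′ + - g))))
              (≈ₚ-reflexive (ring₂ (toℤ t) g g′))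
            ring₃ : ∀ t g → g ≡ - t + (t + g)
            ring₃ = solve-∀
            ring₄ : ∀ b y → y ≡ (b + y) + - b
            ring₄ = solve-∀
            u≢v : u ≢ v
            u≢v u≡v = ≉0 y≢0 (Fin.toℕ<n y) (≈-trans (≈-reflexive (ring₄ (toℤ b) (toℤ y)))
                (≈-trans (≈-+ (≈-sym β) (≈-refl { - toℤ b}))
                    (≈-reflexive (trans (cong (λ i → + i + - toℤ b) (sym b≡b′)) (ℤ.+-inverseʳ (toℤ b))))))
              where
              g≈g′ : g ≈ₚ g′
              g≈g′ = ≈ₚ-trans (≈ₚ-reflexive (ring₃ (toℤ t) g)) (≈ₚ-trans (≈ₚ-+ (≈ₚ-refl { - toℤ t})
                (≈ₚ-trans (≈ₚ-sym (toℤ-resₚ (toℤ t + g)))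
                    (≈ₚ-trans (≈ₚ-reflexive (cong toℤ u≡v)) (toℤ-resₚ (toℤ t + g′)))))
                (≈ₚ-reflexive (sym (ring₃ (toℤ t) g′))))
              GE≡ : 0 ℕ.+ G a b c ℕ.* E ≡ 0 ℕ.+ G a′ b′ c′ ℕ.* E
              GE≡ = ≈ₚ-injective-< (GE<p a b c) (GE<p a′ b′ c′)
                  (subst₂ _≈ₚ_ (sym (ℤ.pos-* (G a b c) E)) (sym (ℤ.pos-* (G a′ b′ c′) E)) g≈g′)
              b≡b′ : toℕ b ≡ toℕ b′
              b≡b′ = proj₁ (digits-unique D {m = toℕ c} {m′ = toℕ c′} (<D b) (<D b′)
                  (proj₂ (digits-unique D (<D a) (<D a′) (proj₂ (digits-unique E 0<E 0<E GE≡)))))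

          k≤q : k ℕ.≤ q
          k≤q = ℕ.≤-trans (ℕ.m≤m+n k (3 ℕ.* k)) 4k≤q

          open Independence q inverse using (q³)

          size : Fin p → ℤ
          size t = ∑ {q} λ b → ∑ {q} λ a → ∑ {q} λ c → 𝟙 (fibre t a b c)

          fibre-bound : ∀ t → + k * size t ≤ᶻ + k * (+ q * + q) + + 2 * q³
          fibre-bound t = Independence.Bound.k∣I∣≤kq²+2q³ q inverse (fibre t) k k≤q (fibre-independent t) 1≤k

          -- Double counting: for a fixed point of 𝔽_q³ its image runs over all of 𝔽_p as t does,
          -- and so hits `I` exactly |I| times.
          ∑size : ∑ {p} size ≡ q³ * + Subset.∣ I ∣
          ∑size = begin
            ∑ {p} (λ t → ∑ {q} λ b → ∑ {q} λ a → ∑ {q} λ c → 𝟙 (fibre t a b c))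
              ≡⟨ ∑-swap {p} (λ t b → ∑ {q} λ a → ∑ {q} λ c → 𝟙 (fibre t a b c)) ⟩
            ∑ {q} (λ b → ∑ {p} λ t → ∑ {q} λ a → ∑ {q} λ c → 𝟙 (fibre t a b c))
              ≡⟨ ∑-cong {q} (λ b → trans (∑-swap {p} (λ t a → ∑ {q} λ c → 𝟙 (fibre t a b c)))
                  (∑-cong {q} λ a → trans (∑-swap {p} (λ t c → 𝟙 (fibre t a b c)))
                   (∑-cong {q} λ c → translate (+ (G a b c) * + E)))) ⟩
            ∑ {q} (λ b → ∑ {q} λ a → ∑ {q} λ c → + Subset.∣ I ∣)
              ≡⟨ trans (∑-cong {q} λ b → trans (∑-cong {q} λ a → ∑-const q (+ Subset.∣ I ∣))
                  (∑-const q (+ q * + Subset.∣ I ∣))) (∑-const q (+ q * (+ q * + Subset.∣ I ∣))) ⟩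
            + q * (+ q * (+ q * + Subset.∣ I ∣))
              ≡⟨ ring₁ (+ q) (+ Subset.∣ I ∣) ⟩
            q³ * + Subset.∣ I ∣ ∎
            where
            open ≡-Reasoning
            ring₁ : ∀ q x → q * (q * (q * x)) ≡ (q * (q * q)) * x
            ring₁ = solve-∀
            translate : ∀ g → ∑ {p} (λ t → 𝟙 (lookup I (resₚ (toℤ t + g)))) ≡ + Subset.∣ I ∣
            translate g = trans (∑ₚ-translate (λ z → 𝟙 (lookup I (resₚ z)))
                (λ z≈ → cong (λ i → 𝟙 (lookup I i)) (resₚ-cong z≈)) g)
              (trans (∑-cong {p} λ t → cong (λ i → 𝟙 (lookup I i)) (resₚ-toℤ t)) (sym ∣ I ∣≡∑))

        kq³∣I∣≤ : k ℕ.* ((q ℕ.* (q ℕ.* q)) ℕ.* Subset.∣ I ∣) ℕ.≤ p ℕ.* (k ℕ.* (q ℕ.* q) ℕ.+ 2 ℕ.* (q ℕ.* (q ℕ.* q)))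
        kq³∣I∣≤ = ℤ.drop‿+≤+ (begin
          + (k ℕ.* ((q ℕ.* (q ℕ.* q)) ℕ.* Subset.∣ I ∣))
            ≡⟨ trans (ℤ.pos-* k _) (cong (_*_ (+ k))
                (trans (ℤ.pos-* (q ℕ.* (q ℕ.* q)) _) (cong (_* + Subset.∣ I ∣) +q³))) ⟩
          + k * (q³ * + Subset.∣ I ∣)
            ≡⟨ trans (cong (_*_ (+ k)) (sym ∑size)) (sym (∑-*ˡ {p} (+ k) size)) ⟩
          ∑ {p} (λ t → + k * size t)
            ≤⟨ ∑-mono-≤ {p} fibre-bound ⟩
          ∑ {p} (λ t → + k * (+ q * + q) + + 2 * q³)
            ≡⟨ ∑-const p _ ⟩
          + p * (+ k * (+ q * + q) + + 2 * q³)
            ≡⟨ cong (_*_ (+ p)) (sym (cong₂ _+_ (trans (ℤ.pos-* k (q ℕ.* q)) (cong (_*_ (+ k)) (ℤ.pos-* q q)))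
                (trans (ℤ.pos-* 2 (q ℕ.* (q ℕ.* q))) (cong (_*_ (+ 2)) +q³)))) ⟩
          + p * + (k ℕ.* (q ℕ.* q) ℕ.+ 2 ℕ.* (q ℕ.* (q ℕ.* q)))
            ≡⟨ ℤ.pos-* p _ ⟨
          + (p ℕ.* (k ℕ.* (q ℕ.* q) ℕ.+ 2 ℕ.* (q ℕ.* (q ℕ.* q)))) ∎)
          where
          open ℤ.≤-Reasoning
          +q³ : + (q ℕ.* (q ℕ.* q)) ≡ q³
          +q³ = trans (ℤ.pos-* q (q ℕ.* q)) (cong (_*_ (+ q)) (ℤ.pos-* q q))

        -- Replacing one factor q of 2 q³ by 7k makes everything a multiple of k q², with
        -- coefficient 1 + 2 · 7.
        q∣I∣≤15p : q ℕ.≤ 7 ℕ.* k → q ℕ.* Subset.∣ I ∣ ℕ.≤ 15 ℕ.* p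
        q∣I∣≤15p q≤7k = ℕ.*-cancelˡ-≤ (k ℕ.* (q ℕ.* q)) {{ℕ.m*n≢0 k (q ℕ.* q) {{ℕ.>-nonZero 1≤k}} {{ℕ.m*n≢0 q q}}}}
            (begin
          k ℕ.* (q ℕ.* q) ℕ.* (q ℕ.* Subset.∣ I ∣)           ≡⟨ ring₁ k q Subset.∣ I ∣ ⟩
          k ℕ.* ((q ℕ.* (q ℕ.* q)) ℕ.* Subset.∣ I ∣)         ≤⟨ kq³∣I∣≤ ⟩
          p ℕ.* (k ℕ.* (q ℕ.* q) ℕ.+ 2 ℕ.* (q ℕ.* (q ℕ.* q)))
            ≤⟨ ℕ.*-monoʳ-≤ p (ℕ.+-monoʳ-≤ (k ℕ.* (q ℕ.* q)) (ℕ.*-monoʳ-≤ 2 (ℕ.*-monoˡ-≤ (q ℕ.* q) q≤7k))) ⟩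
          p ℕ.* (k ℕ.* (q ℕ.* q) ℕ.+ 2 ℕ.* (7 ℕ.* k ℕ.* (q ℕ.* q)))  ≡⟨ ring₂ p k q ⟩
          k ℕ.* (q ℕ.* q) ℕ.* (15 ℕ.* p) ∎)
          where
          open ℕ.≤-Reasoning
          ring₁ : ∀ k q x → k ℕ.* (q ℕ.* q) ℕ.* (q ℕ.* x) ≡ k ℕ.* ((q ℕ.* (q ℕ.* q)) ℕ.* x)
          ring₁ = ℕ-Solver.solve-∀
          ring₂ : ∀ p k q → p ℕ.* (k ℕ.* (q ℕ.* q) ℕ.+ 2 ℕ.* (7 ℕ.* k ℕ.* (q ℕ.* q))) ≡ k ℕ.* (q ℕ.* q) ℕ.* (15 ℕ.* p)
          ring₂ = ℕ-Solver.solve-∀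

      private
        r′ y′ : ℕ
        r′ = ℕ.pred (2 ℕ.* k)
        y′ = ℕ.pred q

        -- The shift by one skips the parameter 0; `y-of` does the same.
        ρ-of : Fin r′ → Fin (2 ℕ.* k)
        ρ-of i = subst Fin (ℕ.suc-pred (2 ℕ.* k) {{ℕ.m*n≢0 2 k {{_}} {{ℕ.>-nonZero 1≤k}}}}) (suc i)

        y-of : Fin y′ → Fin q
        y-of i = subst Fin (ℕ.suc-pred q) (suc i)

        toℕ-subst : ∀ {m n} (eq : m ≡ n) (i : Fin m) → toℕ (subst Fin eq i) ≡ toℕ i
        toℕ-subst refl i = refl

        toℕ-ρ-of : ∀ i → toℕ (ρ-of i) ≡ ℕ.suc (toℕ i)
        toℕ-ρ-of i = toℕ-subst _ (suc i)

        toℕ-y-of : ∀ i → toℕ (y-of i) ≡ ℕ.suc (toℕ i)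
        toℕ-y-of i = toℕ-subst (ℕ.suc-pred q) (suc i)

        0F : Fin q
        0F = fromℕ< (ℕ.>-nonZero⁻¹ q)

        toℕ-0F : toℕ 0F ≡ 0
        toℕ-0F = Fin.toℕ-fromℕ< (ℕ.>-nonZero⁻¹ q)

        a-of c-of : Fin r′ → Fin y′ → Fin q
        a-of i j = res (toℤ (ρ-of i) * toℤ (y-of j))
        c-of i j = res (toℤ (ρ-of i) * (toℤ (y-of j) * toℤ (y-of j)))

        -- Differences from the origin alone already supply one interval for each element of S,
        -- which is enough for the lower bound on the size of `A`.
        value : Fin r′ → Fin y′ → Fin w → ℕ
        value i j e = toℕ e ℕ.+ G (a-of i j) (y-of j) (c-of i j) ℕ.* E

        w≤E : w ℕ.≤ E
        w≤E = ℕ.m≤m+n w (w ℕ.+ 0)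

        value<p′ : ∀ i j e → value i j e ℕ.< p
        value<p′ i j e = value<p {N = G (a-of i j) (y-of j) (c-of i j)} (ℕ.<-≤-trans (Fin.toℕ<n e) w≤E)
          (ℕ.<-≤-trans (G<D³ (a-of i j) (y-of j) (c-of i j)) (ℕ.m≤m+n (D ℕ.* D ℕ.* D) _))

        element : Fin r′ → Fin y′ → Fin w → Fin p
        element i j e = fromℕ< (value<p′ i j e)

        element∈A : ∀ i j e → element i j e ∈ A
        element∈A i j e = ∈A⁺ (0F , 0F , 0F , a-of i j , y-of j , c-of i j , y-of j , ρ-of i ,
          ((λ eq → ℕ.0≢1+n (trans (sym eq) (toℕ-y-of j))) , (λ eq → ℕ.0≢1+n (trans (sym eq) (toℕ-ρ-of i))) ,
            ≈-trans (toℤ-res (toℤ (ρ-of i) * toℤ (y-of j))) (0+ _) , 0+ _ ,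
            ≈-trans (toℤ-res (toℤ (ρ-of i) * (toℤ (y-of j) * toℤ (y-of j)))) (0+ _)) , e , near)
          where
          0+ : ∀ x → x ≈ toℤ 0F + x
          0+ x = ≈-reflexive (sym (trans (cong (λ n → + n + x) toℕ-0F) (ℤ.+-identityˡ x)))
          G0≡0 : G 0F 0F 0F ≡ 0
          G0≡0 = trans (cong (λ n → encode n n n) toℕ-0F) refl
          near : toℤ (element i j e) + + (G 0F 0F 0F) * + E ≈ₚ toℤ e + + (G (a-of i j) (y-of j) (c-of i j)) * + E
          near = ≈ₚ-reflexive (trans (cong₂ (λ m n → + m + + n * + E) (Fin.toℕ-fromℕ< (value<p′ i j e)) G0≡0)
            (trans (ℤ.+-identityʳ (+ value i j e)) (cong (_+_ (toℤ e)) (ℤ.pos-* (G (a-of i j) (y-of j) (c-of i j)) E))))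

        -- The offset and the digits are read off from the value. The middle digit is y itself, and
        -- the first digit ρ y then gives ρ after division by y.
        element-injective : ∀ {i i′ j j′ e e′} → element i j e ≡ element i′ j′ e′ → i ≡ i′ × j ≡ j′ × e ≡ e′
        element-injective {i} {i′} {j} {j′} {e} {e′} eq = i≡i′ , j≡j′ , Fin.toℕ-injective (proj₁ digit-e)
          where
          digit-e : toℕ e ≡ toℕ e′ × G (a-of i j) (y-of j) (c-of i j) ≡ G (a-of i′ j′) (y-of j′) (c-of i′ j′)
          digit-e = digits-unique E (ℕ.<-≤-trans (Fin.toℕ<n e) w≤E) (ℕ.<-≤-trans (Fin.toℕ<n e′) w≤E)
            (trans (sym (Fin.toℕ-fromℕ< (value<p′ i j e))) (trans (cong toℕ eq) (Fin.toℕ-fromℕ< (value<p′ i′ j′ e′))))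
          digit-a : toℕ (a-of i j) ≡ toℕ (a-of i′ j′) × toℕ (y-of j) ℕ.+ toℕ (c-of i j) ℕ.* D ≡ toℕ (y-of j′) ℕ.+ toℕ
              (c-of i′ j′) ℕ.* D
          digit-a = digits-unique D (<D (a-of i j)) (<D (a-of i′ j′)) (proj₂ digit-e)
          y≡y′ : toℕ (y-of j) ≡ toℕ (y-of j′)
          y≡y′ = proj₁ (digits-unique D {m = toℕ (c-of i j)} {m′ = toℕ (c-of i′ j′)} (<D (y-of j)) (<D (y-of j′))
              (proj₂ digit-a))
          j≡j′ : j ≡ j′
          j≡j′ = Fin.toℕ-injective (ℕ.suc-injective (trans (sym (toℕ-y-of j)) (trans y≡y′ (toℕ-y-of j′))))
          ring₁ : ∀ r r′ y → y * (r + - r′) ≡ r * y + - (r′ * y)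
          ring₁ = solve-∀
          ring₂ : ∀ r r′ → r ≡ (r + - r′) + r′
          ring₂ = solve-∀
          ρy≈ρ′y : toℤ (ρ-of i) * toℤ (y-of j) ≈ toℤ (ρ-of i′) * toℤ (y-of j)
          ρy≈ρ′y = ≈-trans (≈-sym (toℤ-res (toℤ (ρ-of i) * toℤ (y-of j))))
              (≈-trans (≈-reflexive (cong +_ (proj₁ digit-a)))
            (≈-trans (toℤ-res (toℤ (ρ-of i′) * toℤ (y-of j′)))
                (≈-reflexive (cong (λ n → toℤ (ρ-of i′) * + n) (sym y≡y′)))))
          ρ-ρ′≈0 : toℤ (ρ-of i) + - toℤ (ρ-of i′) ≈ 0ℤ
          ρ-ρ′≈0 = cancel-unit (toℤ (y-of j)) _ (≉0 (λ eq → ℕ.0≢1+n (trans (sym eq) (toℕ-y-of j))) (Fin.toℕ<n (y-of j)))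
            (≈-trans (≈-reflexive (ring₁ (toℤ (ρ-of i)) (toℤ (ρ-of i′)) (toℤ (y-of j))))
            (≈-trans (≈-+ ρy≈ρ′y (≈-refl { - (toℤ (ρ-of i′) * toℤ (y-of j))}))
                (≈-reflexive (ℤ.+-inverseʳ (toℤ (ρ-of i′) * toℤ (y-of j))))))
          ρ<q : ∀ i → toℕ (ρ-of i) ℕ.< q
          ρ<q i = ℕ.<-≤-trans (Fin.toℕ<n (ρ-of i)) (ℕ.≤-trans (ℕ.*-monoˡ-≤ k (ℕ.s≤s (ℕ.s≤s (ℕ.z≤n {2})))) 4k≤q)
          i≡i′ : i ≡ i′
          i≡i′ = Fin.toℕ-injective (ℕ.suc-injective (trans (sym (toℕ-ρ-of i)) (trans
            (≈-injective-< (ρ<q i) (ρ<q i′) (≈-trans (≈-reflexive (ring₂ (toℤ (ρ-of i)) (toℤ (ρ-of i′))))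
              (≈-trans (≈-+ ρ-ρ′≈0 (≈-refl {toℤ (ρ-of i′)})) (≈-reflexive (ℤ.+-identityˡ (toℤ (ρ-of i′)))))))
            (toℕ-ρ-of i′))))

      ∣A∣≥ : ℕ.pred (2 ℕ.* k) ℕ.* (ℕ.pred q ℕ.* w) ℕ.≤ Subset.∣ A ∣
      ∣A∣≥ = injection₃⇒≤∣ A ∣ element element∈A (λ i i′ j j′ e e′ → element-injective {i} {i′} {j} {j′} {e} {e′})

  -- Colour classes of a sum-free set.

  ∃max : ∀ {n} (f : Fin (ℕ.suc n) → ℤ) → ∃ λ j → ∀ i → f i ≤ᶻ f j
  ∃max {ℕ.zero}  f = zero , λ { zero → ℤ.≤-refl }
  ∃max {ℕ.suc n} f with ∃max (f ∘ suc)
  ... | j , max with ℤ.≤-total (f zero) (f (suc j))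
  ...   | inj₁ f0≤fj = suc j , λ { zero → f0≤fj ; (suc i) → max i }
  ...   | inj₂ fj≤f0 = zero , λ { zero → ℤ.≤-refl ; (suc i) → ℤ.≤-trans (max i) fj≤f0 }

  module _ {n m : ℕ} (A : Subset n) (colour : Fin n → Fin (ℕ.suc m)) where

    colourClass : Fin (ℕ.suc m) → Subset n
    colourClass i = tabulate λ x → lookup A x ∧ does (colour x Fin.≟ i)

    ∈-colourClass⁻ : ∀ {i x} → x ∈ colourClass i → x ∈ A × colour x ≡ i
    ∈-colourClass⁻ {i} {x} x∈ with lookup A x in eq | colour x Fin.≟ i | trans
        (sym (Vec.lookup∘tabulate (λ x → lookup A x ∧ does (colour x Fin.≟ i)) x)) (Vec.[]=⇒lookup x∈)
    ... | true  | yes c≡i | _  = Vec.lookup⇒[]= x A eq , c≡i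
    ... | true  | no _    | ()
    ... | false | _       | ()

    ∣A∣≡∑∣colourClass∣ : + Subset.∣ A ∣ ≡ ∑ λ i → + Subset.∣ colourClass i ∣
    ∣A∣≡∑∣colourClass∣ = begin
      + Subset.∣ A ∣                                                          ≡⟨ ∣ A ∣≡∑ ⟩
      ∑ (λ x → 𝟙 (lookup A x))                                                ≡⟨ ∑-cong (λ x → sym (split x)) ⟩
      ∑ (λ x → ∑ λ i → 𝟙 (lookup A x ∧ does (colour x Fin.≟ i)))              ≡⟨ ∑-swap {n}
          (λ x i → 𝟙 (lookup A x ∧ does (colour x Fin.≟ i))) ⟩
      ∑ (λ i → ∑ λ x → 𝟙 (lookup A x ∧ does (colour x Fin.≟ i)))              ≡⟨ ∑-cong
          (λ i → trans (∑-cong λ x → cong 𝟙 (sym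
          (Vec.lookup∘tabulate (λ x → lookup A x ∧ does (colour x Fin.≟ i)) x))) (sym ∣ colourClass i ∣≡∑)) ⟩
      ∑ (λ i → + Subset.∣ colourClass i ∣)                                     ∎
      where
      open ≡-Reasoning
      does-refl : ∀ x → does (colour x Fin.≟ colour x) ≡ true
      does-refl x with colour x Fin.≟ colour x
      ... | yes _ = refl
      ... | no c≢c = contradiction refl c≢c
      does-≢ : ∀ x i → i ≢ colour x → does (colour x Fin.≟ i) ≡ false
      does-≢ x i i≢c with colour x Fin.≟ i
      ... | yes c≡i = contradiction (sym c≡i) i≢c
      ... | no _    = refl
      split : ∀ x → ∑ (λ i → 𝟙 (lookup A x ∧ does (colour x Fin.≟ i))) ≡ 𝟙 (lookup A x)
      split x = trans (∑-single (λ i → 𝟙 (lookup A x ∧ does (colour x Fin.≟ i))) (colour x)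
          λ i i≢c → cong 𝟙 (trans (cong (lookup A x ∧_) (does-≢ x i i≢c)) (Bool.∧-zeroʳ (lookup A x))))
        (cong 𝟙 (trans (cong (lookup A x ∧_) (does-refl x)) (Bool.∧-identityʳ (lookup A x))))

    ∃-large-colourClass : ∃ λ i → Subset.∣ A ∣ ℕ.≤ ℕ.suc m ℕ.* Subset.∣ colourClass i ∣
    ∃-large-colourClass with ∃max (λ i → + Subset.∣ colourClass i ∣)
    ... | j , max = j , ℤ.drop‿+≤+ (ℤ.≤-trans (ℤ.≤-reflexive ∣A∣≡∑∣colourClass∣) (ℤ.≤-trans (∑-mono-≤ max)
      (ℤ.≤-reflexive (trans (∑-const (ℕ.suc m) (+ Subset.∣ colourClass j ∣))
          (sym (ℤ.pos-* (ℕ.suc m) Subset.∣ colourClass j ∣))))))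

  -- A proper colouring of the graph joining x and 2x on 𝔽_p ∖ {0}: doubling moves x < p/2 either past p/2 or to a
  -- number with ⌊log₂⌋ one larger, and symmetrically for p - x.
  module Doubling (p : ℕ) .{{p≢0 : NonZero p}} where
    open Mod p
    open ModExtra p

    even : ℕ → Bool
    even ℕ.zero    = true
    even (ℕ.suc n) = not (even n)

    evenLog : ℕ → Bool
    evenLog n = even ⌊log₂ n ⌋

    evenLog-2* : ∀ n → n ≢ 0 → evenLog (2 ℕ.* n) ≢ evenLog n
    evenLog-2* n n≢0 eq = Bool.not-¬ refl (trans (sym eq) (cong even (⌊log₂[2*b]⌋≡1+⌊log₂b⌋ n {{ℕ.≢-nonZero n≢0}})))

    low high : Bool → Fin 5
    low  true  = # 1
    low  false = # 2
    high true  = # 3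
    high false = # 4

    colour : Fin p → Fin 5
    colour x with toℕ x ℕ.≟ 0 | 2 ℕ.* toℕ x ℕ.<? p
    ... | yes _ | _     = zero
    ... | no _  | yes _ = low (evenLog (toℕ x))
    ... | no _  | no _  = high (evenLog (p ℕ.∸ toℕ x))

    low-injective : ∀ b c → low b ≡ low c → b ≡ c
    low-injective true  true  _ = refl
    low-injective false false _ = refl

    high-injective : ∀ b c → high b ≡ high c → b ≡ c
    high-injective true  true  _ = refl
    high-injective false false _ = refl

    low≢high : ∀ b c → low b ≢ high c
    low≢high true  true  ()
    low≢high true  false ()
    low≢high false true  ()
    low≢high false false ()

    zero≢low : ∀ b → zero ≢ low b
    zero≢low true  ()
    zero≢low false ()

    zero≢high : ∀ b → zero ≢ high b
    zero≢high true  ()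
    zero≢high false ()

    colour-double : ∀ u v → toℕ u ≢ 0 → toℕ v ≢ 0 → toℤ v ≈ toℤ u + toℤ u → colour u ≢ colour v
    colour-double u v u≢0 v≢0 v≈2u eq with toℕ u ℕ.≟ 0 | toℕ v ℕ.≟ 0 | 2 ℕ.* toℕ u ℕ.<? p | 2 ℕ.* toℕ v ℕ.<? p
    ... | yes u≡0 | _       | _      | _      = u≢0 u≡0
    ... | no _    | yes v≡0 | _      | _      = v≢0 v≡0
    ... | no _    | no _    | yes _  | no _   = low≢high (evenLog (toℕ u)) (evenLog (p ℕ.∸ toℕ v)) eq
    ... | no _    | no _    | no _   | yes _  = low≢high (evenLog (toℕ v)) (evenLog (p ℕ.∸ toℕ u)) (sym eq)
    ... | no _    | no _    | yes 2u<p | yes _ = evenLog-2* (toℕ u) u≢0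
      (trans (cong evenLog (sym v≡2u)) (sym (low-injective _ _ eq)))
      where
      v≡2u : toℕ v ≡ 2 ℕ.* toℕ u
      v≡2u = ≈-injective-< (Fin.toℕ<n v) 2u<p
          (≈-trans v≈2u (≈-reflexive (cong (λ n → + (toℕ u ℕ.+ n)) (sym (ℕ.+-identityʳ (toℕ u))))))
    ... | no _    | no _    | no 2u≮p | no _  = evenLog-2* (p ℕ.∸ toℕ u) (ℕ.m>n⇒m∸n≢0 (Fin.toℕ<n u))
      (trans (cong evenLog (sym p-v≡2[p-u])) (sym (high-injective _ _ eq)))
      where
      open ≡-Reasoning
      p≤2u : p ℕ.≤ 2 ℕ.* toℕ u
      p≤2u = ℕ.≮⇒≥ 2u≮p
      2u-p<p : 2 ℕ.* toℕ u ℕ.∸ p ℕ.< p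
      2u-p<p = ℕ.+-cancelʳ-< p _ _ (subst₂ ℕ._<_ (sym (ℕ.m∸n+n≡m p≤2u)) (cong (p ℕ.+_) (ℕ.+-identityʳ p))
          (ℕ.*-monoʳ-< 2 (Fin.toℕ<n u)))
      v≡2u-p : toℕ v ≡ 2 ℕ.* toℕ u ℕ.∸ p
      v≡2u-p = ≈-injective-< (Fin.toℕ<n v) 2u-p<p (≈-trans v≈2u (mod 1ℤ (trans (cong +_ (begin
        toℕ u ℕ.+ toℕ u                   ≡⟨ cong (toℕ u ℕ.+_) (sym (ℕ.+-identityʳ (toℕ u))) ⟩
        2 ℕ.* toℕ u                       ≡⟨ sym (ℕ.m∸n+n≡m p≤2u) ⟩
        2 ℕ.* toℕ u ℕ.∸ p ℕ.+ p           ∎)) (cong (_+_ (+ (2 ℕ.* toℕ u ℕ.∸ p))) (sym (ℤ.*-identityˡ (+ p)))))))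
      p-v≡2[p-u] : p ℕ.∸ toℕ v ≡ 2 ℕ.* (p ℕ.∸ toℕ u)
      p-v≡2[p-u] = begin
        p ℕ.∸ toℕ v                       ≡⟨ cong (p ℕ.∸_) v≡2u-p ⟩
        p ℕ.∸ (2 ℕ.* toℕ u ℕ.∸ p)         ≡⟨ sym (ℕ.[m+n]∸[m+o]≡n∸o p p _) ⟩
        p ℕ.+ p ℕ.∸ (p ℕ.+ (2 ℕ.* toℕ u ℕ.∸ p))  ≡⟨ cong₂ ℕ._∸_ (cong (p ℕ.+_) (sym (ℕ.+-identityʳ p)))
            (ℕ.m+[n∸m]≡n p≤2u) ⟩
        2 ℕ.* p ℕ.∸ 2 ℕ.* toℕ u           ≡⟨ sym (ℕ.*-distribˡ-∸ 2 p (toℕ u)) ⟩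
        2 ℕ.* (p ℕ.∸ toℕ u)               ∎

    colour-zero : ∀ u → colour u ≡ zero → toℕ u ≡ 0
    colour-zero u eq with toℕ u ℕ.≟ 0 | 2 ℕ.* toℕ u ℕ.<? p
    ... | yes u≡0 | _     = u≡0
    ... | no _    | yes _ = contradiction (sym eq) (zero≢low (evenLog (toℕ u)))
    ... | no _    | no _  = contradiction (sym eq) (zero≢high (evenLog (p ℕ.∸ toℕ u)))

    zero-colour : ∀ u → toℕ u ≡ 0 → colour u ≡ zero
    zero-colour u u≡0 with toℕ u ℕ.≟ 0 | 2 ℕ.* toℕ u ℕ.<? p
    ... | yes _  | _ = refl
    ... | no u≢0 | _ = contradiction u≡0 u≢0

    -- An arc from u to v labelled a is a Schur triple u + a = v inside A, so two of its members
    -- coincide. As u ≠ v, either a = u and v = 2u, excluded by the colouring, or a = v and u = 0;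
    -- the colour of 0 is given to no other vertex.
    colourClass-independent : ∀ A → SchurSolutionFree p A → ∀ i → Independent p A (colourClass A colour i)
    colourClass-independent A A-free i u v u∈ v∈ u≢v (a , a∈A , p∣) with ∈-colourClass⁻ A colour u∈ | ∈-colourClass⁻ A
        colour v∈ | u Fin.≟ a | a Fin.≟ v
    ... | u∈A , u-i | v∈A , v-i | yes refl | _ = colour-double u v u≢0 v≢0
        (≈-trans (≈-reflexive (ring₁ (toℤ v) (toℤ u)))
        (≈-trans (≈-+ (∣⇒≈0 {(toℤ v + - toℤ u) + - toℤ u} p∣) (≈-refl {toℤ u + toℤ u}))
            (≈-reflexive (ℤ.+-identityˡ (toℤ u + toℤ u))))) (trans u-i (sym v-i))
      where
      ring₁ : ∀ v u → v ≡ ((v + - u) + - u) + (u + u)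
      ring₁ = solve-∀
      v≢0 : toℕ v ≢ 0
      v≢0 v≡0 = u≢v (Fin.toℕ-injective (trans (colour-zero u (trans u-i (trans (sym v-i) (zero-colour v v≡0))))
          (sym v≡0)))
      u≢0 : toℕ u ≢ 0
      u≢0 u≡0 = u≢v (Fin.toℕ-injective
          (trans u≡0 (sym (colour-zero v (trans v-i (trans (sym u-i) (zero-colour u u≡0)))))))
    ... | u∈A , u-i | v∈A , v-i | no _ | yes refl =
        u≢v (Fin.toℕ-injective (trans u≡0 (sym (colour-zero v (trans v-i (trans (sym u-i) (zero-colour u u≡0)))))))
      where
      ring₁ : ∀ v u → u ≡ - ((v + - u) + - v)
      ring₁ = solve-∀
      u≡0 : toℕ u ≡ 0
      u≡0 = ℤ.+-injective (small-≈0 (Fin.toℕ<n u) (≈-trans (≈-reflexive (ring₁ (toℤ v) (toℤ u))) (≈-neg (∣⇒≈0 p∣))))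
    ... | u∈A , u-i | v∈A , v-i | no u≢a | no a≢v = A-free (u , a , v , u∈A , a∈A , v∈A , u≢a , u≢v , a≢v ,
        ≈0⇒∣ {(toℤ u + toℤ a) + - toℤ v} (≈-trans (≈-reflexive (ring₁ (toℤ u) (toℤ a) (toℤ v))) (≈-neg (∣⇒≈0 p∣))))
      where
      ring₁ : ∀ u a v → (u + a) + - v ≡ - ((v + - u) + - a)
      ring₁ = solve-∀

open import Data.Integer using (+_)
open import Data.Rational using (ℚ; 0ℚ; 1ℚ; _<_; _≤_; _*_)
open import Data.Rational as ℚ using (mkℚ; toℚᵘ)
import Data.Rational.Properties as ℚ
open import Data.Rational.Unnormalised as ℚᵘ using (mkℚᵘ; *≡*)
import Data.Rational.Unnormalised.Properties as ℚᵘ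
open import Algebra.Bundles using (CommutativeMonoid)
open import Algebra.Properties.CommutativeSemigroup (CommutativeMonoid.commutativeSemigroup ℚ.*-1-commutativeMonoid)
    using (interchange)
open Primes using (powerBelow; prime-between)
open SchurGraphs using (colourClass; ∃-large-colourClass; module Embedding; module Doubling)

-- Rational arithmetic and the upper bound.

toℚᵘ-ℕ→ℚ : ∀ n → toℚᵘ (ℕ→ℚ n) ℚᵘ.≃ mkℚᵘ (+ n) 0
toℚᵘ-ℕ→ℚ n = ℚ.toℚᵘ-fromℚᵘ (mkℚᵘ (+ n) 0)

ℕ→ℚ-mono : ∀ {m n} → m ℕ.≤ n → ℕ→ℚ m ≤ ℕ→ℚ n
ℕ→ℚ-mono {m} {n} m≤n = ℚ.toℚᵘ-cancel-≤ (ℚᵘ.≤-respˡ-≃ (ℚᵘ.≃-sym (toℚᵘ-ℕ→ℚ m)) (ℚᵘ.≤-respʳ-≃ (ℚᵘ.≃-sym (toℚᵘ-ℕ→ℚ n))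
  (ℚᵘ.*≤* (ℤ.*-monoʳ-≤-nonNeg (+ 1) (ℤ.+≤+ m≤n)))))

ℕ→ℚ-* : ∀ m n → ℕ→ℚ (m ℕ.* n) ≡ ℕ→ℚ m * ℕ→ℚ n
ℕ→ℚ-* m n = ℚ.toℚᵘ-injective (ℚᵘ.≃-trans (toℚᵘ-ℕ→ℚ (m ℕ.* n)) (ℚᵘ.≃-trans
  (*≡* (cong (ℤ._* + 1) (ℤ.pos-* m n)))
  (ℚᵘ.≃-sym (ℚᵘ.≃-trans (ℚ.toℚᵘ-homo-* (ℕ→ℚ m) (ℕ→ℚ n)) (ℚᵘ.*-cong (toℚᵘ-ℕ→ℚ m) (toℚᵘ-ℕ→ℚ n))))))

0≤ℕ→ℚ : ∀ n → 0ℚ ≤ ℕ→ℚ n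
0≤ℕ→ℚ n = ℕ→ℚ-mono {0} {n} ℕ.z≤n

*-monoˡ : ∀ {x y z} → 0ℚ ≤ z → x ≤ y → z * x ≤ z * y
*-monoˡ {z = z} 0≤z = ℚ.*-monoˡ-≤-nonNeg z {{ℚ.nonNegative 0≤z}}

*-monoʳ : ∀ {x y z} → 0ℚ ≤ z → x ≤ y → x * z ≤ y * z
*-monoʳ {z = z} 0≤z = ℚ.*-monoʳ-≤-nonNeg z {{ℚ.nonNegative 0≤z}}

1/ : ∀ n .{{_ : NonZero n}} → ℚ
1/ n = + 1 ℚ./ n

toℚᵘ-1/ : ∀ n → toℚᵘ (1/ (ℕ.suc n)) ℚᵘ.≃ mkℚᵘ (+ 1) n
toℚᵘ-1/ n = ℚ.toℚᵘ-fromℚᵘ (mkℚᵘ (+ 1) n)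

0<1/ : ∀ n .{{_ : NonZero n}} → 0ℚ < 1/ n
0<1/ (ℕ.suc n) = ℚ.toℚᵘ-cancel-< (ℚᵘ.<-respʳ-≃ (ℚᵘ.≃-sym (toℚᵘ-1/ n)) (ℚᵘ.*<* (ℤ.+<+ (ℕ.s≤s ℕ.z≤n))))

1/n*n≡1 : ∀ n .{{_ : NonZero n}} → 1/ n * ℕ→ℚ n ≡ 1ℚ
1/n*n≡1 n@(ℕ.suc n-1) = ℚ.toℚᵘ-injective (ℚᵘ.≃-trans (ℚ.toℚᵘ-homo-* (1/ n) (ℕ→ℚ n))
  (ℚᵘ.≃-trans (ℚᵘ.*-cong (toℚᵘ-1/ n-1) (toℚᵘ-ℕ→ℚ n))
      (*≡* (trans (ℤ.*-identityʳ (+ 1 ℤ.* + n)) (cong (λ m → + 1 ℤ.* + m) (sym (ℕ.*-identityʳ n)))))))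

-- The witness is ⌊1/ε⌋ + 1. Its excess over 1/ε is at most 1, which ε ≤ 1 turns into ε n ≤ 2.
∃-reciprocal : ∀ ε → 0ℚ < ε → ε ≤ 1ℚ → ∃ λ n → 1 ℕ.≤ n × 1ℚ ≤ ε * ℕ→ℚ n × ε * ℕ→ℚ n ≤ ℕ→ℚ 2
∃-reciprocal ε@(mkℚ (+ 0) _ _) 0<ε _ = contradiction (ℚ.drop-*<* 0<ε) λ { (ℤ.+<+ ()) }
∃-reciprocal ε@(mkℚ ℤ.-[1+ _ ] _ _) 0<ε _ = contradiction (ℚ.drop-*<* 0<ε) λ ()
∃-reciprocal ε@(mkℚ (+ a@(ℕ.suc _)) d-1 _) 0<ε ε≤1 = n , ℕ.s≤s ℕ.z≤n , 1≤εn , εn≤2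
  where
  d n : ℕ
  d = ℕ.suc d-1
  n = ℕ.suc (d ℕ./ a)
  a≤d : a ℕ.≤ d
  a≤d = ℤ.drop‿+≤+ (subst₂ ℤ._≤_ (ℤ.*-identityʳ (+ a)) (ℤ.*-identityˡ (+ d)) (ℚ.drop-*≤* ε≤1))
  toℚᵘ-εn : toℚᵘ (ε * ℕ→ℚ n) ℚᵘ.≃ mkℚᵘ (+ a) d-1 ℚᵘ.* mkℚᵘ (+ n) 0
  toℚᵘ-εn = ℚᵘ.≃-trans (ℚ.toℚᵘ-homo-* ε (ℕ→ℚ n)) (ℚᵘ.*-cong (ℚᵘ.≃-refl {mkℚᵘ (+ a) d-1}) (toℚᵘ-ℕ→ℚ n))
  d≤an : d ℕ.≤ a ℕ.* n
  d≤an = begin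
    d                             ≡⟨ ℕ.m≡m%n+[m/n]*n d a ⟩
    d ℕ.% a ℕ.+ (d ℕ./ a) ℕ.* a   ≤⟨ ℕ.+-monoˡ-≤ ((d ℕ./ a) ℕ.* a) (ℕ.<⇒≤ (ℕ.m%n<n d a)) ⟩
    n ℕ.* a                       ≡⟨ ℕ.*-comm n a ⟩
    a ℕ.* n                       ∎
    where open ℕ.≤-Reasoning
  an≤2d : a ℕ.* n ℕ.≤ 2 ℕ.* d
  an≤2d = begin
    a ℕ.* n                ≡⟨ ℕ.*-comm a n ⟩
    a ℕ.+ (d ℕ./ a) ℕ.* a  ≤⟨ ℕ.+-mono-≤ a≤d (ℕ.m/n*n≤m d a) ⟩
    d ℕ.+ d                ≡⟨ cong (d ℕ.+_) (sym (ℕ.+-identityʳ d)) ⟩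
    2 ℕ.* d                ∎
    where open ℕ.≤-Reasoning
  1≤εn : 1ℚ ≤ ε * ℕ→ℚ n
  1≤εn = ℚ.toℚᵘ-cancel-≤ (ℚᵘ.≤-respʳ-≃ (ℚᵘ.≃-sym toℚᵘ-εn) (ℚᵘ.*≤* (subst₂ ℤ._≤_
    (trans (cong +_ (sym (ℕ.*-identityʳ d))) (sym (ℤ.*-identityˡ (+ (d ℕ.* 1)))))
        (trans (ℤ.pos-* a n) (sym (ℤ.*-identityʳ (+ a ℤ.* + n)))) (ℤ.+≤+ d≤an))))
  εn≤2 : ε * ℕ→ℚ n ≤ ℕ→ℚ 2
  εn≤2 = ℚ.toℚᵘ-cancel-≤ (ℚᵘ.≤-respˡ-≃ (ℚᵘ.≃-sym toℚᵘ-εn) (ℚᵘ.*≤* (subst₂ ℤ._≤_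
    (trans (ℤ.pos-* a n) (sym (ℤ.*-identityʳ (+ a ℤ.* + n))))
        (trans (ℤ.pos-* 2 d) (cong (λ m → + 2 ℤ.* + m) (sym (ℕ.*-identityʳ d)))) (ℤ.+≤+ an≤2d))))

upper : ∀ ε → 0ℚ < ε → dAtMost ε (ℕ→ℚ 5 * ε)
-- The estimate holds for every prime, so the threshold can be 0.
upper ε 0<ε δ 0<δ = 0 , λ p p-prime _ A (A-free , α≤) → bound p p-prime A A-free α≤
  where
  x≤x+δ : ∀ x → x ≤ x ℚ.+ δ
  x≤x+δ x = subst (_≤ x ℚ.+ δ) (ℚ.+-identityʳ x) (ℚ.+-monoʳ-≤ x (ℚ.<⇒≤ 0<δ))
  bound : ∀ p → Prime p → ∀ A → SchurSolutionFree p A → AlphaAtMost p A ε → ℕ→ℚ Subset.∣ A ∣ ≤ (ℕ→ℚ 5 * ε ℚ.+ δ) * ℕ→ℚ p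
  bound p p-prime A A-free α≤ = begin
    ℕ→ℚ Subset.∣ A ∣                ≤⟨ ℕ→ℚ-mono (proj₂ large) ⟩
    ℕ→ℚ (5 ℕ.* Subset.∣ Aᵢ ∣)       ≡⟨ ℕ→ℚ-* 5 Subset.∣ Aᵢ ∣ ⟩
    ℕ→ℚ 5 * ℕ→ℚ Subset.∣ Aᵢ ∣       ≤⟨ *-monoˡ (0≤ℕ→ℚ 5)
        (α≤ Aᵢ (Doubling.colourClass-independent p {{prime⇒nonZero p-prime}} A A-free (proj₁ large))) ⟩
    ℕ→ℚ 5 * (ε * ℕ→ℚ p)             ≡⟨ ℚ.*-assoc (ℕ→ℚ 5) ε (ℕ→ℚ p) ⟨
    ℕ→ℚ 5 * ε * ℕ→ℚ p               ≤⟨ *-monoʳ (0≤ℕ→ℚ p) (x≤x+δ (ℕ→ℚ 5 * ε)) ⟩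
    (ℕ→ℚ 5 * ε ℚ.+ δ) * ℕ→ℚ p       ∎
    where
    open ℚ.≤-Reasoning
    colour = Doubling.colour p {{prime⇒nonZero p-prime}}
    large : ∃ λ i → Subset.∣ A ∣ ℕ.≤ 5 ℕ.* Subset.∣ colourClass A colour i ∣
    large = ∃-large-colourClass A colour
    Aᵢ : Subset p
    Aᵢ = colourClass A colour (proj₁ large)

-- Choice of the primes and the parameters.

n<2^n : ∀ n → n ℕ.< 2 ℕ.^ n
n<2^n ℕ.zero    = ℕ.≤-refl
n<2^n (ℕ.suc n) = ℕ.+-mono-≤-< (ℕ.m^n>0 2 n) (ℕ.<-≤-trans (n<2^n n) (ℕ.m≤m+n (2 ℕ.^ n) 0))

∃-prime> : ∀ n → ∃ λ p → Prime p × n ℕ.< p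
∃-prime> n with prime-between n
... | p , p-prime , 2^<p , _ = p , p-prime ,
    ℕ.<-trans (ℕ.<-trans (n<2^n n) (ℕ.^-monoʳ-< 2 (ℕ.s≤s (ℕ.s≤s ℕ.z≤n)) (ℕ.m≤n+m (ℕ.suc n) 1))) 2^<p

-- If 2^(e+1) ≤ n < 2^(e+2), then a prime in (2^(e+2), 2^(e+9)] exceeds n and is at most 2^8 ·
-- 2^(e+1) ≤ 256 n.
∃-prime-near : ∀ n → 2 ℕ.≤ n → ∃ λ q → Prime q × n ℕ.< q × q ℕ.≤ 256 ℕ.* n
∃-prime-near n 2≤n with powerBelow 2 n (ℕ.s≤s (ℕ.s≤s ℕ.z≤n)) (ℕ.≤-trans (ℕ.s≤s ℕ.z≤n) 2≤n)
... | ℕ.zero  , _     , n<2  = contradiction n<2 (ℕ.≤⇒≯ 2≤n)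
... | ℕ.suc e , 2^e≤n , n<2^ with prime-between e
...   | q , q-prime , 2^<q , q≤ = q , q-prime , ℕ.<-trans n<2^ 2^<q , (begin
  q                            ≤⟨ q≤ ⟩
  2 ℕ.^ (8 ℕ.+ ℕ.suc e)        ≡⟨ ℕ.^-distribˡ-+-* 2 8 (ℕ.suc e) ⟩
  256 ℕ.* 2 ℕ.^ ℕ.suc e        ≤⟨ ℕ.*-monoʳ-≤ 256 2^e≤n ⟩
  256 ℕ.* n                    ∎)
  where open ℕ.≤-Reasoning

module Construction (n : ℕ) (1≤n : 1 ℕ.≤ n) (N : ℕ) where
  private
    2≤15n : 2 ℕ.≤ 15 ℕ.* n
    2≤15n = ℕ.≤-trans (ℕ.s≤s (ℕ.s≤s ℕ.z≤n)) (ℕ.*-monoʳ-≤ 15 1≤n)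

    -- Taken above 15 n so that q |I| ≤ 15 p becomes n |I| ≤ p; the price is q ≤ 256 · 15 n = 3840
    -- n.
    q : ℕ
    q = proj₁ (∃-prime-near (15 ℕ.* n) 2≤15n)

    q-prime : Prime q
    q-prime = proj₁ (proj₂ (∃-prime-near (15 ℕ.* n) 2≤15n))

    15n<q : 15 ℕ.* n ℕ.< q
    15n<q = proj₁ (proj₂ (proj₂ (∃-prime-near (15 ℕ.* n) 2≤15n)))

    q≤3840n : q ℕ.≤ 3840 ℕ.* n
    q≤3840n = ℕ.≤-trans (proj₂ (proj₂ (proj₂ (∃-prime-near (15 ℕ.* n) 2≤15n))))
        (ℕ.≤-reflexive (sym (ℕ.*-assoc 256 15 n)))

    k : ℕ
    k = q ℕ./ 4

    4k≤q : 4 ℕ.* k ℕ.≤ q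
    4k≤q = subst (ℕ._≤ q) (ℕ.*-comm k 4) (ℕ.m/n*n≤m q 4)

    1≤k : 1 ℕ.≤ k
    1≤k = ℕ.m≥n⇒m/n>0 {q} {4} (ℕ.≤-trans (ℕ.≤-trans (ℕ.m≤m+n 4 11) (ℕ.*-monoʳ-≤ 15 1≤n)) (ℕ.<⇒≤ 15n<q))

    q≤7k : q ℕ.≤ 7 ℕ.* k
    q≤7k = begin
      q                      ≡⟨ ℕ.m≡m%n+[m/n]*n q 4 ⟩
      q ℕ.% 4 ℕ.+ k ℕ.* 4    ≤⟨ ℕ.+-monoˡ-≤ (k ℕ.* 4) (ℕ.≤-trans (ℕ.s≤s⁻¹ (ℕ.m%n<n q 4)) (ℕ.*-monoʳ-≤ 3 1≤k)) ⟩
      3 ℕ.* k ℕ.+ k ℕ.* 4    ≡⟨ ring₁ k ⟩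
      7 ℕ.* k                ∎
      where
      open ℕ.≤-Reasoning
      ring₁ : ∀ k → 3 ℕ.* k ℕ.+ k ℕ.* 4 ≡ 7 ℕ.* k
      ring₁ = ℕ-Solver.solve-∀

    -- `S` is the room needed per unit of interval length, so w = ⌊p/S⌋ is the largest length that
    -- fits; p > S ensures w ≥ 1.
    D³ S : ℕ
    D³ = (4 ℕ.* q) ℕ.* (4 ℕ.* q) ℕ.* (4 ℕ.* q)
    S = 3 ℕ.* D³ ℕ.* 2

    instance
      q≢0 : NonZero q
      q≢0 = prime⇒nonZero q-prime
      4q≢0 : NonZero (4 ℕ.* q)
      4q≢0 = ℕ.m*n≢0 4 q
      D³≢0 : NonZero D³
      D³≢0 = ℕ.m*n≢0 (4 ℕ.* q ℕ.* (4 ℕ.* q)) (4 ℕ.* q) {{ℕ.m*n≢0 (4 ℕ.* q) (4 ℕ.* q)}}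
      S≢0 : NonZero S
      S≢0 = ℕ.m*n≢0 (3 ℕ.* D³) 2 {{ℕ.m*n≢0 3 D³}}

  p : ℕ
  p = proj₁ (∃-prime> (N ℕ.+ S))

  p-prime : Prime p
  p-prime = proj₁ (proj₂ (∃-prime> (N ℕ.+ S)))

  private
    N+S<p : N ℕ.+ S ℕ.< p
    N+S<p = proj₂ (proj₂ (∃-prime> (N ℕ.+ S)))

  N≤p : N ℕ.≤ p
  N≤p = ℕ.≤-trans (ℕ.m≤m+n N S) (ℕ.<⇒≤ N+S<p)

  private
    w : ℕ
    w = p ℕ./ S

    1≤w : 1 ℕ.≤ w
    1≤w = ℕ.m≥n⇒m/n>0 {p} {S} (ℕ.≤-trans (ℕ.m≤n+m S N) (ℕ.<⇒≤ N+S<p))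

    instance
      p≢0 : NonZero p
      p≢0 = prime⇒nonZero p-prime

    fits : 3 ℕ.* D³ ℕ.* (2 ℕ.* w) ℕ.≤ p
    fits = subst (ℕ._≤ p) (ring₁ w (3 ℕ.* D³)) (ℕ.m/n*n≤m p S)
      where
      ring₁ : ∀ w x → w ℕ.* (x ℕ.* 2) ≡ x ℕ.* (2 ℕ.* w)
      ring₁ = ℕ-Solver.solve-∀

    module E = Embedding q q-prime k 1≤k 4k≤q w 1≤w p

  A : Subset p
  A = E.A fits

  A-free : SchurSolutionFree p A
  A-free = E.A-sumFree fits

  n∣I∣≤p : ∀ I → Independent p A I → n ℕ.* Subset.∣ I ∣ ℕ.≤ p
  n∣I∣≤p I I-independent = ℕ.*-cancelˡ-≤ 15 (begin
    15 ℕ.* (n ℕ.* Subset.∣ I ∣)    ≡⟨ ℕ.*-assoc 15 n Subset.∣ I ∣ ⟨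
    15 ℕ.* n ℕ.* Subset.∣ I ∣      ≤⟨ ℕ.*-monoˡ-≤ Subset.∣ I ∣ (ℕ.<⇒≤ 15n<q) ⟩
    q ℕ.* Subset.∣ I ∣             ≤⟨ E.q∣I∣≤15p fits I I-independent q≤7k ⟩
    15 ℕ.* p                       ∎)
    where open ℕ.≤-Reasoning

  -- Rounding costs p ≤ 2 w S = 768 q³ w. Two of the factors q are replaced by 7 (2k - 1) and 2 (q -
  -- 1), to match the count of `A`, and the third by 3840 n; the constant is 768 · 7 · 2 = 10752.
  p≤Kn∣A∣ : p ℕ.≤ 10752 ℕ.* 3840 ℕ.* (n ℕ.* Subset.∣ A ∣)
  p≤Kn∣A∣ = begin
    p                                      ≡⟨ ℕ.m≡m%n+[m/n]*n p S ⟩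
    p ℕ.% S ℕ.+ w ℕ.* S                    ≤⟨ ℕ.+-monoˡ-≤ (w ℕ.* S)
        (ℕ.≤-trans (ℕ.<⇒≤ (ℕ.m%n<n p S)) (ℕ.m≤n*m S w {{ℕ.>-nonZero 1≤w}})) ⟩
    w ℕ.* S ℕ.+ w ℕ.* S                    ≡⟨ ring₁ w q ⟩
    768 ℕ.* q ℕ.* (q ℕ.* (q ℕ.* w))        ≤⟨ ℕ.*-monoʳ-≤ (768 ℕ.* q) (ℕ.*-mono-≤ q≤7[2k-1] (ℕ.*-monoˡ-≤ w q≤2[q-1])) ⟩
    768 ℕ.* q ℕ.* (7 ℕ.* ℕ.pred (2 ℕ.* k) ℕ.* (2 ℕ.* ℕ.pred q ℕ.* w))
                                           ≡⟨ ring₂ q (ℕ.pred (2 ℕ.* k)) (ℕ.pred q) w ⟩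
    10752 ℕ.* q ℕ.* (ℕ.pred (2 ℕ.* k) ℕ.* (ℕ.pred q ℕ.* w))
                                           ≤⟨ ℕ.*-mono-≤ (ℕ.*-monoʳ-≤ 10752 q≤3840n) (E.∣A∣≥ fits) ⟩
    10752 ℕ.* (3840 ℕ.* n) ℕ.* Subset.∣ A ∣  ≡⟨ ring₃ 10752 3840 n Subset.∣ A ∣ ⟩
    10752 ℕ.* 3840 ℕ.* (n ℕ.* Subset.∣ A ∣)  ∎
    where
    open ℕ.≤-Reasoning
    ring₁ : ∀ w q → w ℕ.* (3 ℕ.* ((4 ℕ.* q) ℕ.* (4 ℕ.* q) ℕ.* (4 ℕ.* q)) ℕ.* 2) ℕ.+ w ℕ.*
        (3 ℕ.* ((4 ℕ.* q) ℕ.* (4 ℕ.* q) ℕ.* (4 ℕ.* q)) ℕ.* 2)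
      ≡ 768 ℕ.* q ℕ.* (q ℕ.* (q ℕ.* w))
    ring₁ = ℕ-Solver.solve-∀
    ring₂ : ∀ q x y w → 768 ℕ.* q ℕ.* (7 ℕ.* x ℕ.* (2 ℕ.* y ℕ.* w)) ≡ 10752 ℕ.* q ℕ.* (x ℕ.* (y ℕ.* w))
    ring₂ = ℕ-Solver.solve-∀
    ring₃ : ∀ x y n z → x ℕ.* (y ℕ.* n) ℕ.* z ≡ x ℕ.* y ℕ.* (n ℕ.* z)
    ring₃ = ℕ-Solver.solve-∀
    m≤pred[2m] : ∀ {m} → 1 ℕ.≤ m → m ℕ.≤ ℕ.pred (2 ℕ.* m)
    m≤pred[2m] {ℕ.suc m} _ = subst (ℕ.suc m ℕ.≤_) (sym (ℕ.+-suc m (m ℕ.+ 0))) (ℕ.s≤s (ℕ.m≤m+n m (m ℕ.+ 0)))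
    m≤2pred[m] : ∀ {m} → 2 ℕ.≤ m → m ℕ.≤ 2 ℕ.* ℕ.pred m
    m≤2pred[m] {ℕ.suc (ℕ.suc m)} _ =
        ℕ.s≤s (subst (ℕ.suc m ℕ.≤_) (sym (ℕ.+-suc m (m ℕ.+ 0))) (ℕ.s≤s (ℕ.m≤m+n m (m ℕ.+ 0))))
    m≤2pred[m] {ℕ.suc ℕ.zero} (ℕ.s≤s ())
    q≤7[2k-1] : q ℕ.≤ 7 ℕ.* ℕ.pred (2 ℕ.* k)
    q≤7[2k-1] = ℕ.≤-trans q≤7k (ℕ.*-monoʳ-≤ 7 (m≤pred[2m] 1≤k))
    q≤2[q-1] : q ℕ.≤ 2 ℕ.* ℕ.pred q
    q≤2[q-1] = m≤2pred[m] (ℕ.≤-trans 2≤15n (ℕ.<⇒≤ 15n<q))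

-- From integer estimates to the lower density.

-- The extra 2 in the denominator absorbs the loss ε n ≤ 2 from replacing ε by a reciprocal 1/n.
scaled-≤ : ∀ K .{{_ : NonZero (K ℕ.* 2)}} ε n p a → 0ℚ ≤ ε → ε * ℕ→ℚ n ≤ ℕ→ℚ 2 → p ℕ.≤ K ℕ.* (n ℕ.* a) →
           1/ (K ℕ.* 2) * ε * ℕ→ℚ p ≤ ℕ→ℚ a
scaled-≤ K ε n p a 0≤ε εn≤2 p≤Kna = begin
  c * ε * ℕ→ℚ p                               ≤⟨ *-monoˡ (*-nonneg 0≤c 0≤ε) (ℕ→ℚ-mono p≤Kna) ⟩
  c * ε * ℕ→ℚ (K ℕ.* (n ℕ.* a))               ≡⟨ cong (c * ε *_)
      (trans (ℕ→ℚ-* K (n ℕ.* a)) (cong (ℕ→ℚ K *_) (ℕ→ℚ-* n a))) ⟩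
  c * ε * (ℕ→ℚ K * (ℕ→ℚ n * ℕ→ℚ a))           ≡⟨ interchange c ε (ℕ→ℚ K) (ℕ→ℚ n * ℕ→ℚ a) ⟩
  c * ℕ→ℚ K * (ε * (ℕ→ℚ n * ℕ→ℚ a))           ≡⟨ cong (c * ℕ→ℚ K *_) (sym (ℚ.*-assoc ε (ℕ→ℚ n) (ℕ→ℚ a))) ⟩
  c * ℕ→ℚ K * (ε * ℕ→ℚ n * ℕ→ℚ a)             ≤⟨ *-monoˡ (*-nonneg 0≤c (0≤ℕ→ℚ K)) (*-monoʳ (0≤ℕ→ℚ a) εn≤2) ⟩
  c * ℕ→ℚ K * (ℕ→ℚ 2 * ℕ→ℚ a)                 ≡⟨ ℚ.*-assoc (c * ℕ→ℚ K) (ℕ→ℚ 2) (ℕ→ℚ a) ⟨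
  c * ℕ→ℚ K * ℕ→ℚ 2 * ℕ→ℚ a                   ≡⟨ cong (_* ℕ→ℚ a) (trans (ℚ.*-assoc c (ℕ→ℚ K) (ℕ→ℚ 2))
                                                   (trans (cong (c *_) (sym (ℕ→ℚ-* K 2))) (1/n*n≡1 (K ℕ.* 2)))) ⟩
  1ℚ * ℕ→ℚ a                                  ≡⟨ ℚ.*-identityˡ (ℕ→ℚ a) ⟩
  ℕ→ℚ a                                       ∎
  where
  open ℚ.≤-Reasoning
  c : ℚ
  c = 1/ (K ℕ.* 2)
  0≤c : 0ℚ ≤ c
  0≤c = ℚ.<⇒≤ (0<1/ (K ℕ.* 2))
  *-nonneg : ∀ {x y} → 0ℚ ≤ x → 0ℚ ≤ y → 0ℚ ≤ x * y
  *-nonneg {x} {y} 0≤x 0≤y = subst (_≤ x * y) (ℚ.*-zeroʳ x) (*-monoˡ 0≤x 0≤y)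

-- The lower bound for ε of order 1/n in integer form: α ≤ p / n and |A| ≥ p / (K n).
DenseSet : ℕ → ℕ → ℕ → Set
DenseSet K n p = Σ (Subset p) λ A → SchurSolutionFree p A × (∀ I → Independent p A I → n ℕ.* Subset.∣ I ∣ ℕ.≤ p) ×
    p ℕ.≤ K ℕ.* (n ℕ.* Subset.∣ A ∣)

abstract
  ∃-denseSet : ∀ n → 1 ℕ.≤ n → ∀ N → ∃ λ p → Prime p × N ℕ.≤ p × DenseSet (10752 ℕ.* 3840) n p
  ∃-denseSet n 1≤n N = p , p-prime , N≤p , A , A-free , n∣I∣≤p , p≤Kn∣A∣
    where open Construction n 1≤n N

module _ (K : ℕ) .{{_ : NonZero (K ℕ.* 2)}} where

  denseSet⇒DAtLeast : ∀ ε n p δ → 0ℚ < ε → 1ℚ ≤ ε * ℕ→ℚ n → ε * ℕ→ℚ n ≤ ℕ→ℚ 2 → 0ℚ < δ → DenseSet K n p → DAtLeast ε p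
      (1/ (K ℕ.* 2) * ε ℚ.- δ)
  denseSet⇒DAtLeast ε n p δ 0<ε 1≤εn εn≤2 0<δ (A , A-free , n∣I∣≤p , p≤Kn∣A∣) = A , (A-free , α≤) , large
    where
    open ℚ.≤-Reasoning
    0≤ε : 0ℚ ≤ ε
    0≤ε = ℚ.<⇒≤ 0<ε
    c : ℚ
    c = 1/ (K ℕ.* 2)
    α≤ : AlphaAtMost p A ε
    α≤ I I-independent = begin
      ℕ→ℚ Subset.∣ I ∣                   ≡⟨ ℚ.*-identityˡ (ℕ→ℚ Subset.∣ I ∣) ⟨
      1ℚ * ℕ→ℚ Subset.∣ I ∣              ≤⟨ *-monoʳ (0≤ℕ→ℚ Subset.∣ I ∣) 1≤εn ⟩
      ε * ℕ→ℚ n * ℕ→ℚ Subset.∣ I ∣       ≡⟨ trans (ℚ.*-assoc ε (ℕ→ℚ n) (ℕ→ℚ Subset.∣ I ∣))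
          (cong (ε *_) (sym (ℕ→ℚ-* n Subset.∣ I ∣))) ⟩
      ε * ℕ→ℚ (n ℕ.* Subset.∣ I ∣)       ≤⟨ *-monoˡ 0≤ε (ℕ→ℚ-mono (n∣I∣≤p I I-independent)) ⟩
      ε * ℕ→ℚ p                          ∎
    cε-δ≤cε : c * ε ℚ.- δ ≤ c * ε
    cε-δ≤cε = subst (c * ε ℚ.- δ ≤_) (ℚ.+-identityʳ (c * ε)) (ℚ.+-monoʳ-≤ (c * ε) (ℚ.neg-antimono-≤ (ℚ.<⇒≤ 0<δ)))
    large : (c * ε ℚ.- δ) * ℕ→ℚ p ≤ ℕ→ℚ Subset.∣ A ∣
    large = ℚ.≤-trans (*-monoʳ (0≤ℕ→ℚ p) cε-δ≤cε) (scaled-≤ K ε n p Subset.∣ A ∣ 0≤ε εn≤2 p≤Kn∣A∣)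

  lower : (∀ n → 1 ℕ.≤ n → ∀ N → ∃ λ p → Prime p × N ℕ.≤ p × DenseSet K n p) →
          ∀ ε → 0ℚ < ε → ε ≤ 1ℚ → dAtLeast ε (1/ (K ℕ.* 2) * ε)
  lower denseSet ε 0<ε ε≤1 δ 0<δ N =
    let n , 1≤n , 1≤εn , εn≤2 = ∃-reciprocal ε 0<ε ε≤1
        p , p-prime , N≤p , dense = denseSet n 1≤n N
    in p , p-prime , N≤p , denseSet⇒DAtLeast ε n p δ 0<ε 1≤εn εn≤2 0<δ dense

theorem1p3 : Σ ℚ λ c → Σ ℚ λ C → (0ℚ < c) × (0ℚ < C) × (∀ (ε : ℚ) → 0ℚ < ε → ε ≤ 1ℚ → dAtLeast ε (c * ε) ×
    dAtMost ε (C * ε))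
theorem1p3 = 1/ (10752 ℕ.* 3840 ℕ.* 2) , ℕ→ℚ 5 , 0<1/ (10752 ℕ.* 3840 ℕ.* 2) , ℚ.positive⁻¹ (ℕ→ℚ 5) ,
  λ ε 0<ε ε≤1 → lower (10752 ℕ.* 3840) ∃-denseSet ε 0<ε ε≤1 , upper ε 0<ε
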